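{- (a) For every fixed $\eta>0$ there are constants $c_\eta,C>0$ such that for all sufficiently large $n$ and all $\epsilon$ with $0\le \epsilon\le \frac14-\eta$ we have $c_\eta n\le P(n,\epsilon,2)\le Cn$; that is, $P(n,\epsilon,2)=\Theta(n)$ for $\epsilon<1/4$ bounded away from $1/4$. (b) For $n^{ -1/2}\le \epsilon\le \epsilon_0$, where $\epsilon_0>0$ is a suitable absolute constant, $P(n,\epsilon,3)=\Theta(1/\epsilon^2)$, i.e. $c/\epsilon^2\le P(n,\epsilon,3)\le C/\epsilon^2$ for absolute constants $c,C>0$. (c) For $n^{ -1}\le \epsilon\le \epsilon_0$, where $\epsilon_0>0$ is a suitable absolute constant, $P(n,\epsilon,4)=\Theta(1/\epsilon)$, i.e. $c/\epsilon\le P(n,\epsilon,4)\le C/\epsilon$ for absolute constants $c,C>0$.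
   Context: Graphs are finite and simple. The distance between two vertices is the length of a shortest path between them; the diameter of a connected graph is the maximum distance between two of its vertices, and a disconnected graph has diameter $\infty$. For an edge subset $E'\subseteq E$ of a graph $G=(V,E)$, the diameter of $E'$ is the diameter of the graph with edge set $E'$ whose vertex set is the set of vertices of $G$ lying in at least one edge of $E'$. $P(n,\epsilon,d)$ denotes the smallest $\ell$ such that every graph $G=(V,E)$ on $n$ vertices has an edge partition $E=E_0\cup E_1\cup\cdots\cup E_\ell$ with $|E_0|\le \epsilon n^2$ and the diameter of $E_i$ at most $d$ for $1\le i\le \ell$.
   Formalization: The parameters ε and η range over the rational numbers instead of the reals (the constants obtained are rational too); since P(n,ε,d) depends on ε only through the integer part of εn², the real case follows. -}

module Defs where

open import Data.Bool using (Bool; true; false; _∧_)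
open import Data.Nat as ℕ using (ℕ; zero; suc; _<ᵇ_)
open import Data.Fin using (Fin; toℕ)
import Data.Fin as Fin
open import Data.List using (List; map)
open import Data.Nat.ListAction using (sum)
open import Data.Fin.Properties using () renaming (_≟_ to _≟ᶠ_)
open import Data.Integer using (+_)
open import Data.Rational using (ℚ; _/_; _*_; _≤_)
open import Data.Product using (Σ; ∃; _×_)
open import Relation.Binary.PropositionalEquality using (_≡_)
open import Relation.Nullary using (¬_; does)
open import Data.List using (allFin)

record Graph (n : ℕ) : Set where
  field
    adj   : Fin n → Fin n → Bool
    sym   : ∀ u v → adj u v ≡ adj v u
    irref : ∀ u → adj u u ≡ false
open Graph public

-- An edge partition E = E₀ ∪ E₁ ∪ … ∪ E_ℓ of G: every edge {u,v} gets a
-- class in Fin (suc ℓ) (class 0 = E₀), well defined on unordered pairs.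
-- (Values on non-edges are irrelevant.)
record EdgePartition {n : ℕ} (G : Graph n) (ℓ : ℕ) : Set where
  field
    cls    : Fin n → Fin n → Fin (suc ℓ)
    clsSym : ∀ u v → adj G u v ≡ true → cls u v ≡ cls v u
open EdgePartition public

InClass : ∀ {n ℓ} {G : Graph n} → EdgePartition G ℓ → Fin (suc ℓ) → Fin n → Fin n → Set
InClass {G = G} p i u v = (adj G u v ≡ true) × (cls p u v ≡ i)

data WalkLe {n : ℕ} (R : Fin n → Fin n → Set) : ℕ → Fin n → Fin n → Set where
  here : ∀ {k u} → WalkLe R k u u
  step : ∀ {k u w v} → R u w → WalkLe R k w v → WalkLe R (suc k) u v

Covered : ∀ {n ℓ} {G : Graph n} → EdgePartition G ℓ → Fin (suc ℓ) → Fin n → Set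
Covered p i u = ∃ λ w → InClass p i u w

-- The diameter of E_i is at most d: any two vertices of E_i are joined in
-- the graph (V(E_i), E_i) by a path of length ≤ d (in particular that graph
-- is connected). For empty E_i the condition holds vacuously.
DiamLe : ∀ {n ℓ} {G : Graph n} → EdgePartition G ℓ → Fin (suc ℓ) → ℕ → Set
DiamLe p i d = ∀ u v → Covered p i u → Covered p i v → WalkLe (InClass p i) d u v

isZero : ∀ {ℓ} → Fin (suc ℓ) → Bool
isZero i = does (i ≟ᶠ Fin.zero)

sizeE₀ : ∀ {n ℓ} {G : Graph n} → EdgePartition G ℓ → ℕ
sizeE₀ {n} {G = G} p =
  sum (map (λ u → sum (map (λ v → indicator u v) (allFin n))) (allFin n))
  where
    indicator : Fin n → Fin n → ℕ
    indicator u v with (toℕ u <ᵇ toℕ v) ∧ adj G u v ∧ isZero (cls p u v)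
    ... | true  = 1
    ... | false = 0

ℕtoℚ : ℕ → ℚ
ℕtoℚ k = + k / 1

GoodPartition : ∀ {n} → Graph n → ℚ → ℕ → ℕ → Set
GoodPartition {n} G ε d ℓ =
  Σ (EdgePartition G ℓ) λ p →
    (ℕtoℚ (sizeE₀ p) ≤ ε * (ℕtoℚ n * ℕtoℚ n)) ×
    (∀ (j : Fin ℓ) → DiamLe p (Fin.suc j) d)

-- Every graph on n vertices admits such a partition into E₀,E₁,…,E_ℓ.
-- P(n,ε,d) is the least ℓ with  Partitionable n ε d ℓ.
Partitionable : ℕ → ℚ → ℕ → ℕ → Set
Partitionable n ε d ℓ = (G : Graph n) → GoodPartition G ε d ℓ

P≤ : ℕ → ℚ → ℕ → ℚ → Set
P≤ n ε d B = ∃ λ ℓ → Partitionable n ε d ℓ × (ℕtoℚ ℓ ≤ B)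

P≥ : ℕ → ℚ → ℕ → ℚ → Set
P≥ n ε d B = ∀ ℓ → Partitionable n ε d ℓ → B ≤ ℕtoℚ ℓ

{-# OPTIONS --safe #-}
-- Upper bounds.  For d = 2 take the star of every vertex.  For d = 4, repeatedly remove all edges meeting the
-- neighbourhood of a vertex of maximum degree Δ: each step isolates Δ vertices, so Δ ≤ n/(k+1) after k steps.
-- For d = 3, repeatedly remove all edges between N(u) and N(v) for the best edge uv: with D ordered edges left,
-- counting 4-cycles shows that at least D³/n⁴ of them disappear, so that n⁴/D² ≥ k+1 after k steps.
--
-- Lower bounds.  A piece of diameter at most d in a blow-up of a bipartite graph R projects to such a piece of R,
-- so R with many edges but only small pieces suffices.  For d = 4, R is a perfect matching.  For d = 2 the pieces
-- are bicliques, and R is the complement of a level set of a pairwise independent family of 𝔽_q-valued functions,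
-- so that bicliques have O(n) edges by the second moment method.  For d = 3, R is the point-line incidence graph of the affine plane
-- over 𝔽_p.  A piece is closed under joining points and meeting lines.  If some point lay on three of its lines,
-- one of which had three points and another two, then iterating an elation would produce a point at infinity;
-- hence a piece has at most 5p of the p³ edges.  Suitable primes p exist by a Chebyshev-type estimate.
module Submission where

-- A blow-up keeps the ratio of `count R` to the largest piece while stretching R to n vertices. So
-- E₀ takes at most half of the edges once R has density 32ε, which leads to a matching of about
-- 1/(32ε) edges for d = 4 and a plane of order about 1/(32ε) for d = 3. For d = 2 no fixed R works,
-- since ℓ has to grow with n, and near ε = 1/4 the host must be almost complete bipartite. Hence
-- the level set of density 1/q with q ≥ 1/η: its complement loses only m²/q edges, yet independence
-- still forces every biclique down to q³m edges. Parity shapes the bipartite pieces. Left-right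
-- distances are odd and left-left distances even, so diameter 2 gives bicliques, and diameter 3
-- gives a common line for any two points and a common point for any two lines. The plane is taken
-- over a prime field because there a nonzero translation passes through every element, so the orbit
-- of an elation cannot avoid infinity. Throughout, ε is a fraction a/b and residues are integers
-- compared by divisibility, so that estimates live in ℕ and geometry reduces to ring identities.

open import Defs hiding (sym)
open import Data.Bool using (Bool; true; false; _∧_; _∨_; not)
open import Data.Product using (Σ; ∃; _×_; _,_; proj₁; proj₂)
open import Data.Sum using (_⊎_; inj₁; inj₂; [_,_]′)
open import Data.Empty using (⊥; ⊥-elim)
open import Relation.Nullary using (¬_; Dec; yes; no; does; contradiction; _×-dec_)
open import Relation.Binary.PropositionalEquality
open import Function using (_∘_; id)

-- Boolean indicators, finite sums and the Cauchy-Schwarz inequality.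

module FiniteSums where

  open import Data.Nat
  open import Data.Nat.Properties
  open import Data.Nat.Tactic.RingSolver using (solve-∀)
  open import Data.Fin as Fin using (Fin; zero; suc; _↑ˡ_; _↑ʳ_; combine)
  import Data.Fin.Properties as Finₚ
  open import Data.List using (map; tabulate; allFin)
  import Data.Nat.ListAction as List
  open import Data.List.Properties using (map-tabulate)
  import Algebra.Properties.Semiring.Sum +-*-semiring as Sum

  ⟦_⟧ : Bool → ℕ
  ⟦ true ⟧  = 1
  ⟦ false ⟧ = 0

  ⟦⟧≤1 : ∀ b → ⟦ b ⟧ ≤ 1
  ⟦⟧≤1 true  = ≤-refl
  ⟦⟧≤1 false = z≤n

  true≢false : true ≢ false
  true≢false ()

  ∧-true : ∀ {a b} → a ∧ b ≡ true → a ≡ true × b ≡ true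
  ∧-true {true} eq = refl , eq

  ∨-true : ∀ {a b} → a ∨ b ≡ true → a ≡ true ⊎ b ≡ true
  ∨-true {true}  eq = inj₁ refl
  ∨-true {false} eq = inj₂ eq

  ∧-intro : ∀ {a b} → a ≡ true → b ≡ true → a ∧ b ≡ true
  ∧-intro refl refl = refl

  ∨-introˡ : ∀ {a b} → a ≡ true → a ∨ b ≡ true
  ∨-introˡ refl = refl

  ∨-introʳ : ∀ {a b} → b ≡ true → a ∨ b ≡ true
  ∨-introʳ {true}  refl = refl
  ∨-introʳ {false} refl = refl

  ⟦⟧-mono : ∀ {a b} → (a ≡ true → b ≡ true) → ⟦ a ⟧ ≤ ⟦ b ⟧
  ⟦⟧-mono {false} f = z≤n
  ⟦⟧-mono {true}  f rewrite f refl = ≤-refl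

  ⟦⟧≡0 : ∀ {b} → ¬ b ≡ true → ⟦ b ⟧ ≡ 0
  ⟦⟧≡0 {true}  f = ⊥-elim (f refl)
  ⟦⟧≡0 {false} f = refl

  ⟦∧⟧ : ∀ a b → ⟦ a ∧ b ⟧ ≡ ⟦ a ⟧ * ⟦ b ⟧
  ⟦∧⟧ true  b = sym (+-identityʳ _)
  ⟦∧⟧ false b = refl

  does-true : ∀ {p} {P : Set p} (d : Dec P) → P → does d ≡ true
  does-true (yes _) p  = refl
  does-true (no ¬p) p = contradiction p ¬p

  from-does : ∀ {p} {P : Set p} (d : Dec P) → does d ≡ true → P
  from-does (yes p) _ = p

  -- Opaque, so that unification never unfolds a sum over Fin (suc n).
  opaque

    sum : ∀ {n} → (Fin n → ℕ) → ℕ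
    sum = Sum.sum

    sum-cong-≗ : ∀ {n} {f g : Fin n → ℕ} → (∀ i → f i ≡ g i) → sum f ≡ sum g
    sum-cong-≗ = Sum.sum-cong-≗

    ∑-distrib : ∀ {n} (f g : Fin n → ℕ) → sum (λ i → f i + g i) ≡ sum f + sum g
    ∑-distrib = Sum.∑-distrib-+

    ∑-swap : ∀ {m n} (f : Fin m → Fin n → ℕ) → sum (λ i → sum (f i)) ≡ sum (λ j → sum (λ i → f i j))
    ∑-swap = Sum.∑-comm

    sum-suc : ∀ {n} (f : Fin (suc n) → ℕ) → sum f ≡ f zero + sum (f ∘ suc)
    sum-suc f = refl

    *-distribˡ-sum : ∀ {n} x (f : Fin n → ℕ) → x * sum f ≡ sum (λ i → x * f i)
    *-distribˡ-sum = Sum.*-distribˡ-sum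

    *-distribʳ-sum : ∀ {n} x (f : Fin n → ℕ) → sum f * x ≡ sum (λ i → f i * x)
    *-distribʳ-sum = Sum.*-distribʳ-sum

    sum-mono : ∀ {n} {f g : Fin n → ℕ} → (∀ i → f i ≤ g i) → sum f ≤ sum g
    sum-mono {zero}  h = z≤n
    sum-mono {suc n} h = +-mono-≤ (h zero) (sum-mono (h ∘ suc))

    term≤sum : ∀ {n} (f : Fin n → ℕ) i → f i ≤ sum f
    term≤sum f zero    = m≤m+n _ _
    term≤sum f (suc i) = ≤-trans (term≤sum (f ∘ suc) i) (m≤n+m _ _)

    sum-const : ∀ n c → sum {n} (λ _ → c) ≡ n * c
    sum-const zero    c = refl
    sum-const (suc n) c = cong (c +_) (sum-const n c)

    sum≤const : ∀ {n} {f : Fin n → ℕ} c → (∀ i → f i ≤ c) → sum f ≤ n * c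
    sum≤const {n} c h = ≤-trans (sum-mono h) (≤-reflexive (sum-const n c))

    count≤n : ∀ {n} (b : Fin n → Bool) → sum (λ i → ⟦ b i ⟧) ≤ n
    count≤n {n} b = ≤-trans (sum≤const {f = λ i → ⟦ b i ⟧} 1 (λ i → ⟦⟧≤1 (b i))) (≤-reflexive (*-identityʳ n))

    sum-split : ∀ m {n} (f : Fin (m + n) → ℕ) →
      sum f ≡ sum {m} (λ i → f (i ↑ˡ n)) + sum {n} (λ j → f (m ↑ʳ j))
    sum-split zero    f = refl
    sum-split (suc m) f = trans (cong (f zero +_) (sum-split m (f ∘ suc))) (sym (+-assoc (f zero) _ _))

    sum-combine : ∀ m {n} (f : Fin (m * n) → ℕ) →
      sum f ≡ sum {m} (λ i → sum {n} (λ j → f (combine i j)))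
    sum-combine zero        f = refl
    sum-combine (suc m) {n} f = trans (sum-split n f)
      (cong (sum {n} (λ j → f (j ↑ˡ (m * n))) +_) (sum-combine m (f ∘ (n ↑ʳ_))))

    sum-allFin : ∀ {n} (f : Fin n → ℕ) → List.sum (map f (allFin n)) ≡ sum f
    sum-allFin {n} f = trans (cong List.sum (map-tabulate id f)) (go n f)
      where
      go : ∀ n (f : Fin n → ℕ) → List.sum (tabulate f) ≡ sum f
      go zero    f = refl
      go (suc n) f = cong (f zero +_) (go n (f ∘ suc))

    sum-<⇒∃< : ∀ {n} (f g : Fin n → ℕ) → sum f < sum g → ∃ λ i → f i < g i
    sum-<⇒∃< {suc n} f g lt with f zero <? g zero
    ... | yes p = zero , p
    ... | no ¬p with sum-<⇒∃< (f ∘ suc) (g ∘ suc)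
                       (+-cancelˡ-< (f zero) _ _ (<-≤-trans lt (+-monoˡ-≤ _ (≮⇒≥ ¬p))))
    ...   | i , q = suc i , q

    sum-positive⇒∃ : ∀ {n} (f : Fin n → ℕ) → 0 < sum f → ∃ λ i → 0 < f i
    sum-positive⇒∃ {n} f pos = sum-<⇒∃< (λ _ → 0) f (subst (_< sum f) (sym (trans (sum-const n 0) (*-zeroʳ n))) pos)

  sum-syntax : ∀ n → (Fin n → ℕ) → ℕ
  sum-syntax _ = sum

  syntax sum-syntax n (λ i → x) = ∑[ i < n ] x

  argmax : ∀ {n} (f : Fin (suc n) → ℕ) → ∃ λ i → ∀ j → f j ≤ f i
  argmax {zero}  f = zero , λ { zero → ≤-refl }
  argmax {suc n} f with argmax (f ∘ suc)
  ... | i , p with f zero ≤? f (suc i)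
  ...   | yes q = suc i , λ { zero → q ; (suc j) → p j }
  ...   | no ¬q = zero , λ { zero → ≤-refl ; (suc j) → ≤-trans (p j) (<⇒≤ (≰⇒> ¬q)) }

  eqᵇ : ∀ {n} → Fin n → Fin n → Bool
  eqᵇ i j = does (i Finₚ.≟ j)

  eqᵇ-refl : ∀ {n} (i : Fin n) → eqᵇ i i ≡ true
  eqᵇ-refl i = does-true (i Finₚ.≟ i) refl

  eqᵇ⇒≡ : ∀ {n} {i j : Fin n} → eqᵇ i j ≡ true → i ≡ j
  eqᵇ⇒≡ {i = i} {j} = from-does (i Finₚ.≟ j)

  sum-zero : ∀ {n} (f : Fin n → ℕ) → (∀ i → f i ≡ 0) → sum f ≡ 0
  sum-zero {n} f h = trans (sum-cong-≗ h) (trans (sum-const n 0) (*-zeroʳ n))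

  opaque
    unfolding sum

    sum-unique : ∀ {n} (j : Fin n) (b : Fin n → Bool) → b j ≡ true → (∀ i → b i ≡ true → i ≡ j) →
      ∑[ i < n ] ⟦ b i ⟧ ≡ 1
    sum-unique {suc n} zero b bj u rewrite bj = cong suc (sum-zero _ λ i → zer i (b (suc i)) refl)
      where
      zer : ∀ i c → b (suc i) ≡ c → ⟦ c ⟧ ≡ 0
      zer i true  e with () ← u (suc i) e
      zer i false e = refl
    sum-unique {suc n} (suc j) b bj u with b zero in e
    ... | true with () ← u zero e
    ... | false = sum-unique j (b ∘ suc) bj (λ i h → Finₚ.suc-injective (u (suc i) h))

    sum-eqᵇ : ∀ {n} (j : Fin n) → ∑[ i < n ] ⟦ eqᵇ i j ⟧ ≡ 1
    sum-eqᵇ j = sum-unique j (λ i → eqᵇ i j) (eqᵇ-refl j) (λ i → eqᵇ⇒≡)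

    sum-atMostOne : ∀ {n} (b : Fin n → Bool) → (∀ i j → b i ≡ true → b j ≡ true → i ≡ j) →
      ∑[ i < n ] ⟦ b i ⟧ ≤ 1
    sum-atMostOne {zero}  b u = z≤n
    sum-atMostOne {suc n} b u with b zero in e
    ... | true = s≤s (≤-reflexive (sum-zero _ λ i → zer i (b (suc i)) refl))
      where
      zer : ∀ i c → b (suc i) ≡ c → ⟦ c ⟧ ≡ 0
      zer i true  e′ with () ← u zero (suc i) e e′
      zer i false e′ = refl
    ... | false = sum-atMostOne (b ∘ suc) (λ i j p q → Finₚ.suc-injective (u (suc i) (suc j) p q))

  2mn≤m²+n² : ∀ m n → 2 * (m * n) ≤ m * m + n * n
  2mn≤m²+n² m n with ≤-total m n
  ... | inj₁ m≤n with d , refl ← m≤n⇒∃[o]m+o≡n m≤n = m+k (lem m d)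
    where
    lem : ∀ m d → m * m + (m + d) * (m + d) ≡ 2 * (m * (m + d)) + d * d
    lem = solve-∀
    m+k : ∀ {x y k} → y ≡ x + k → x ≤ y
    m+k refl = m≤m+n _ _
  ... | inj₂ n≤m with d , refl ← m≤n⇒∃[o]m+o≡n n≤m = m+k (lem n d)
    where
    lem : ∀ n d → (n + d) * (n + d) + n * n ≡ 2 * ((n + d) * n) + d * d
    lem = solve-∀
    m+k : ∀ {x y k} → y ≡ x + k → x ≤ y
    m+k refl = m≤m+n _ _

  sum-*-sum : ∀ {m n} (f : Fin m → ℕ) (g : Fin n → ℕ) → sum f * sum g ≡ ∑[ i < m ] ∑[ j < n ] (f i * g j)
  sum-*-sum f g = trans (*-distribʳ-sum (sum g) f) (sum-cong-≗ λ i → *-distribˡ-sum (f i) g)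

  -- Sum 2·f i·f j ≤ c i·(f j)² + (f i)²·c j over all pairs; outside c the left side vanishes.
  -- Counting only the marked indices, in place of all n, is what later turns this into a second
  -- moment bound on the number of nonzero values.
  cauchy-schwarz : ∀ {n} (c : Fin n → Bool) (f : Fin n → ℕ) → (∀ i → c i ≡ false → f i ≡ 0) →
    sum f * sum f ≤ ∑[ i < n ] ⟦ c i ⟧ * ∑[ i < n ] (f i * f i)
  cauchy-schwarz {n} c f supp = *-cancelˡ-≤ 2 (begin
    2 * (sum f * sum f)
      ≡⟨ cong (2 *_) (sum-*-sum f f) ⟩
    2 * ∑[ i < n ] ∑[ j < n ] (f i * f j)
      ≡⟨ trans (*-distribˡ-sum 2 (λ i → ∑[ j < n ] (f i * f j))) (sum-cong-≗ λ i → *-distribˡ-sum 2 (λ j → f i * f j)) ⟩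
    ∑[ i < n ] ∑[ j < n ] (2 * (f i * f j))
      ≤⟨ sum-mono (λ i → sum-mono (λ j → pt i j (c i) (c j) refl refl)) ⟩
    ∑[ i < n ] ∑[ j < n ] (⟦ c i ⟧ * (f j * f j) + (f i * f i) * ⟦ c j ⟧)
      ≡⟨ trans (sum-cong-≗ λ i → ∑-distrib (λ j → ⟦ c i ⟧ * (f j * f j)) (λ j → (f i * f i) * ⟦ c j ⟧))
          (∑-distrib (λ i → ∑[ j < n ] (⟦ c i ⟧ * (f j * f j))) (λ i → ∑[ j < n ] ((f i * f i) * ⟦ c j ⟧))) ⟩
    ∑[ i < n ] ∑[ j < n ] (⟦ c i ⟧ * (f j * f j)) + ∑[ i < n ] ∑[ j < n ] ((f i * f i) * ⟦ c j ⟧)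
      ≡⟨ cong₂ _+_ (sum-*-sum (⟦_⟧ ∘ c) (λ j → f j * f j)) (sum-*-sum (λ i → f i * f i) (⟦_⟧ ∘ c)) ⟨
    C * F + F * C
      ≡⟨ fin C F ⟩
    2 * (C * F) ∎)
    where
    open ≤-Reasoning
    C = ∑[ i < n ] ⟦ c i ⟧
    F = ∑[ i < n ] (f i * f i)
    fin : ∀ C F → C * F + F * C ≡ 2 * (C * F)
    fin = solve-∀
    zl : ∀ {x y} → x ≡ 0 → 2 * (x * y) ≡ 0
    zl refl = refl
    zr : ∀ x {y} → y ≡ 0 → 2 * (x * y) ≡ 0
    zr x refl = cong (2 *_) (*-zeroʳ x)
    pt : ∀ i j ci cj → c i ≡ ci → c j ≡ cj → 2 * (f i * f j) ≤ ⟦ ci ⟧ * (f j * f j) + (f i * f i) * ⟦ cj ⟧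
    pt i j false cj ei ej = ≤-trans (≤-reflexive (zl {f i} {f j} (supp i ei))) z≤n
    pt i j true false ei ej = ≤-trans (≤-reflexive (zr (f i) (supp j ej))) z≤n
    pt i j true true ei ej = ≤-trans (2mn≤m²+n² (f i) (f j)) (≤-reflexive (sw (f i * f i) (f j * f j)))
      where
      sw : ∀ a b → a + b ≡ 1 * b + a * 1
      sw = solve-∀

  cauchy-schwarz-const : ∀ {n} (f : Fin n → ℕ) → sum f * sum f ≤ n * ∑[ i < n ] (f i * f i)
  cauchy-schwarz-const {n} f = subst (λ k → sum f * sum f ≤ k * ∑[ i < n ] (f i * f i))
    (trans (sum-const n 1) (*-identityʳ n)) (cauchy-schwarz (λ _ → true) f (λ _ ()))

-- Building an edge partition by peeling off pieces of bounded diameter.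

module Decompositions where

  open FiniteSums
  open import Data.Nat
  open import Data.Nat.Properties
  open import Data.Fin as Fin using (Fin; zero; suc; toℕ)
  import Data.Fin.Properties as Finₚ
  open import Data.List using (map; allFin)
  import Data.Nat.ListAction as List

  walk-map : ∀ {n} {R S : Fin n → Fin n → Set} → (∀ {x y} → R x y → S x y) →
    ∀ {k u v} → WalkLe R k u v → WalkLe S k u v
  walk-map f here       = here
  walk-map f (step r w) = step (f r) (walk-map f w)

  walk-suc : ∀ {n} {R : Fin n → Fin n → Set} {k u v} → WalkLe R k u v → WalkLe R (suc k) u v
  walk-suc here       = here
  walk-suc (step r w) = step r (walk-suc w)

  sizeE₀≡ : ∀ {n ℓ} {G : Graph n} (p : EdgePartition G ℓ) →
    sizeE₀ p ≡ ∑[ u < n ] ∑[ v < n ] ⟦ (toℕ u <ᵇ toℕ v) ∧ adj G u v ∧ isZero (cls p u v) ⟧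
  sizeE₀≡ {n} {G = G} p = trans (proj₂ indicator)
    (trans (sum-allFin (λ u → List.sum (map (proj₁ indicator u) (allFin n))))
      (sum-cong-≗ λ u → trans (sum-allFin (proj₁ indicator u)) (sum-cong-≗ (pointwise u))))
    where
    -- The summand is local to `sizeE₀`; unification with the unfolded definition recovers it as a
    -- first component.
    indicator : ∃ λ (f : Fin n → Fin n → ℕ) →
      sizeE₀ p ≡ List.sum (map (λ u → List.sum (map (f u) (allFin n))) (allFin n))
    indicator = _ , refl
    pointwise : ∀ u v → proj₁ indicator u v ≡ ⟦ (toℕ u <ᵇ toℕ v) ∧ adj G u v ∧ isZero (cls p u v) ⟧
    pointwise u v with (toℕ u <ᵇ toℕ v) ∧ adj G u v ∧ isZero (cls p u v)
    ... | true  = refl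
    ... | false = refl

  degreeSum : ∀ {n} → Graph n → ℕ
  degreeSum {n} G = ∑[ u < n ] ∑[ v < n ] ⟦ adj G u v ⟧

  -- `sizeE₀` counts an edge once, `degreeSum` counts both of its orientations; the factor two given
  -- away affects constants only.
  sizeE₀≤degreeSum : ∀ {n ℓ} {G : Graph n} (p : EdgePartition G ℓ) (R : Graph n) →
    (∀ u v → InClass p zero u v → adj R u v ≡ true) → sizeE₀ p ≤ degreeSum R
  sizeE₀≤degreeSum {G = G} p R sub = ≤-trans (≤-reflexive (sizeE₀≡ p))
    (sum-mono λ u → sum-mono λ v → ⟦⟧-mono λ h →
      let _ , h′ = ∧-true {toℕ u <ᵇ toℕ v} h
          a , z  = ∧-true {adj G u v} h′
      in sub u v (a , from-does (_ Finₚ.≟ _) z))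

  -- A candidate for a class. H may be empty, so peeling can go on after the edges have run out and
  -- always makes exactly k steps.
  record Piece {n} (G : Graph n) (d : ℕ) : Set where
    field
      H      : Fin n → Fin n → Bool
      H-sym  : ∀ u v → H u v ≡ H v u
      H⊆G    : ∀ u v → H u v ≡ true → adj G u v ≡ true
      H-diam : ∀ u v → (∃ λ w → H u w ≡ true) → (∃ λ w → H v w ≡ true) →
               WalkLe (λ x y → H x y ≡ true) d u v

  open Piece

  remove : ∀ {n d} (G : Graph n) → Piece G d → Graph n
  remove G P = record
    { adj   = λ u v → adj G u v ∧ not (H P u v)
    ; sym   = λ u v → cong₂ _∧_ (Graph.sym G u v) (cong not (H-sym P u v))
    ; irref = λ u → cong (_∧ not (H P u u)) (irref G u)
    }

  module Peeling {n d : ℕ} (step : (G : Graph n) → Piece G d) where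

    residue : Graph n → ℕ → Graph n
    residue G zero    = G
    residue G (suc k) = residue (remove G (step G)) k

    -- Renumbering after the first peeled piece: it becomes class 1, class 0 stays the residue, and
    -- the other classes move up by one.
    shift : ∀ {k} → Bool → Fin (suc k) → Fin (suc (suc k))
    shift true  _       = suc zero
    shift false zero    = zero
    shift false (suc j) = suc (suc j)

    shift-1 : ∀ {k} b (j : Fin (suc k)) → shift b j ≡ suc zero → b ≡ true
    shift-1 true  _       _ = refl
    shift-1 false (suc j) ()

    shift-0 : ∀ {k} b (j : Fin (suc k)) → shift b j ≡ zero → b ≡ false × j ≡ zero
    shift-0 false zero _ = refl , refl

    shift-2+ : ∀ {k} b (j : Fin (suc k)) {i} → shift b j ≡ suc (suc i) → b ≡ false × j ≡ suc i
    shift-2+ false (suc j) refl = refl , refl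

    peel : (G : Graph n) (k : ℕ) → Σ (EdgePartition G k) λ p →
      (∀ j → DiamLe p (suc j) d) × (∀ u v → InClass p zero u v → adj (residue G k) u v ≡ true)
    peel G zero = record { cls = λ _ _ → zero ; clsSym = λ _ _ _ → refl } , (λ ()) , λ u v → proj₁
    peel G (suc k) with peel (remove G (step G)) k
    ... | p , diam , rest = q , diam′ , rest′
      where
      K = H (step G)
      q : EdgePartition G (suc k)
      q = record { cls = λ u v → shift (K u v) (cls p u v) ; clsSym = s }
        where
        -- The classes of p are known to be symmetric only on the edges left after removal; on edges
        -- of the piece `shift true` ignores them.
        s : ∀ u v → adj G u v ≡ true → shift (K u v) (cls p u v) ≡ shift (K v u) (cls p v u)
        s u v a rewrite H-sym (step G) v u with K u v in e
        ... | true  = refl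
        ... | false = cong (shift false) (clsSym p u v (∧-intro a (cong not e)))
      toK : ∀ {u v} → InClass q (suc zero) u v → K u v ≡ true
      toK {u} {v} (a , c) = shift-1 (K u v) (cls p u v) c
      fromK : ∀ {u v} → K u v ≡ true → InClass q (suc zero) u v
      fromK {u} {v} h = H⊆G (step G) u v h , cong (λ b → shift b (cls p u v)) h
      toP : ∀ {u v i} → InClass q (suc (suc i)) u v → InClass p (suc i) u v
      toP {u} {v} (a , c) with shift-2+ (K u v) (cls p u v) c
      ... | e , c′ = ∧-intro a (cong not e) , c′
      fromP : ∀ {u v i} → InClass p (suc i) u v → InClass q (suc (suc i)) u v
      fromP {u} {v} (a , c) with ∧-true {adj G u v} a
      ... | a′ , e with K u v
      ...   | false = a′ , cong (shift false) c
      diam′ : ∀ j → DiamLe q (suc j) d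
      diam′ zero u v (x , hx) (y , hy) = walk-map fromK (H-diam (step G) u v (x , toK hx) (y , toK hy))
      diam′ (suc j) u v (x , hx) (y , hy) = walk-map fromP (diam j u v (x , toP hx) (y , toP hy))
      rest′ : ∀ u v → InClass q zero u v → adj (residue (remove G (step G)) k) u v ≡ true
      rest′ u v (a , c) with shift-0 (K u v) (cls p u v) c
      ... | e , c′ = rest u v (∧-intro a (cong not e) , c′)

    peel-size : (G : Graph n) (k : ℕ) → Σ (EdgePartition G k) λ p →
      (∀ j → DiamLe p (suc j) d) × (sizeE₀ p ≤ degreeSum (residue G k))
    peel-size G k with p , diam , rest ← peel G k = p , diam , sizeE₀≤degreeSum p (residue G k) rest

  degreeSum-remove : ∀ {n d} (G : Graph n) (P : Piece G d) →
    degreeSum (remove G P) + ∑[ u < n ] ∑[ v < n ] ⟦ H P u v ⟧ ≡ degreeSum G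
  degreeSum-remove {n} G P = trans
    (sym (∑-distrib (λ u → ∑[ v < n ] ⟦ adj (remove G P) u v ⟧) (λ u → ∑[ v < n ] ⟦ H P u v ⟧)))
    (sum-cong-≗ λ u → trans (sym (∑-distrib (λ v → ⟦ adj (remove G P) u v ⟧) (λ v → ⟦ H P u v ⟧)))
      (sum-cong-≗ λ v → pt (adj G u v) (H P u v) (H⊆G P u v)))
    where
    pt : ∀ a h → (h ≡ true → a ≡ true) → ⟦ a ∧ not h ⟧ + ⟦ h ⟧ ≡ ⟦ a ⟧
    pt a true f rewrite f refl = refl
    pt true false f = refl
    pt false false f = refl

-- Upper bounds: neighbourhood pieces, double stars and stars.

module Pieces where

  open FiniteSums
  open Decompositions
  open import Data.Bool.Properties using (∧-zeroʳ; ∨-comm)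
  open import Data.Nat
  open import Data.Nat.Properties
  open import Data.Nat.Tactic.RingSolver using (solve-∀)
  open import Data.Fin as Fin using (Fin; zero; suc; toℕ)
  import Data.Fin.Properties as Finₚ
  open Piece

  walk-weaken : ∀ {n} {R : Fin n → Fin n → Set} j {k u v} → WalkLe R k u v → WalkLe R (j + k) u v
  walk-weaken zero    w = w
  walk-weaken (suc j) w = walk-suc (walk-weaken j w)

  walk-++ : ∀ {n} {R : Fin n → Fin n → Set} {j k u v w} →
    WalkLe R j u v → WalkLe R k v w → WalkLe R (j + k) u w
  walk-++ {j = j} here       w = walk-weaken j w
  walk-++         (step r v) w = step r (walk-++ v w)

  module _ {n : ℕ} (G : Graph n) where

    private A = adj G

    -- Each edge of the piece has an end x adjacent to v, and vx itself belongs to the piece. Every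
    -- covered vertex is therefore within distance 2 of the centre v.
    nbhdPiece : Fin n → Piece G 4
    nbhdPiece v = record
      { H      = N
      ; H-sym  = N-sym
      ; H⊆G    = λ x y h → proj₁ (∧-true h)
      ; H-diam = λ x y cx cy → walk-++ (proj₁ (near x cx)) (proj₂ (near y cy))
      }
      where
      N : Fin n → Fin n → Bool
      N x y = A x y ∧ (A v x ∨ A v y)
      N-sym : ∀ x y → N x y ≡ N y x
      N-sym x y = cong₂ _∧_ (Graph.sym G x y) (∨-comm (A v x) (A v y))
      R : Fin n → Fin n → Set
      R x y = N x y ≡ true
      flip : ∀ {x y} → R x y → R y x
      flip {x} {y} r = trans (N-sym y x) r
      toCentre : ∀ {x} → A v x ≡ true → R v x
      toCentre {x} a = ∧-intro a (∨-introʳ {A v v} a)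
      near : ∀ x → (∃ λ w → R x w) → WalkLe R 2 x v × WalkLe R 2 v x
      near x (w , r) with ∨-true {A v x} (proj₂ (∧-true {A x w} r))
      ... | inj₁ a = step (flip (toCentre a)) here , step (toCentre a) here
      ... | inj₂ a = step r (step (flip (toCentre a)) here) , step (toCentre a) (step (flip r) here)

    -- When uv is an edge, u lies in N(v) and v in N(u), so the piece contains the full stars at u
    -- and v. Each covered vertex lies in N(u) or N(v), and the edge uv links the two centres, so
    -- three steps suffice.
    doubleStarPiece : Fin n → Fin n → Piece G 3
    doubleStarPiece u v = record
      { H      = N
      ; H-sym  = N-sym
      ; H⊆G    = λ x y h → proj₁ (∧-true (proj₂ (∧-true {A u v} h)))
      ; H-diam = diam
      }
      where
      N : Fin n → Fin n → Bool
      -- The factor `A u v` empties the piece when uv is not an edge, so every pair u, v yields a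
      -- piece.
      N x y = A u v ∧ (A x y ∧ ((A u x ∧ A v y) ∨ (A u y ∧ A v x)))
      N-sym : ∀ x y → N x y ≡ N y x
      N-sym x y = cong (A u v ∧_) (cong₂ _∧_ (Graph.sym G x y) (∨-comm (A u x ∧ A v y) (A u y ∧ A v x)))
      R : Fin n → Fin n → Set
      R x y = N x y ≡ true
      flip : ∀ {x y} → R x y → R y x
      flip {x} {y} r = trans (N-sym y x) r
      data Near (x : Fin n) : Set where
        nearU : R x u → R u x → Near x
        nearV : R x v → R v x → Near x
      module _ (uv : A u v ≡ true) where
        vu : A v u ≡ true
        vu = trans (Graph.sym G v u) uv
        fromU : ∀ {x} → A u x ≡ true → R u x
        fromU {x} a = ∧-intro uv (∧-intro a (∨-introʳ {A u u ∧ A v x} (∧-intro a vu)))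
        fromV : ∀ {x} → A v x ≡ true → R v x
        fromV {x} a = ∧-intro uv (∧-intro a (∨-introˡ {A u v ∧ A v x} (∧-intro uv a)))
        near : ∀ x → (∃ λ w → R x w) → Near x
        near x (w , r) with ∨-true {A u x ∧ A v w} (proj₂ (∧-true {A x w} (proj₂ (∧-true {A u v} r))))
        ... | inj₁ a = let ux = fromU (proj₁ (∧-true a)) in nearU (flip ux) ux
        ... | inj₂ a = let vx = fromV (proj₂ (∧-true {A u w} a)) in nearV (flip vx) vx
        join : ∀ {x y} → Near x → Near y → WalkLe R 3 x y
        join (nearU a _) (nearU _ b) = step a (step b here)
        join (nearU a _) (nearV _ b) = step a (step (fromU uv) (step b here))
        join (nearV a _) (nearU _ b) = step a (step (fromV vu) (step b here))
        join (nearV a _) (nearV _ b) = step a (step b here)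
      diam : ∀ x y → (∃ λ w → R x w) → (∃ λ w → R y w) → WalkLe R 3 x y
      diam x y (w , r) cy = let uv = proj₁ (∧-true {A u v} r) in join uv (near uv x (w , r)) (near uv y cy)

  degree : ∀ {n} → Graph n → Fin n → ℕ
  degree {n} G v = ∑[ w < n ] ⟦ adj G v w ⟧

  nonIsolated : ∀ {n} → Graph n → Fin n → Bool
  nonIsolated G v = does (0 <? degree G v)

  support : ∀ {n} → Graph n → ℕ
  support {n} G = ∑[ v < n ] ⟦ nonIsolated G v ⟧

  adj⇒0<degree : ∀ {n} (G : Graph n) {v w} → adj G v w ≡ true → 0 < degree G v
  adj⇒0<degree G {v} {w} a = ≤-trans (≤-reflexive (sym (cong ⟦_⟧ a))) (term≤sum (λ w → ⟦ adj G v w ⟧) w)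

  0<degree⇒adj : ∀ {n} (G : Graph n) {v} → 0 < degree G v → ∃ λ w → adj G v w ≡ true
  0<degree⇒adj G {v} pos with sum-positive⇒∃ (λ w → ⟦ adj G v w ⟧) pos
  ... | w , q with adj G v w in e
  ...   | true = w , e

  module _ {m : ℕ} where

    private n = suc m

    maxDegree : Graph n → Fin n
    maxDegree G = proj₁ (argmax (degree G))

    Δ : Graph n → ℕ
    Δ G = degree G (maxDegree G)

    degree≤Δ : ∀ G v → degree G v ≤ Δ G
    degree≤Δ G = proj₂ (argmax (degree G))

    nbhdStep : (G : Graph n) → Piece G 4
    nbhdStep G = nbhdPiece G (maxDegree G)

    open Peeling nbhdStep

    private
      rem : Graph n → Graph n
      rem G = remove G (nbhdStep G)

    nonIsolated-rem : ∀ G x → ⟦ nonIsolated (rem G) x ⟧ + ⟦ adj G (maxDegree G) x ⟧ ≤ ⟦ nonIsolated G x ⟧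
    nonIsolated-rem G x = split _ refl
      where
      split : ∀ b → adj G (maxDegree G) x ≡ b → ⟦ nonIsolated (rem G) x ⟧ + ⟦ b ⟧ ≤ ⟦ nonIsolated G x ⟧
      split true e = ≤-reflexive (trans (cong (_+ 1) (⟦⟧≡0 isolated)) (sym (cong ⟦_⟧ was)))
        where
        was : nonIsolated G x ≡ true
        was = does-true (0 <? degree G x) (adj⇒0<degree G (trans (Graph.sym G x _) e))
        isolated : ¬ nonIsolated (rem G) x ≡ true
        isolated h with w , r ← 0<degree⇒adj (rem G) (from-does (0 <? degree (rem G) x) h)
          = kept (adj G x w) (adj G (maxDegree G) x) (adj G (maxDegree G) w) e r
          where
          kept : ∀ a b c → b ≡ true → ¬ a ∧ not (a ∧ (b ∨ c)) ≡ true
          kept true true _ _ ()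
      split false e = ≤-trans (≤-reflexive (+-identityʳ _)) (⟦⟧-mono λ h →
        let w , a = 0<degree⇒adj (rem G) (from-does (0 <? degree (rem G) x) h)
        in does-true (0 <? degree G x) (adj⇒0<degree G (proj₁ (∧-true a))))

    support-rem : ∀ G → support (rem G) + Δ G ≤ support G
    support-rem G = ≤-trans
      (≤-reflexive (sym (∑-distrib (λ x → ⟦ nonIsolated (rem G) x ⟧) (λ x → ⟦ adj G (maxDegree G) x ⟧))))
      (sum-mono (nonIsolated-rem G))

    Δ≤support : ∀ G → Δ G ≤ support G
    Δ≤support G = ≤-trans (m≤n+m (Δ G) (support (rem G))) (support-rem G)

    Δ-rem : ∀ G → Δ (rem G) ≤ Δ G
    Δ-rem G = ≤-trans (sum-mono λ w → ⟦⟧-mono (λ h → proj₁ (∧-true h))) (degree≤Δ G (maxDegree (rem G)))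

    -- The counter j charges every step already made with the current maximum degree: that step
    -- isolated at least as many vertices, since the maximum degree never grows.
    support-residue : ∀ k j G → support G + j * Δ G ≤ n →
      support (residue G k) + (k + j) * Δ (residue G k) ≤ n
    support-residue zero    j G h = h
    support-residue (suc k) j G h = subst (λ i → support (residue G (suc k)) + i * Δ (residue G (suc k)) ≤ n)
      (+-suc k j) (support-residue k (suc j) (rem G) (begin
        support (rem G) + (Δ (rem G) + j * Δ (rem G))
          ≤⟨ +-monoʳ-≤ (support (rem G)) (+-mono-≤ (Δ-rem G) (*-monoʳ-≤ j (Δ-rem G))) ⟩
        support (rem G) + (Δ G + j * Δ G)
          ≡⟨ +-assoc (support (rem G)) _ _ ⟨
        support (rem G) + Δ G + j * Δ G
          ≤⟨ +-monoˡ-≤ _ (support-rem G) ⟩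
        support G + j * Δ G
          ≤⟨ h ⟩
        n ∎))
      where open ≤-Reasoning

    -- The extra one in `suc k` comes from the residue itself, whose support still holds at least Δ
    -- vertices.
    Δ-residue : ∀ k G → suc k * Δ (residue G k) ≤ n
    Δ-residue k G = ≤-trans (+-monoˡ-≤ _ (Δ≤support (residue G k)))
      (subst (λ i → support (residue G k) + i * Δ (residue G k) ≤ n) (+-identityʳ k)
        (support-residue k 0 G (≤-trans (≤-reflexive (+-identityʳ _))
          (count≤n (nonIsolated G)))))

    diam4-suc : (G : Graph n) (k : ℕ) → Σ (EdgePartition G k) λ p →
      (∀ j → DiamLe p (suc j) 4) × (suc k * sizeE₀ p ≤ n * n)
    diam4-suc G k with p , diam , size ← peel-size G k = p , diam , (begin
      suc k * sizeE₀ p                  ≤⟨ *-monoʳ-≤ (suc k) size ⟩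
      suc k * degreeSum (residue G k)   ≤⟨ *-monoʳ-≤ (suc k) (sum≤const (Δ (residue G k)) (degree≤Δ (residue G k))) ⟩
      suc k * (n * Δ (residue G k))     ≡⟨ lem (suc k) n (Δ (residue G k)) ⟩
      n * (suc k * Δ (residue G k))     ≤⟨ *-monoʳ-≤ n (Δ-residue k G) ⟩
      n * n ∎)
      where
      open ≤-Reasoning
      lem : ∀ a b c → a * (b * c) ≡ b * (a * c)
      lem = solve-∀

  diam4-partition : ∀ {n} (G : Graph n) (k : ℕ) → Σ (EdgePartition G k) λ p →
    (∀ j → DiamLe p (suc j) 4) × (suc k * sizeE₀ p ≤ n * n)
  diam4-partition {zero}  G k = record { cls = λ () ; clsSym = λ () } , (λ j ()) , ≤-reflexive (*-zeroʳ (suc k))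
  diam4-partition {suc m} G k = diam4-suc G k

  private
    square-mono : ∀ {a b} → a ≤ b → a * a ≤ b * b
    square-mono h = *-mono-≤ h h

  module _ {n : ℕ} (G : Graph n) where

    private
      A : Fin n → Fin n → ℕ
      A u v = ⟦ adj G u v ⟧

      A-sym : ∀ u v → A u v ≡ A v u
      A-sym u v = cong ⟦_⟧ (Graph.sym G u v)

    codegree : Fin n → Fin n → ℕ
    codegree u y = ∑[ x < n ] (A u x * A x y)

    -- Closing the path u, x, y, v by the edge vu gives a homomorphic 4-cycle, so summing this over
    -- u and v with weight `A u v` counts those cycles.
    crossEdges : Fin n → Fin n → ℕ
    crossEdges u v = ∑[ y < n ] ∑[ x < n ] (A v y * (A u x * A x y))

    sum-codegree : ∑[ u < n ] ∑[ y < n ] codegree u y ≡ ∑[ x < n ] (degree G x * degree G x)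
    sum-codegree = begin
      ∑[ u < n ] ∑[ y < n ] ∑[ x < n ] (A u x * A x y)
        ≡⟨ sum-cong-≗ (λ u → ∑-swap (λ y x → A u x * A x y)) ⟩
      ∑[ u < n ] ∑[ x < n ] ∑[ y < n ] (A u x * A x y)
        ≡⟨ ∑-swap (λ u x → ∑[ y < n ] (A u x * A x y)) ⟩
      ∑[ x < n ] ∑[ u < n ] ∑[ y < n ] (A u x * A x y)
        ≡⟨ sum-cong-≗ (λ x → trans (sum-cong-≗ λ u → sum-cong-≗ λ y → cong (_* A x y) (A-sym u x))
             (sym (sum-*-sum (A x) (A x)))) ⟩
      ∑[ x < n ] (degree G x * degree G x) ∎
      where open ≡-Reasoning

    -- Both sides count homomorphic 4-cycles: cutting one at the opposite vertices u and y leaves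
    -- two independent paths of length two.
    sum-crossEdges : ∑[ u < n ] ∑[ v < n ] (A u v * crossEdges u v) ≡
      ∑[ u < n ] ∑[ y < n ] (codegree u y * codegree u y)
    sum-crossEdges = sum-cong-≗ λ u → begin
      ∑[ v < n ] (A u v * crossEdges u v)
        ≡⟨ sum-cong-≗ (λ v → *-distribˡ-sum (A u v) (λ y → ∑[ x < n ] (A v y * (A u x * A x y)))) ⟩
      ∑[ v < n ] ∑[ y < n ] (A u v * ∑[ x < n ] (A v y * (A u x * A x y)))
        ≡⟨ sum-cong-≗ (λ v → sum-cong-≗ λ y → *-distribˡ-sum (A u v) (λ x → A v y * (A u x * A x y))) ⟩
      ∑[ v < n ] ∑[ y < n ] ∑[ x < n ] (A u v * (A v y * (A u x * A x y)))
        ≡⟨ sum-cong-≗ (λ v → sum-cong-≗ λ y → sum-cong-≗ λ x → sym (*-assoc (A u v) (A v y) (A u x * A x y))) ⟩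
      ∑[ v < n ] ∑[ y < n ] ∑[ x < n ] ((A u v * A v y) * (A u x * A x y))
        ≡⟨ ∑-swap (λ v y → ∑[ x < n ] ((A u v * A v y) * (A u x * A x y))) ⟩
      ∑[ y < n ] ∑[ v < n ] ∑[ x < n ] ((A u v * A v y) * (A u x * A x y))
        ≡⟨ sum-cong-≗ (λ y → sym (sum-*-sum (λ v → A u v * A v y) (λ x → A u x * A x y))) ⟩
      ∑[ y < n ] (codegree u y * codegree u y) ∎
      where open ≡-Reasoning

    -- Sidorenko's inequality for the 4-cycle: Cauchy-Schwarz once for the degrees, the sum of whose
    -- squares is the total codegree, then once in each index of the codegree.
    degreeSum⁴≤sum-crossEdges : let D = degreeSum G in
      (D * D) * (D * D) ≤ (n * n * (n * n)) * ∑[ u < n ] ∑[ v < n ] (A u v * crossEdges u v)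
    degreeSum⁴≤sum-crossEdges = begin
      (D * D) * (D * D)
        ≤⟨ square-mono (cauchy-schwarz-const (degree G)) ⟩
      (n * S) * (n * S)
        ≡⟨ cong (λ s → (n * s) * (n * s)) (sym sum-codegree) ⟩
      (n * C) * (n * C)
        ≡⟨ lem₁ n C ⟩
      n * n * (C * C)
        ≤⟨ *-monoʳ-≤ (n * n) (cauchy-schwarz-const (λ u → sum (codegree u))) ⟩
      n * n * (n * ∑[ u < n ] (sum (codegree u) * sum (codegree u)))
        ≤⟨ *-monoʳ-≤ (n * n) (*-monoʳ-≤ n (sum-mono λ u → cauchy-schwarz-const (codegree u))) ⟩
      n * n * (n * ∑[ u < n ] (n * ∑[ y < n ] (codegree u y * codegree u y)))
        ≡⟨ cong (λ s → n * n * (n * s)) (sym (*-distribˡ-sum n (λ u → ∑[ y < n ] (codegree u y * codegree u y)))) ⟩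
      n * n * (n * (n * ∑[ u < n ] ∑[ y < n ] (codegree u y * codegree u y)))
        ≡⟨ lem₂ n _ ⟩
      (n * n * (n * n)) * ∑[ u < n ] ∑[ y < n ] (codegree u y * codegree u y)
        ≡⟨ cong ((n * n * (n * n)) *_) (sym sum-crossEdges) ⟩
      (n * n * (n * n)) * ∑[ u < n ] ∑[ v < n ] (A u v * crossEdges u v) ∎
      where
      open ≤-Reasoning
      D = degreeSum G
      S = ∑[ x < n ] (degree G x * degree G x)
      C = ∑[ u < n ] ∑[ y < n ] codegree u y
      lem₁ : ∀ n C → (n * C) * (n * C) ≡ n * n * (C * C)
      lem₁ = solve-∀
      lem₂ : ∀ n X → n * n * (n * (n * X)) ≡ (n * n * (n * n)) * X
      lem₂ = solve-∀

  module _ {m : ℕ} where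

    private n = suc m

    weight : Graph n → Fin n → Fin n → ℕ
    weight G u v = ⟦ adj G u v ⟧ * crossEdges G u v

    private
      bestV : Graph n → Fin n → Fin n
      bestV G u = proj₁ (argmax (weight G u))
      bestU : Graph n → Fin n
      bestU G = proj₁ (argmax λ u → weight G u (bestV G u))

    maxWeight : Graph n → ℕ
    maxWeight G = weight G (bestU G) (bestV G (bestU G))

    weight≤maxWeight : ∀ G u v → weight G u v ≤ maxWeight G
    weight≤maxWeight G u v = ≤-trans (proj₂ (argmax (weight G u)) v)
      (proj₂ (argmax λ u → weight G u (bestV G u)) u)

    doubleStarStep : (G : Graph n) → Piece G 3
    doubleStarStep G = doubleStarPiece G (bestU G) (bestV G (bestU G))

    open Peeling doubleStarStep

    private
      rem : Graph n → Graph n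
      rem G = remove G (doubleStarStep G)

    maxWeight≤removed : ∀ G → maxWeight G ≤ ∑[ x < n ] ∑[ y < n ] ⟦ H (doubleStarStep G) x y ⟧
    maxWeight≤removed G = begin
      ⟦ adj G u v ⟧ * crossEdges G u v
        ≡⟨ cong (⟦ adj G u v ⟧ *_) (∑-swap (λ y x → ⟦ adj G v y ⟧ * (⟦ adj G u x ⟧ * ⟦ adj G x y ⟧))) ⟩
      ⟦ adj G u v ⟧ * ∑[ x < n ] ∑[ y < n ] (⟦ adj G v y ⟧ * (⟦ adj G u x ⟧ * ⟦ adj G x y ⟧))
        ≡⟨ trans (*-distribˡ-sum ⟦ adj G u v ⟧ _) (sum-cong-≗ λ x → *-distribˡ-sum ⟦ adj G u v ⟧ _) ⟩
      ∑[ x < n ] ∑[ y < n ] (⟦ adj G u v ⟧ * (⟦ adj G v y ⟧ * (⟦ adj G u x ⟧ * ⟦ adj G x y ⟧)))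
        ≤⟨ sum-mono (λ x → sum-mono λ y → pt (adj G u v) (adj G v y) (adj G u x) (adj G x y) (adj G u y ∧ adj G v x)) ⟩
      ∑[ x < n ] ∑[ y < n ] ⟦ H (doubleStarStep G) x y ⟧ ∎
      where
      open ≤-Reasoning
      u = bestU G
      v = bestV G u
      pt : ∀ a b c d e → ⟦ a ⟧ * (⟦ b ⟧ * (⟦ c ⟧ * ⟦ d ⟧)) ≤ ⟦ a ∧ (d ∧ ((c ∧ b) ∨ e)) ⟧
      pt false b c d e = z≤n
      pt true false c d e = z≤n
      pt true true false d e = z≤n
      pt true true true false e = z≤n
      pt true true true true e = ≤-refl

    private
      q = n * n * (n * n)

    -- The D ordered edges share a total weight of at least D⁴/n⁴, so the best one has at least
    -- D³/n⁴. The case D = 0 is split off so that D can be cancelled.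
    degreeSum³≤maxWeight : ∀ G → let D = degreeSum G in D * (D * D) ≤ q * maxWeight G
    degreeSum³≤maxWeight G with degreeSum G in e
    ... | zero  = z≤n
    ... | suc d = *-cancelˡ-≤ (suc d) (begin
      suc d * (suc d * (suc d * suc d))
        ≡⟨ *-assoc (suc d) (suc d) _ ⟨
      (suc d * suc d) * (suc d * suc d)
        ≤⟨ subst (λ D → (D * D) * (D * D) ≤ q * ∑[ u < n ] ∑[ v < n ] weight G u v) e (degreeSum⁴≤sum-crossEdges G) ⟩
      q * ∑[ u < n ] ∑[ v < n ] weight G u v
        ≤⟨ *-monoʳ-≤ q (sum-mono λ u → sum-mono λ v → le u v) ⟩
      q * ∑[ u < n ] ∑[ v < n ] (⟦ adj G u v ⟧ * maxWeight G)
        ≡⟨ cong (q *_) (trans (sum-cong-≗ λ u → sym (*-distribʳ-sum (maxWeight G) (λ v → ⟦ adj G u v ⟧)))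
             (sym (*-distribʳ-sum (maxWeight G) (degree G)))) ⟩
      q * (degreeSum G * maxWeight G)
        ≡⟨ cong (λ D → q * (D * maxWeight G)) e ⟩
      q * (suc d * maxWeight G)
        ≡⟨ lem q (suc d) (maxWeight G) ⟩
      suc d * (q * maxWeight G) ∎)
      where
      open ≤-Reasoning
      lem : ∀ a b c → a * (b * c) ≡ b * (a * c)
      lem = solve-∀
      le : ∀ u v → weight G u v ≤ ⟦ adj G u v ⟧ * maxWeight G
      le u v with adj G u v | weight≤maxWeight G u v
      ... | true  | h = ≤-trans h (≤-reflexive (sym (*-identityˡ _)))
      ... | false | h = z≤n

    -- The potential n⁴/D² grows by at least 1 when D drops to D − D³/n⁴.
    potential-step : ∀ j q D D′ R → .{{NonZero q}} → D′ + R ≡ D → D * (D * D) ≤ q * R →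
      suc j * (D * D) ≤ q → suc (suc j) * (D′ * D′) ≤ q
    potential-step j q D D′ R eq cube inv with g , qg ← m≤n⇒∃[o]m+o≡n (≤-trans (m≤m+n (D * D) (j * (D * D))) inv) =
      -- With g = q - D², the hypothesis `cube` gives qD′ ≤ Dg. After multiplication by q² it thus
      -- suffices that (j+2)D²g² ≤ (D²+g)³, where jD² ≤ g.
      *-cancelˡ-≤ q (*-cancelˡ-≤ q (begin
        q * (q * (suc (suc j) * (D′ * D′)))
          ≡⟨ lem₁ q j D′ ⟩
        suc (suc j) * ((q * D′) * (q * D′))
          ≤⟨ *-monoʳ-≤ (suc (suc j)) (*-mono-≤ qD′≤ qD′≤) ⟩
        suc (suc j) * ((D * g) * (D * g))
          ≡⟨ lem₂ j D g ⟩
        (j * (D * D)) * (g * g) + 2 * ((D * D) * (g * g))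
          ≤⟨ +-monoˡ-≤ _ (*-monoˡ-≤ (g * g) js≤g) ⟩
        g * (g * g) + 2 * ((D * D) * (g * g))
          ≤⟨ m≤m+n _ _ ⟩
        g * (g * g) + 2 * ((D * D) * (g * g)) + ((D * D) * (g * g) + 3 * ((D * D) * (D * D) * g) + (D * D) * ((D * D) * (D * D)))
          ≡⟨ lem₃ (D * D) g ⟩
        (D * D + g) * ((D * D + g) * (D * D + g))
          ≡⟨ cong (λ x → x * (x * x)) qg ⟩
        q * (q * q) ∎))
      where
      open ≤-Reasoning
      lem₁ : ∀ q j d → q * (q * (suc (suc j) * (d * d))) ≡ suc (suc j) * ((q * d) * (q * d))
      lem₁ = solve-∀
      lem₂ : ∀ j D g → suc (suc j) * ((D * g) * (D * g)) ≡ (j * (D * D)) * (g * g) + 2 * ((D * D) * (g * g))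
      lem₂ = solve-∀
      lem₃ : ∀ s g → g * (g * g) + 2 * (s * (g * g)) + (s * (g * g) + 3 * (s * s * g) + s * (s * s)) ≡ (s + g) * ((s + g) * (s + g))
      lem₃ = solve-∀
      js≤g : j * (D * D) ≤ g
      js≤g = +-cancelˡ-≤ (D * D) _ _ (≤-trans inv (≤-reflexive (sym qg)))
      qD′≤ : q * D′ ≤ D * g
      qD′≤ = +-cancelʳ-≤ (D * (D * D)) _ _ (begin
        q * D′ + D * (D * D)  ≤⟨ +-monoʳ-≤ (q * D′) cube ⟩
        q * D′ + q * R        ≡⟨ *-distribˡ-+ q D′ R ⟨
        q * (D′ + R)          ≡⟨ cong (q *_) eq ⟩
        q * D                 ≡⟨ cong (_* D) qg ⟨
        (D * D + g) * D       ≡⟨ lem₄ D g ⟩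
        D * g + D * (D * D)   ∎)
        where
        lem₄ : ∀ D g → (D * D + g) * D ≡ D * g + D * (D * D)
        lem₄ = solve-∀

    degreeSum-residue : ∀ k j G → suc j * (degreeSum G * degreeSum G) ≤ q →
      suc (k + j) * (degreeSum (residue G k) * degreeSum (residue G k)) ≤ q
    degreeSum-residue zero    j G h = h
    degreeSum-residue (suc k) j G h = subst (λ i → suc i * (degreeSum (residue G (suc k)) * degreeSum (residue G (suc k))) ≤ q)
      (+-suc k j) (degreeSum-residue k (suc j) (rem G)
        (potential-step j q (degreeSum G) (degreeSum (rem G)) _ (degreeSum-remove G (doubleStarStep G))
          (≤-trans (degreeSum³≤maxWeight G) (*-monoʳ-≤ q (maxWeight≤removed G))) h))

    diam3-suc : (G : Graph n) (k : ℕ) → Σ (EdgePartition G k) λ p →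
      (∀ j → DiamLe p (suc j) 3) × (suc k * (sizeE₀ p * sizeE₀ p) ≤ n * n * (n * n))
    diam3-suc G k = p , diam , (begin
      suc k * (sizeE₀ p * sizeE₀ p)
        ≤⟨ *-monoʳ-≤ (suc k) (*-mono-≤ size size) ⟩
      suc k * (D * D)
        ≡⟨ cong (λ i → suc i * (D * D)) (+-identityʳ k) ⟨
      suc (k + 0) * (D * D)
        ≤⟨ degreeSum-residue k 0 G initial ⟩
      q ∎)
      where
      open ≤-Reasoning
      P = peel-size G k
      p = proj₁ P
      diam = proj₁ (proj₂ P)
      size = proj₂ (proj₂ P)
      D = degreeSum (residue G k)
      D≤ : degreeSum G ≤ n * n
      D≤ = sum≤const {f = degree G} n λ u → count≤n (adj G u)
      initial : 1 * (degreeSum G * degreeSum G) ≤ q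
      initial = ≤-trans (≤-reflexive (*-identityˡ (degreeSum G * degreeSum G))) (*-mono-≤ D≤ D≤)

  diam3-partition : ∀ {n} (G : Graph n) (k : ℕ) → Σ (EdgePartition G k) λ p →
    (∀ j → DiamLe p (suc j) 3) × (suc k * (sizeE₀ p * sizeE₀ p) ≤ n * n * (n * n))
  diam3-partition {zero}  G k = record { cls = λ () ; clsSym = λ () } , (λ j ()) , ≤-reflexive (*-zeroʳ (suc k))
  diam3-partition {suc m} G k = diam3-suc G k

  minFin : ∀ {n} → Fin n → Fin n → Fin n
  minFin zero    v       = zero
  minFin (suc u) zero    = zero
  minFin (suc u) (suc v) = suc (minFin u v)

  minFin-comm : ∀ {n} (u v : Fin n) → minFin u v ≡ minFin v u
  minFin-comm zero    zero    = refl
  minFin-comm zero    (suc v) = refl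
  minFin-comm (suc u) zero    = refl
  minFin-comm (suc u) (suc v) = cong suc (minFin-comm u v)

  minFin-sel : ∀ {n} (u v : Fin n) → minFin u v ≡ u ⊎ minFin u v ≡ v
  minFin-sel zero    v       = inj₁ refl
  minFin-sel (suc u) zero    = inj₂ refl
  minFin-sel (suc u) (suc v) with minFin-sel u v
  ... | inj₁ e = inj₁ (cong suc e)
  ... | inj₂ e = inj₂ (cong suc e)

  -- Every edge goes to the star of its smaller end; any symmetric choice of an end would do. All
  -- edges are used up, so the partition serves every ε ≥ 0.
  starPartition : ∀ {n} (G : Graph n) → Σ (EdgePartition G n) λ p →
    (∀ j → DiamLe p (suc j) 2) × (sizeE₀ p ≡ 0)
  starPartition {n} G = p , diam , trans (sizeE₀≡ p) (sum-zero _ λ u → sum-zero _ λ v → none u v)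
    where
    p : EdgePartition G n
    p = record { cls = λ u v → suc (minFin u v) ; clsSym = λ u v _ → cong suc (minFin-comm u v) }
    none : ∀ u v → ⟦ (toℕ u <ᵇ toℕ v) ∧ adj G u v ∧ false ⟧ ≡ 0
    none u v rewrite ∧-zeroʳ (adj G u v) | ∧-zeroʳ (toℕ u <ᵇ toℕ v) = refl
    flip : ∀ {j u v} → InClass p j u v → InClass p j v u
    flip {u = u} {v} (a , c) = trans (Graph.sym G v u) a , trans (cong suc (minFin-comm v u)) c
    near : ∀ j u → Covered p (suc j) u → u ≡ j ⊎ InClass p (suc j) u j
    near j u (w , a , c) with minFin-sel u w
    ... | inj₁ e = inj₁ (trans (sym e) (Finₚ.suc-injective c))
    ... | inj₂ e with refl ← trans (sym e) (Finₚ.suc-injective c) = inj₂ (a , c)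
    diam : ∀ j → DiamLe p (suc j) 2
    diam j u v cu cv with near j u cu | near j v cv
    ... | inj₁ refl | inj₁ refl = here
    ... | inj₁ refl | inj₂ r = step (flip r) here
    ... | inj₂ r | inj₁ refl = step r here
    ... | inj₂ r | inj₂ s = step r (step (flip s) here)

-- Blow-ups of bipartite graphs and the projection of classes.

module Blowups where

  open FiniteSums
  open Decompositions
  import Data.Bool as Bool
  open import Data.Nat
  open import Data.Nat.Properties
  open import Data.Fin as Fin using (Fin; zero; suc; toℕ; _↑ˡ_; _↑ʳ_; combine; remQuot; splitAt)
  import Data.Fin.Properties as Finₚ

  count : ∀ {m n} → (Fin m → Fin n → Bool) → ℕ
  count {m} {n} B = ∑[ x < m ] ∑[ y < n ] ⟦ B x y ⟧

  count-mono : ∀ {m n} {B C : Fin m → Fin n → Bool} → (∀ x y → B x y ≡ true → C x y ≡ true) → count B ≤ count C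
  count-mono h = sum-mono λ x → sum-mono λ y → ⟦⟧-mono (h x y)

  module Bipartite {a : ℕ} (B : Fin a → Fin a → Bool) where

    Vertex : Set
    Vertex = Fin a ⊎ Fin a

    Edge : Vertex → Vertex → Set
    Edge (inj₁ x) (inj₂ y) = B x y ≡ true
    Edge (inj₂ y) (inj₁ x) = B x y ≡ true
    Edge _        _        = ⊥

    data Path : ℕ → Vertex → Vertex → Set where
      here : ∀ {k u} → Path k u u
      step : ∀ {k u w v} → Edge u w → Path k w v → Path (suc k) u v

    Touched : Vertex → Set
    Touched u = ∃ λ v → Edge u v

    Diam : ℕ → Set
    Diam d = ∀ u v → Touched u → Touched v → Path d u v

  Small : ∀ {a} → (Fin a → Fin a → Bool) → ℕ → ℕ → Set
  Small {a} R d h = ∀ (H : Fin a → Fin a → Bool) → (∀ x y → H x y ≡ true → R x y ≡ true) →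
    Bipartite.Diam H d → count H ≤ h

  -- Vertices are numbered with the left blocks first, then the right blocks, then s isolated vertices.
  module Blowup {a : ℕ} (t s : ℕ) (R : Fin a → Fin a → Bool) where

    m n : ℕ
    m = a * t
    n = m + (m + s)

    cell : Fin a → Fin t → Fin m
    cell = combine

    data Loc : Set where
      left right : Fin a → Loc
      spare : Loc

    loc′ : Fin m ⊎ Fin (m + s) → Loc
    loc″ : Fin m ⊎ Fin s → Loc
    loc′ (inj₁ i) = left (proj₁ (remQuot {a} t i))
    loc′ (inj₂ j) = loc″ (splitAt m j)
    loc″ (inj₁ j) = right (proj₁ (remQuot {a} t j))
    loc″ (inj₂ _) = spare

    loc : Fin n → Loc
    loc u = loc′ (splitAt m u)

    lt rt : Fin m → Fin n
    lt i = i ↑ˡ (m + s)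
    rt j = m ↑ʳ (j ↑ˡ s)

    loc-lt : ∀ x i → loc (lt (cell x i)) ≡ left x
    loc-lt x i = trans (cong loc′ (Finₚ.splitAt-↑ˡ m (cell x i) (m + s)))
      (cong (left ∘ proj₁) (Finₚ.remQuot-combine x i))

    loc-rt : ∀ y j → loc (rt (cell y j)) ≡ right y
    loc-rt y j = trans (cong loc′ (Finₚ.splitAt-↑ʳ m (m + s) (cell y j ↑ˡ s)))
      (trans (cong loc″ (Finₚ.splitAt-↑ˡ m (cell y j) s)) (cong (right ∘ proj₁) (Finₚ.remQuot-combine y j)))

    data View (u : Fin n) : Set where
      isLeft  : ∀ x i → u ≡ lt (cell x i) → View u
      isRight : ∀ y j → u ≡ rt (cell y j) → View u
      isSpare : loc u ≡ spare → View u

    view : ∀ u → View u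
    view u with splitAt m u in e
    ... | inj₁ i = isLeft _ _ (trans (sym (Finₚ.splitAt⁻¹-↑ˡ e)) (cong lt (sym (Finₚ.combine-remQuot {a} t i))))
    ... | inj₂ j with splitAt m j in e′
    ...   | inj₁ k = isRight _ _ (trans (sym (Finₚ.splitAt⁻¹-↑ʳ e)) (cong (m ↑ʳ_)
                       (trans (sym (Finₚ.splitAt⁻¹-↑ˡ e′)) (cong (_↑ˡ s) (sym (Finₚ.combine-remQuot {a} t k))))))
    ...   | inj₂ k = isSpare (trans (cong loc′ e) (cong loc″ e′))

    adjLoc : Loc → Loc → Bool
    adjLoc (left x)  (right y) = R x y
    adjLoc (right y) (left x)  = R x y
    adjLoc _         _         = false

    adjLoc-sym : ∀ p q → adjLoc p q ≡ adjLoc q p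
    adjLoc-sym (left x)  (left y)  = refl
    adjLoc-sym (left x)  (right y) = refl
    adjLoc-sym (left x)  spare     = refl
    adjLoc-sym (right x) (left y)  = refl
    adjLoc-sym (right x) (right y) = refl
    adjLoc-sym (right x) spare     = refl
    adjLoc-sym spare     (left y)  = refl
    adjLoc-sym spare     (right y) = refl
    adjLoc-sym spare     spare     = refl

    adjLoc-irref : ∀ p → adjLoc p p ≡ false
    adjLoc-irref (left x)  = refl
    adjLoc-irref (right x) = refl
    adjLoc-irref spare     = refl

    graph : Graph n
    graph = record
      { adj   = λ u v → adjLoc (loc u) (loc v)
      ; sym   = λ u v → adjLoc-sym (loc u) (loc v)
      ; irref = λ u → adjLoc-irref (loc u)
      }

    adj-lr : ∀ x i y j → adj graph (lt (cell x i)) (rt (cell y j)) ≡ R x y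
    adj-lr x i y j = cong₂ adjLoc (loc-lt x i) (loc-rt y j)

    lt<ᵇrt : ∀ i j → (toℕ (lt i) <ᵇ toℕ (rt j)) ≡ true
    lt<ᵇrt i j = <⇒<ᵇ≡ (begin-strict
      toℕ (lt i)           ≡⟨ Finₚ.toℕ-↑ˡ i (m + s) ⟩
      toℕ i                <⟨ Finₚ.toℕ<n i ⟩
      m                    ≤⟨ m≤m+n m _ ⟩
      m + toℕ (j ↑ˡ s)     ≡⟨ Finₚ.toℕ-↑ʳ m (j ↑ˡ s) ⟨
      toℕ (rt j)           ∎)
      where
      open ≤-Reasoning
      <⇒<ᵇ≡ : ∀ {x y} → x < y → (x <ᵇ y) ≡ true
      <⇒<ᵇ≡ {x} {y} lt with x <ᵇ y | <⇒<ᵇ lt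
      ... | true | _ = refl

    module _ {ℓ d : ℕ} (p : EdgePartition graph ℓ) (diam : ∀ j → DiamLe p (suc j) d) where

      inClass : Fin (suc ℓ) → Fin m → Fin m → Bool
      inClass k u v = adj graph (lt u) (rt v) ∧ eqᵇ (cls p (lt u) (rt v)) k

      H? : ∀ k x y → Dec (∃ λ i → ∃ λ j → inClass k (cell x i) (cell y j) ≡ true)
      H? k x y = Finₚ.any? λ i → Finₚ.any? λ j → inClass k (cell x i) (cell y j) Bool.≟ true

      H : Fin (suc ℓ) → Fin a → Fin a → Bool
      H k x y = does (H? k x y)

      H-elim : ∀ {k x y} → H k x y ≡ true → ∃ λ i → ∃ λ j → inClass k (cell x i) (cell y j) ≡ true
      H-elim {k} {x} {y} = from-does (H? k x y)

      H⊆R : ∀ k x y → H k x y ≡ true → R x y ≡ true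
      H⊆R k x y h with i , j , e ← H-elim h =
        trans (sym (adj-lr x i y j)) (proj₁ (∧-true e))

      inClass-intro : ∀ {k u v} → InClass p k (lt u) (rt v) → inClass k u v ≡ true
      inClass-intro {k} {u} {v} (e , c) = ∧-intro e (does-true (cls p (lt u) (rt v) Finₚ.≟ k) c)

      inClass-elim : ∀ {k u v} → inClass k u v ≡ true → InClass p k (lt u) (rt v)
      inClass-elim {k} {u} {v} h = let e , c = ∧-true h in e , from-does (cls p (lt u) (rt v) Finₚ.≟ k) c

      flip : ∀ {k u v} → InClass p k u v → InClass p k v u
      flip {k} {u} {v} (e , c) = trans (Graph.sym graph v u) e , trans (sym (clsSym p u v e)) c

      module _ (k : Fin ℓ) where
        open Bipartite (H (suc k))

        At : Vertex → Fin n → Set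
        At (inj₁ x) u = loc u ≡ left x
        At (inj₂ y) u = loc u ≡ right y

        -- This is the homomorphism that makes walks project: a class edge joins a left block to a
        -- right block, spare vertices being isolated, and so witnesses an edge of H.
        edge : ∀ {u v} → InClass p (suc k) u v → ∀ {q} → At q u → ∃ λ q′ → At q′ v × Edge q q′
        edge {u} {v} c {q} at with view u | view v
        edge c {inj₁ x} at | isLeft x′ i refl | isRight y j refl with refl ← trans (sym at) (loc-lt x′ i) =
          inj₂ y , loc-rt y j , does-true (H? (suc k) x y) (i , j , inClass-intro c)
        edge c {inj₂ x} at | isLeft x′ i refl | isRight y j refl with () ← trans (sym at) (loc-lt x′ i)
        edge c {inj₂ y} at | isRight y′ j refl | isLeft x i refl with refl ← trans (sym at) (loc-rt y′ j) =
          inj₁ x , loc-lt x i , does-true (H? (suc k) x y) (i , j , inClass-intro (flip c))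
        edge c {inj₁ y} at | isRight y′ j refl | isLeft x i refl with () ← trans (sym at) (loc-rt y′ j)
        edge c at | isLeft x i refl | isLeft x′ i′ refl
          with () ← trans (sym (proj₁ c)) (cong₂ adjLoc (loc-lt x i) (loc-lt x′ i′))
        edge c at | isRight x i refl | isRight x′ i′ refl
          with () ← trans (sym (proj₁ c)) (cong₂ adjLoc (loc-rt x i) (loc-rt x′ i′))
        edge {u} {v} c at | isSpare e | _
          with () ← trans (sym (proj₁ c)) (cong (λ l → adjLoc l (loc v)) e)
        edge {u} {v} c at | _ | isSpare e
          with () ← trans (sym (proj₁ c)) (trans (adjLoc-sym (loc u) (loc v)) (cong (λ l → adjLoc l (loc u)) e))

        At-unique : ∀ {u} q q′ → At q u → At q′ u → q ≡ q′
        At-unique (inj₁ x) (inj₁ y) e e′ with refl ← trans (sym e) e′ = refl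
        At-unique (inj₁ x) (inj₂ y) e e′ with () ← trans (sym e) e′
        At-unique (inj₂ x) (inj₁ y) e e′ with () ← trans (sym e) e′
        At-unique (inj₂ x) (inj₂ y) e e′ with refl ← trans (sym e) e′ = refl

        project : ∀ {d u v} → WalkLe (InClass p (suc k)) d u v → ∀ {q q′} → At q u → At q′ v → Path d q q′
        project here {q} {q′} at at′ with refl ← At-unique q q′ at at′ = here
        project (step c w) at at′ with _ , at″ , e ← edge c at = step e (project w at″ at′)

        lift : ∀ q → Touched q → ∃ λ u → At q u × Covered p (suc k) u
        lift (inj₁ x) (inj₂ y , h) with i , j , e ← H-elim h =
          _ , loc-lt x i , _ , inClass-elim e
        lift (inj₂ y) (inj₁ x , h) with i , j , e ← H-elim h =
          _ , loc-rt y j , _ , flip (inClass-elim e)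

        -- Projection cannot increase distances: a touched block contains a covered vertex, and a
        -- walk between two such vertices projects to a path under the same length bound.
        H-diam : Diam d
        H-diam q q′ τ τ′ with u , at , c ← lift q τ | v , at′ , c′ ← lift q′ τ′ =
          project (diam k u v c c′) at at′

      classCount : Fin (suc ℓ) → ℕ
      classCount k = count (inClass k)

      blocks : ∀ (f : Fin m → Fin m → ℕ) (g : Fin a → Fin a → ℕ) →
        (∀ x i y j → f (cell x i) (cell y j) ≡ g x y) →
        ∑[ u < m ] ∑[ v < m ] f u v ≡ t * t * ∑[ x < a ] ∑[ y < a ] g x y
      blocks f g h = begin
        ∑[ u < m ] ∑[ v < m ] f u v
          ≡⟨ sum-combine a (λ u → ∑[ v < m ] f u v) ⟩
        ∑[ x < a ] ∑[ i < t ] ∑[ v < m ] f (cell x i) v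
          ≡⟨ sum-cong-≗ (λ x → sum-cong-≗ λ i → trans (sum-combine a (f (cell x i)))
               (sum-cong-≗ λ y → trans (sum-cong-≗ λ j → h x i y j) (sum-const t (g x y)))) ⟩
        ∑[ x < a ] ∑[ i < t ] ∑[ y < a ] (t * g x y)
          ≡⟨ sum-cong-≗ (λ x → trans (sum-const t _) (cong (t *_) (sym (*-distribˡ-sum t (g x))))) ⟩
        ∑[ x < a ] (t * (t * ∑[ y < a ] g x y))
          ≡⟨ trans (*-distribˡ-sum (t * t) (λ x → sum (g x))) (sum-cong-≗ λ x → *-assoc t t _) ⟨
        t * t * ∑[ x < a ] ∑[ y < a ] g x y ∎
        where open ≡-Reasoning

      -- A class lies inside the blow-up of its projection, where each projected edge becomes t²
      -- edges.
      classCount-suc : ∀ k → classCount (suc k) ≤ t * t * count (H (suc k))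
      classCount-suc k = ≤-trans (count-mono {C = C} sub)
        (≤-reflexive (blocks (λ u v → ⟦ C u v ⟧) (λ x y → ⟦ H (suc k) x y ⟧) λ x i y j → cong ⟦_⟧
          (cong₂ (H (suc k)) (cong proj₁ (Finₚ.remQuot-combine x i)) (cong proj₁ (Finₚ.remQuot-combine y j)))))
        where
        C : Fin m → Fin m → Bool
        C u v = H (suc k) (proj₁ (remQuot {a} t u)) (proj₁ (remQuot {a} t v))
        sub : ∀ u v → inClass (suc k) u v ≡ true → C u v ≡ true
        sub u v h = does-true (H? (suc k) _ _) (proj₂ (remQuot {a} t u) , proj₂ (remQuot {a} t v) ,
          subst₂ (λ u v → inClass (suc k) u v ≡ true)
            (sym (Finₚ.combine-remQuot {a} t u)) (sym (Finₚ.combine-remQuot {a} t v)) h)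

      -- All left vertices are numbered before all right ones, so the condition u < v in `sizeE₀`
      -- holds for every left-right pair.
      classCount-zero : classCount zero ≤ sizeE₀ p
      classCount-zero = begin
        ∑[ u < m ] ∑[ v < m ] ⟦ inClass zero u v ⟧
          ≡⟨ sum-cong-≗ (λ u → sum-cong-≗ λ v → cong (λ b → ⟦ b ∧ inClass zero u v ⟧) (lt<ᵇrt u v)) ⟨
        ∑[ u < m ] ∑[ v < m ] f (lt u) (rt v)
          ≤⟨ sum-mono (λ u → ≤-trans (m≤m+n _ _) (≤-reflexive (sym (sum-split m (λ j → f (lt u) (m ↑ʳ j)))))) ⟩
        ∑[ u < m ] ∑[ j < m + s ] f (lt u) (m ↑ʳ j)
          ≤⟨ sum-mono (λ u → ≤-trans (m≤n+m _ _) (≤-reflexive (sym (sum-split m (f (lt u)))))) ⟩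
        ∑[ u < m ] ∑[ v < n ] f (lt u) v
          ≤⟨ ≤-trans (m≤m+n _ _) (≤-reflexive (sym (sum-split m (λ u → ∑[ v < n ] f u v)))) ⟩
        ∑[ u < n ] ∑[ v < n ] f u v
          ≡⟨ sizeE₀≡ p ⟨
        sizeE₀ p ∎
        where
        open ≤-Reasoning
        f : Fin n → Fin n → ℕ
        f u v = ⟦ (toℕ u <ᵇ toℕ v) ∧ adj graph u v ∧ isZero (cls p u v) ⟧

      sum-classCount : ∑[ k < suc ℓ ] classCount k ≡ t * t * count R
      sum-classCount = begin
        ∑[ k < suc ℓ ] ∑[ u < m ] ∑[ v < m ] ⟦ inClass k u v ⟧
          ≡⟨ ∑-swap (λ k u → ∑[ v < m ] ⟦ inClass k u v ⟧) ⟩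
        ∑[ u < m ] ∑[ k < suc ℓ ] ∑[ v < m ] ⟦ inClass k u v ⟧
          ≡⟨ sum-cong-≗ (λ u → ∑-swap (λ k v → ⟦ inClass k u v ⟧)) ⟩
        ∑[ u < m ] ∑[ v < m ] ∑[ k < suc ℓ ] ⟦ inClass k u v ⟧
          ≡⟨ sum-cong-≗ (λ u → sum-cong-≗ λ v → one u v) ⟩
        ∑[ u < m ] ∑[ v < m ] ⟦ adj graph (lt u) (rt v) ⟧
          ≡⟨ blocks (λ u v → ⟦ adj graph (lt u) (rt v) ⟧) (λ x y → ⟦ R x y ⟧) (λ x i y j → cong ⟦_⟧ (adj-lr x i y j)) ⟩
        t * t * count R ∎
        where
        open ≡-Reasoning
        one : ∀ u v → ∑[ k < suc ℓ ] ⟦ inClass k u v ⟧ ≡ ⟦ adj graph (lt u) (rt v) ⟧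
        one u v with adj graph (lt u) (rt v)
        ... | false = sum-zero _ λ _ → refl
        ... | true  = sum-unique (cls p (lt u) (rt v)) _ (eqᵇ-refl (cls p (lt u) (rt v)))
                        (λ i h → sym (eqᵇ⇒≡ {i = cls p (lt u) (rt v)} h))

      blowup-bound : ∀ {h} → Small R d h → t * t * count R ≤ sizeE₀ p + ℓ * (t * t * h)
      blowup-bound {h} small = begin
        t * t * count R                 ≡⟨ sum-classCount ⟨
        ∑[ k < suc ℓ ] classCount k     ≡⟨ sum-suc classCount ⟩
        classCount zero + ∑[ k < ℓ ] classCount (suc k)
          ≤⟨ +-mono-≤ classCount-zero (sum≤const (t * t * h) λ k →
               ≤-trans (classCount-suc k) (*-monoʳ-≤ (t * t) (small (H (suc k)) (H⊆R (suc k)) (H-diam k)))) ⟩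
        sizeE₀ p + ℓ * (t * t * h)      ∎
        where open ≤-Reasoning

  lowerBoundGraph : ∀ {a d h} n t (R : Fin a → Fin a → Bool) → Small R d h → a * t + a * t ≤ n →
    Σ (Graph n) λ G → ∀ {ℓ} (p : EdgePartition G ℓ) → (∀ j → DiamLe p (suc j) d) →
      t * t * count R ≤ sizeE₀ p + ℓ * (t * t * h)
  lowerBoundGraph {a} {d} {h} n t R small fits with s , refl ← m≤n⇒∃[o]m+o≡n fits =
    subst (λ n → Σ (Graph n) λ G → ∀ {ℓ} (p : EdgePartition G ℓ) → (∀ j → DiamLe p (suc j) d) →
        t * t * count R ≤ sizeE₀ p + ℓ * (t * t * h))
      (sym (+-assoc (a * t) (a * t) s))
      (Blowup.graph t s R , λ p diam → Blowup.blowup-bound t s R p diam small)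

-- Arithmetic modulo a prime, with integers as representatives.

module Residues where

  open FiniteSums
  open import Data.Nat as ℕ using (ℕ; zero; suc)
  import Data.Nat.Properties as ℕₚ
  import Data.Nat.Divisibility as ℕᵈ
  open import Data.Nat.Primality using (Prime; prime⇒irreducible; prime⇒nonZero; prime⇒nonTrivial; euclidsLemma)
  open import Data.Nat.Coprimality using (Coprime; coprime-Bézout)
  open import Data.Nat.GCD using (module Bézout)
  open import Data.Integer hiding (suc)
  open import Data.Integer.Properties
  open import Data.Integer.Divisibility.Signed
  import Data.Integer.DivMod as ℤᵈ
  open import Data.Integer.Tactic.RingSolver using (solve-∀)
  open import Data.Fin as Fin using (Fin; zero; suc; toℕ; fromℕ<)
  import Data.Fin.Properties as Finₚ

  ∣-resp : ∀ {k x y : ℤ} → x ≡ y → k ∣ x → k ∣ y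
  ∣-resp refl h = h

  -- Congruences are derived below as explicit combinations of known ones, which leaves a polynomial
  -- identity to the ring solver.
  ∣-comb : ∀ {k x y : ℤ} a b → k ∣ x → k ∣ y → k ∣ a * x + b * y
  ∣-comb a b h h′ = ∣m∣n⇒∣m+n (∣n⇒∣m*n a h) (∣n⇒∣m*n b h′)

  ∣-diff-comm : ∀ {k} x y → k ∣ x - y → k ∣ y - x
  ∣-diff-comm x y h = ∣-resp (lem x y) (∣m⇒∣-m h)
    where
    lem : ∀ x y → - (x - y) ≡ y - x
    lem = solve-∀

  small-multiple : ∀ {p m n} → n ℕ.≤ m → m ℕ.< p → + p ∣ + m - + n → m ≡ n
  small-multiple {p} {m} {n} n≤m m<p h = ℕₚ.≤-antisym (ℕₚ.m∸n≡0⇒m≤n z) n≤m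
    where
    d : p ℕᵈ.∣ m ℕ.∸ n
    d = subst (p ℕᵈ.∣_) (cong ∣_∣ (trans (m-n≡m⊖n m n) (⊖-≥ n≤m))) (∣⇒∣ᵤ h)
    z : m ℕ.∸ n ≡ 0
    z with m ℕ.∸ n in e
    ... | zero  = refl
    ... | suc k = contradiction (subst (p ℕᵈ.∣_) e d)
      (ℕᵈ.>⇒∤ (subst (ℕ._< p) e (ℕₚ.≤-<-trans (ℕₚ.m∸n≤m m n) m<p)))

  residue-unique : ∀ {p} (a b : Fin p) → + p ∣ + toℕ a - + toℕ b → a ≡ b
  residue-unique a b h with ℕₚ.≤-total (toℕ b) (toℕ a)
  ... | inj₁ b≤a = Finₚ.toℕ-injective (small-multiple b≤a (Finₚ.toℕ<n a) h)
  ... | inj₂ a≤b = sym (Finₚ.toℕ-injective (small-multiple a≤b (Finₚ.toℕ<n b) (∣-diff-comm (+ toℕ a) (+ toℕ b) h)))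

  module ModPrime {p : ℕ} (pr : Prime p) where

    private instance
      p≢0 : ℕ.NonZero p
      p≢0 = prime⇒nonZero pr

    euclid : ∀ a b → + p ∣ a * b → (+ p ∣ a) ⊎ (+ p ∣ b)
    euclid a b h with euclidsLemma ∣ a ∣ ∣ b ∣ pr (subst (p ℕᵈ.∣_) (abs-* a b) (∣⇒∣ᵤ h))
    ... | inj₁ h′ = inj₁ (∣ᵤ⇒∣ h′)
    ... | inj₂ h′ = inj₂ (∣ᵤ⇒∣ h′)

    cancel : ∀ {a b} → ¬ + p ∣ a → + p ∣ a * b → + p ∣ b
    cancel {a} {b} na h with euclid a b h
    ... | inj₁ h′ = contradiction h′ na
    ... | inj₂ h′ = h′

    *-nonzero : ∀ {a b} → ¬ + p ∣ a → ¬ + p ∣ b → ¬ + p ∣ a * b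
    *-nonzero na nb h = nb (cancel na h)

    coprime-abs : ∀ {d} → ¬ + p ∣ d → Coprime p ∣ d ∣
    coprime-abs nd (i∣p , i∣d) with prime⇒irreducible pr i∣p
    ... | inj₁ e    = e
    ... | inj₂ refl = contradiction (∣ᵤ⇒∣ i∣d) nd

    inverse-abs : ∀ {d} → ¬ + p ∣ d → ∃ λ e → + p ∣ e * + ∣ d ∣ - 1ℤ
    inverse-abs {d} nd with coprime-Bézout (coprime-abs nd)
    ... | Bézout.Identity.+- x y eq = - (+ y) , divides (- (+ x)) (lem (+ x) (+ y) (+ ∣ d ∣) (+ p) cast)
      where
      cast : 1ℤ + + y * + ∣ d ∣ ≡ + x * + p
      cast = trans (cong (λ k → 1ℤ + k) (sym (pos-* y ∣ d ∣))) (trans (cong (λ k → + k) eq) (pos-* x p))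
      lem : ∀ x y d p → 1ℤ + y * d ≡ x * p → - y * d - 1ℤ ≡ - x * p
      lem x y d p e = trans (lem₁ y d) (trans (cong -_ e) (lem₂ x p))
        where
        lem₁ : ∀ y d → - y * d - 1ℤ ≡ - (1ℤ + y * d)
        lem₁ = solve-∀
        lem₂ : ∀ x p → - (x * p) ≡ - x * p
        lem₂ = solve-∀
    ... | Bézout.Identity.-+ x y eq = + y , divides (+ x) (lem (+ y) (+ x * + p) (+ y * + ∣ d ∣) cast)
      where
      cast : 1ℤ + + x * + p ≡ + y * + ∣ d ∣
      cast = trans (cong (λ k → 1ℤ + k) (sym (pos-* x p))) (trans (cong (λ k → + k) eq) (pos-* y ∣ d ∣))
      lem : ∀ y xp yd → 1ℤ + xp ≡ yd → yd - 1ℤ ≡ xp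
      lem y xp yd refl = lem₁ xp
        where
        lem₁ : ∀ xp → 1ℤ + xp - 1ℤ ≡ xp
        lem₁ = solve-∀

    inverse : ∀ {d} → ¬ + p ∣ d → ∃ λ e → + p ∣ e * d - 1ℤ
    inverse {d} nd with inverse-abs nd | +∣i∣≡i⊎+∣i∣≡-i d
    ... | e , h | inj₁ eq = e , ∣-resp (cong (λ x → e * x - 1ℤ) eq) h
    ... | e , h | inj₂ eq = - e , ∣-resp (trans (cong (λ x → e * x - 1ℤ) eq) (lem e d)) h
      where
      lem : ∀ e d → e * (- d) - 1ℤ ≡ - e * d - 1ℤ
      lem = solve-∀

    -- The solution is the residue of e·s, where e inverts d modulo p.
    linear-solve : ∀ {d} → ¬ + p ∣ d → ∀ s → ∃ λ (a : Fin p) → + p ∣ + toℕ a * d - s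
    linear-solve {d} nd s with e , h ← inverse nd = a , ∣-resp eq (∣-comb (- (z ℤᵈ./ℕ p) * d) s ∣-refl h)
      where
      z = e * s
      a = fromℕ< (ℤᵈ.n%ℕd<d z p)
      ta : + toℕ a ≡ + (z ℤᵈ.%ℕ p)
      ta = cong (λ k → + k) (Finₚ.toℕ-fromℕ< (ℤᵈ.n%ℕd<d z p))
      lem : ∀ r w p d s e → r + w * p ≡ e * s → (- w * d) * p + s * (e * d - 1ℤ) ≡ r * d - s
      lem r w p d s e eq = trans (lem₁ w p d s e) (trans (cong (λ k → (- w * d) * p + (k * d - s)) (sym eq)) (lem₂ r w p d s))
        where
        lem₁ : ∀ w p d s e → (- w * d) * p + s * (e * d - 1ℤ) ≡ (- w * d) * p + ((e * s) * d - s)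
        lem₁ = solve-∀
        lem₂ : ∀ r w p d s → (- w * d) * p + ((r + w * p) * d - s) ≡ r * d - s
        lem₂ = solve-∀
      eq : (- (z ℤᵈ./ℕ p) * d) * + p + s * (e * d - 1ℤ) ≡ + toℕ a * d - s
      eq = trans (lem (+ (z ℤᵈ.%ℕ p)) (z ℤᵈ./ℕ p) (+ p) d s e (sym (ℤᵈ.a≡a%ℕn+[a/ℕn]*n z p)))
        (cong (λ r → r * d - s) (sym ta))

    linear-unique : ∀ {d} → ¬ + p ∣ d → ∀ s (a b : Fin p) →
      + p ∣ + toℕ a * d - s → + p ∣ + toℕ b * d - s → a ≡ b
    linear-unique {d} nd s a b h h′ = residue-unique a b (cancel nd
      (∣-resp (lem (+ toℕ a) (+ toℕ b) d s) (∣m∣n⇒∣m-n h h′)))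
      where
      lem : ∀ a b d s → (a * d - s) - (b * d - s) ≡ d * (a - b)
      lem = solve-∀

    ∣p : ℤ → Bool
    ∣p z = does (+ p ∣? z)

    ∣p-elim : ∀ z → ∣p z ≡ true → + p ∣ z
    ∣p-elim z = from-does (+ p ∣? z)

    ∣p-intro : ∀ z → + p ∣ z → ∣p z ≡ true
    ∣p-intro z = does-true (+ p ∣? z)

    linear-count : ∀ {d} → ¬ + p ∣ d → ∀ s → ∑[ a < p ] ⟦ ∣p (+ toℕ a * d - s) ⟧ ≡ 1
    linear-count {d} nd s = sum-unique (proj₁ sol) b (∣p-intro (+ toℕ (proj₁ sol) * d - s) (proj₂ sol))
        (λ c h → linear-unique nd s c (proj₁ sol) (∣p-elim (+ toℕ c * d - s) h) (proj₂ sol))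
      where
      sol : ∃ λ (a : Fin p) → + p ∣ + toℕ a * d - s
      sol = linear-solve nd s
      b : Fin p → Bool
      b a = ∣p (+ toℕ a * d - s)

    ¬p∣1 : ¬ + p ∣ 1ℤ
    ¬p∣1 h = ℕ.nonTrivial⇒≢1 (ℕᵈ.∣1⇒≡1 (∣⇒∣ᵤ h))
      where
      instance
        nt : ℕ.NonTrivial p
        nt = prime⇒nonTrivial pr

-- Configurations of points and lines modulo p, closed under joining and meeting.

module ClosedConfigurations where

  open FiniteSums
  open Residues
  open import Data.Nat as ℕ using (ℕ; zero; suc)
  open import Data.Nat.Primality using (Prime)
  open import Data.Integer hiding (suc)
  open import Data.Integer.Properties
  open import Data.Integer.Divisibility.Signed
  open import Data.Integer.Tactic.RingSolver using (solve-∀)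
  open import Data.Fin as Fin using (zero; suc; toℕ)

  -- I stands for an arbitrary subset of the incidences y = mx + b modulo p. The force of `join` and
  -- `meet` is that the connecting line and the common point are incident in I itself; in
  -- particular, distinct lines carrying points of I are never parallel.
  module ClosedConfiguration {p : ℕ} (pr : Prime p) {Pt Ln : Set}
    (px py : Pt → ℤ) (lm lb : Ln → ℤ) (I : Pt → Ln → Set)
    (incident : ∀ {P L} → I P L → + p ∣ py P - (lm L * px P + lb L))
    (Pt-ext : ∀ {P Q} → + p ∣ px P - px Q → + p ∣ py P - py Q → P ≡ Q)
    (Ln-ext : ∀ {L M} → + p ∣ lm L - lm M → + p ∣ lb L - lb M → L ≡ M)
    (join : ∀ {P Q L M} → I P L → I Q M → ∃ λ N → I P N × I Q N)
    (meet : ∀ {P Q L M} → I P L → I Q M → ∃ λ R → I R L × I R M) where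

    open ModPrime pr

    slope : ∀ {P Q L} → I P L → I Q L → + p ∣ (py Q - py P) - lm L * (px Q - px P)
    slope {P} {Q} {L} i j = ∣-resp (lem (py P) (py Q) (px P) (px Q) (lm L) (lb L)) (∣m∣n⇒∣m-n (incident j) (incident i))
      where
      lem : ∀ y y′ x x′ m b → (y′ - (m * x′ + b)) - (y - (m * x + b)) ≡ (y′ - y) - m * (x′ - x)
      lem = solve-∀

    Pt-unique : ∀ {P Q L} → I P L → I Q L → + p ∣ px P - px Q → P ≡ Q
    Pt-unique {P} {Q} {L} i j h = Pt-ext h
      (∣-resp (lem (py P) (py Q) (px P) (px Q) (lm L)) (∣-comb 1ℤ (lm L) (slope j i) h))
      where
      lem : ∀ y y′ x x′ m → 1ℤ * ((y - y′) - m * (x - x′)) + m * (x - x′) ≡ y - y′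
      lem = solve-∀

    Ln-unique : ∀ {P L M} → I P L → I P M → + p ∣ lm L - lm M → L ≡ M
    Ln-unique {P} {L} {M} i j h = Ln-ext h
      (∣-resp (lem (py P) (px P) (lm L) (lb L) (lm M) (lb M))
        (∣m∣n⇒∣m-n (∣m∣n⇒∣m-n (incident j) (incident i)) (∣m⇒∣m*n (px P) h)))
      where
      lem : ∀ y x m b m′ b′ → (y - (m′ * x + b′)) - (y - (m * x + b)) - (m - m′) * x ≡ b - b′
      lem = solve-∀

    -- Subtracting the two slope relations gives (xQ - xP)(mL - mM) ≡ 0, and either factor yields an
    -- equality, of the points or of the lines.
    no-digon : ∀ {P Q L M} → I P L → I Q L → I P M → I Q M → ¬ P ≡ Q → L ≡ M
    no-digon {P} {Q} {L} {M} i j i′ j′ P≢Q = [ (λ h → contradiction (sym (Pt-unique j i h)) P≢Q) , Ln-unique i i′ ]′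
        (euclid (px Q - px P) (lm L - lm M)
          (∣-resp (lem (py Q - py P) (px Q - px P) (lm L) (lm M)) (∣m∣n⇒∣m-n (slope i′ j′) (slope i j))))
      where
      lem : ∀ y x m m′ → (y - m′ * x) - (y - m * x) ≡ x * (m - m′)
      lem = solve-∀

    -- Projecting L₀ onto L₁ from Q and back from Q′ is an elation of L₀ with centre s₀: in the coordinate
    -- 1/X, where X = x − x(s₀), it is the translation by K/W.  Its iterates reach 1/X = 0 modulo p, a
    -- point at infinity, which no point of the configuration can be.
    module Elation {s₀ L₀ L₁ L₂ Q Q′ s}
      (i₀ : I s₀ L₀) (i₁ : I s₀ L₁) (i₂ : I s₀ L₂)
      (L₀≢L₁ : ¬ L₀ ≡ L₁) (L₀≢L₂ : ¬ L₀ ≡ L₂) (L₁≢L₂ : ¬ L₁ ≡ L₂)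
      (iQ : I Q L₂) (iQ′ : I Q′ L₂) (Q≢s₀ : ¬ Q ≡ s₀) (Q′≢s₀ : ¬ Q′ ≡ s₀) (Q≢Q′ : ¬ Q ≡ Q′)
      (is : I s L₀) (s≢s₀ : ¬ s ≡ s₀) where

      X : Pt → ℤ
      X P = px P - px s₀

      mu lam kap W K : ℤ
      mu  = lm L₂ - lm L₀
      lam = lm L₁ - lm L₀
      kap = lm L₂ - lm L₁
      W = kap * (X Q * X Q′)
      K = lam * (X Q′ - X Q)

      X≢0 : ∀ {P L} → I P L → I s₀ L → ¬ P ≡ s₀ → ¬ + p ∣ X P
      X≢0 i j ne h = ne (Pt-unique i j h)

      slopes-distinct : ∀ {L M} → I s₀ L → I s₀ M → ¬ L ≡ M → ¬ + p ∣ lm M - lm L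
      slopes-distinct i j ne h = ne (sym (Ln-unique j i h))

      mu≢0 : ¬ + p ∣ mu
      mu≢0 = slopes-distinct i₀ i₂ L₀≢L₂

      W≢0 : ¬ + p ∣ W
      W≢0 = *-nonzero (slopes-distinct i₁ i₂ L₁≢L₂) (*-nonzero (X≢0 iQ i₂ Q≢s₀) (X≢0 iQ′ i₂ Q′≢s₀))

      K≢0 : ¬ + p ∣ K
      K≢0 = *-nonzero (slopes-distinct i₀ i₁ L₀≢L₁)
        (λ h → Q≢Q′ (sym (Pt-unique iQ′ iQ (∣-resp (lem (px Q′) (px Q) (px s₀)) h))))
        where
        lem : ∀ a b c → (a - c) - (b - c) ≡ a - b
        lem = solve-∀

      -- The collinearity determinant, found by eliminating the slope of N. Divided by X r · X r₁ ·
      -- X R it reads mu/X r₁ = kap/X r + lam/X R with mu = kap + lam, so projection from R is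
      -- affine in 1/X.
      collinear : ∀ {r r₁ R N} → I r L₀ → I r₁ L₁ → I R L₂ → I r N → I r₁ N → I R N →
        + p ∣ X r₁ * (kap * X R + lam * X r) - mu * X R * X r
      collinear {r} {r₁} {R} {N} ir ir₁ iR jr jr₁ jR = ∣-resp
        (lem (px s₀) (py s₀) (px r) (py r) (px r₁) (py r₁) (px R) (py R) (lm L₀) (lm L₁) (lm L₂) (lm N))
        (∣-comb (px R - px s₀ - (px r - px s₀)) (- (px r₁ - px s₀ - (px r - px s₀)))
          (∣m∣n⇒∣m-n (∣m∣n⇒∣m-n (slope i₁ ir₁) (slope i₀ ir)) (slope jr jr₁))
          (∣m∣n⇒∣m-n (∣m∣n⇒∣m-n (slope i₂ iR) (slope i₀ ir)) (slope jr jR)))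
        where
        lem : ∀ x₀ y₀ x y x₁ y₁ x₂ y₂ m₀ m₁ m₂ m →
          (x₂ - x₀ - (x - x₀)) * (((y₁ - y₀) - m₁ * (x₁ - x₀)) - ((y - y₀) - m₀ * (x - x₀)) - ((y₁ - y) - m * (x₁ - x)))
          + (- (x₁ - x₀ - (x - x₀))) * (((y₂ - y₀) - m₂ * (x₂ - x₀)) - ((y - y₀) - m₀ * (x - x₀)) - ((y₂ - y) - m * (x₂ - x)))
          ≡ (x₁ - x₀) * ((m₂ - m₁) * (x₂ - x₀) + (m₁ - m₀) * (x - x₀)) - (m₂ - m₀) * (x₂ - x₀) * (x - x₀)
        lem = solve-∀

      -- If t were s₀, then N would share r and s₀ with L and hence equal L. Then P would lie on
      -- both L and M, which have only s₀ in common.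
      off-centre : ∀ {L M N P r t} → I s₀ L → I s₀ M → ¬ L ≡ M → I P M → ¬ P ≡ s₀ → I r L → ¬ r ≡ s₀ →
        I P N → I r N → I t N → ¬ t ≡ s₀
      off-centre {L} {M} {N} {P} iL iM L≢M iP P≢s₀ ir r≢s₀ jP jr jt e =
        L≢M (no-digon (subst (I P) N≡L jP) iL iP iM P≢s₀)
        where
        N≡L : N ≡ L
        N≡L = no-digon jr (subst (λ z → I z N) e jt) ir iL r≢s₀

      -- Subtracting the collinearity relations for Q and Q′ eliminates X r₁ and leaves 1/X r′ = 1/X
      -- r + K/W; the congruence is this equation without denominators.
      elation : ∀ {r} → I r L₀ → ¬ r ≡ s₀ →
        ∃ λ r′ → I r′ L₀ × ¬ r′ ≡ s₀ × + p ∣ W * X r - X r′ * (W + K * X r)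
      elation {r} ir r≢s₀ =
        let N , jQ , jr      = join iQ ir
            r₁ , jr₁ , ir₁   = meet jr i₁
            N′ , jQ′ , jr₁′  = join iQ′ ir₁
            r′ , jr′ , ir′   = meet jr₁′ i₀
            r₁≢s₀ = off-centre i₀ i₂ L₀≢L₂ iQ Q≢s₀ ir r≢s₀ jQ jr jr₁
            r′≢s₀ = off-centre i₁ i₂ L₁≢L₂ iQ′ Q′≢s₀ ir₁ r₁≢s₀ jQ′ jr₁′ jr′
        in r′ , ir′ , r′≢s₀ , cancel (X≢0 ir₁ i₁ r₁≢s₀) (cancel mu≢0 (∣-resp
            (lem mu lam kap (X Q) (X Q′) (X r) (X r′) (X r₁))
            (∣-comb (mu * X Q * X r) (- (mu * X Q′ * X r′))
              (collinear ir′ ir₁ iQ′ jr′ jr₁′ jQ′)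
              (collinear ir ir₁ iQ jr jr₁ jQ))))
        where
        lem : ∀ mu lam kap u v x x′ x₁ →
          (mu * u * x) * (x₁ * (kap * v + lam * x′) - mu * v * x′) + (- (mu * v * x′)) * (x₁ * (kap * u + lam * x) - mu * u * x)
          ≡ mu * (x₁ * (kap * (u * v) * x - x′ * (kap * (u * v) + lam * (v - u) * x)))
        lem = solve-∀

      -- The congruence is 1/X r = 1/X s + jK/W, cleared of denominators.
      iterate : ∀ j → ∃ λ r → I r L₀ × ¬ r ≡ s₀ × + p ∣ W * X s - X r * (W + + j * (K * X s))
      iterate zero = s , is , s≢s₀ , ∣-resp (lem W (X s) (K * X s)) (∣n⇒∣m*n 0ℤ ∣-refl)
        where
        lem : ∀ W x k → 0ℤ * + p ≡ W * x - x * (W + 0ℤ * k)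
        lem W x k = lem′ W x k (+ p)
          where
          lem′ : ∀ W x k p → 0ℤ * p ≡ W * x - x * (W + 0ℤ * k)
          lem′ = solve-∀
      iterate (suc j) =
        let r , ir , r≢s₀ , T    = iterate j
            r′ , ir′ , r′≢s₀ , S = elation ir r≢s₀
        in r′ , ir′ , r′≢s₀ , cancel W≢0 (∣-resp (lem W K (X s) (X r) (X r′) (+ j))
            (∣-comb (W + + j * (K * X s)) (W - X r′ * K) S T))
        where
        lem : ∀ W K x r r′ j →
          (W + j * (K * x)) * (W * r - r′ * (W + K * r)) + (W - r′ * K) * (W * x - r * (W + j * (K * x)))
          ≡ W * (W * x - r′ * (W + (1ℤ + j) * (K * x)))
        lem = solve-∀

      impossible : ⊥
      impossible =
        -- The number a of iterations solves a·K·X s ≡ -W. It would make 1/X r vanish, and the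
        -- congruence collapses to W·X s ≡ 0.
        let a , h         = linear-solve (*-nonzero K≢0 (X≢0 is i₀ s≢s₀)) (- W)
            r , _ , _ , T = iterate (toℕ a)
        in *-nonzero W≢0 (X≢0 is i₀ s≢s₀) (∣-resp (lem W (X s) (X r) (K * X s) (+ toℕ a)) (∣-comb 1ℤ (X r) T h))
        where
        lem : ∀ W x r k a → 1ℤ * (W * x - r * (W + a * k)) + r * (a * k - - W) ≡ W * x
        lem = solve-∀

-- Pieces of matchings and of the affine plane are small.

module Incidences where

  open FiniteSums
  open Blowups
  open Residues
  open ClosedConfigurations
  open import Data.Nat as ℕ using (ℕ; suc; _+_; _*_; _≤_; _<_; z≤n; s≤s; _≤?_; _<?_)
  open import Data.Nat.Properties as ℕₚ using (≤-trans; ≤-refl; ≤-reflexive; module ≤-Reasoning)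
  open import Data.Nat.Primality using (Prime)
  import Data.Nat.Tactic.RingSolver as ℕ-Solver
  open import Data.Integer as ℤ using (ℤ; +_)
  import Data.Integer.Properties as ℤₚ
  open import Data.Integer.Divisibility.Signed using (_∣_)
  open import Data.Integer.Tactic.RingSolver using (solve-∀)
  open import Data.Fin as Fin using (Fin; suc; toℕ; combine; remQuot)
  import Data.Fin.Properties as Finₚ

  -- A path in a matching never changes the index, so a connected piece is a single edge.
  matching-small : ∀ {a} d → Small {a} eqᵇ d 1
  matching-small {a} d H H⊆ diam = ≤-trans (sum-mono row) (sum-atMostOne (λ x → H x x) unique)
    where
    open Bipartite H
    index : Vertex → Fin a
    index (inj₁ x) = x
    index (inj₂ y) = y
    edge-index : ∀ u v → Edge u v → index u ≡ index v
    edge-index (inj₁ x) (inj₂ y) h = eqᵇ⇒≡ (H⊆ x y h)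
    edge-index (inj₂ y) (inj₁ x) h = sym (eqᵇ⇒≡ (H⊆ x y h))
    path-index : ∀ {k u v} → Path k u v → index u ≡ index v
    path-index here = refl
    path-index (step {u = u} {w} e q) = trans (edge-index u w e) (path-index q)
    unique : ∀ x x′ → H x x ≡ true → H x′ x′ ≡ true → x ≡ x′
    unique x x′ h h′ = path-index (diam (inj₁ x) (inj₁ x′) (inj₂ x , h) (inj₂ x′ , h′))
    row : ∀ x → ∑[ y < a ] ⟦ H x y ⟧ ≤ ⟦ H x x ⟧
    row x with H x x in e
    ... | true  = sum-atMostOne (H x) λ y y′ h h′ → trans (sym (eqᵇ⇒≡ {i = x} (H⊆ x y h))) (eqᵇ⇒≡ {i = x} (H⊆ x y′ h′))
    ... | false = ≤-reflexive (sum-zero _ λ y → ⟦⟧≡0 λ h →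
        true≢false (trans (sym (subst (λ z → H x z ≡ true) (sym (eqᵇ⇒≡ (H⊆ x y h))) h)) e))

  matching-count : ∀ a → count {a} eqᵇ ≡ a
  matching-count a = trans (sum-cong-≗ λ x → sum-unique x (eqᵇ x) (eqᵇ-refl x) (λ y h → sym (eqᵇ⇒≡ h)))
    (trans (sum-const a 1) (ℕₚ.*-identityʳ a))

  third : ∀ {n} (b : Fin n → Bool) → 3 ≤ ∑[ i < n ] ⟦ b i ⟧ → ∀ i j → ∃ λ k → b k ≡ true × ¬ k ≡ i × ¬ k ≡ j
  third {n} b big i j with sum-<⇒∃< (λ k → ⟦ eqᵇ k i ⟧ + ⟦ eqᵇ k j ⟧) (λ k → ⟦ b k ⟧)
      (subst (_< ∑[ k < n ] ⟦ b k ⟧) (sym (trans (∑-distrib (λ k → ⟦ eqᵇ k i ⟧) (λ k → ⟦ eqᵇ k j ⟧))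
        (cong₂ _+_ (sum-eqᵇ i) (sum-eqᵇ j)))) big)
  ... | k , lt with b k in e | k Finₚ.≟ i | k Finₚ.≟ j
  ...   | true | no k≢i | no k≢j = k , e , k≢i , k≢j
  ...   | true | no _   | yes _  with s≤s () ← lt
  ...   | true | yes _  | _      with s≤s () ← lt

  module _ {a : ℕ} (H : Fin a → Fin a → Bool) where
    open Bipartite H

    -- A path between two left vertices has even length, so a bound of 3 is really a bound of 2.
    left-joined : ∀ {x x′ y} → H x y ≡ true → Path 3 (inj₁ x) (inj₁ x′) → ∃ λ z → H x z ≡ true × H x′ z ≡ true
    left-joined h here = _ , h , h
    left-joined h (step {w = inj₂ z} e (step {w = inj₁ _} e′ here)) = z , e , e′
    left-joined h (step {w = inj₂ _} e (step {w = inj₁ _} e′ (step {w = inj₂ _} e″ ())))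

    right-joined : ∀ {y y′ x} → H x y ≡ true → Path 3 (inj₂ y) (inj₂ y′) → ∃ λ z → H z y ≡ true × H z y′ ≡ true
    right-joined h here = _ , h , h
    right-joined h (step {w = inj₁ z} e (step {w = inj₂ _} e′ here)) = z , e , e′
    right-joined h (step {w = inj₁ _} e (step {w = inj₂ _} e′ (step {w = inj₁ _} e″ ())))

  transpose : ∀ {m n} → (Fin m → Fin n → Bool) → Fin n → Fin m → Bool
  transpose H y x = H x y

  rowSum : ∀ {m n} → (Fin m → Fin n → Bool) → Fin m → ℕ
  rowSum {n = n} H x = ∑[ y < n ] ⟦ H x y ⟧

  covered : ∀ {m n} → (Fin m → Fin n → Bool) → Fin m → Bool
  covered H x = does (0 <? rowSum H x)

  covered-elim : ∀ {m n} (H : Fin m → Fin n → Bool) {x} → covered H x ≡ true → ∃ λ y → H x y ≡ true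
  covered-elim H {x} c with sum-positive⇒∃ (λ y → ⟦ H x y ⟧) (from-does (0 <? rowSum H x) c)
  ... | y , q with H x y in e
  ...   | true = y , e

  covered-intro : ∀ {m n} (H : Fin m → Fin n → Bool) {x y} → H x y ≡ true → covered H x ≡ true
  covered-intro H {x} {y} h = does-true (0 <? rowSum H x)
    (≤-trans (≤-reflexive (sym (cong ⟦_⟧ h))) (term≤sum (λ y → ⟦ H x y ⟧) y))

  lightRows : ∀ {m n} (H : Fin m → Fin n → Bool) {c} → ∑[ x < m ] ⟦ covered H x ⟧ ≤ c →
    ∑[ x < m ] ∑[ y < n ] (⟦ does (rowSum H x ≤? 2) ⟧ * ⟦ H x y ⟧) ≤ 2 * c
  lightRows {m} {n} H {c} h = begin
    ∑[ x < m ] ∑[ y < n ] (⟦ does (rowSum H x ≤? 2) ⟧ * ⟦ H x y ⟧)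
      ≡⟨ sum-cong-≗ (λ x → *-distribˡ-sum ⟦ does (rowSum H x ≤? 2) ⟧ (λ y → ⟦ H x y ⟧)) ⟨
    ∑[ x < m ] (⟦ does (rowSum H x ≤? 2) ⟧ * rowSum H x)
      ≤⟨ sum-mono (λ x → pt (rowSum H x)) ⟩
    ∑[ x < m ] (2 * ⟦ covered H x ⟧)
      ≡⟨ *-distribˡ-sum 2 (λ x → ⟦ covered H x ⟧) ⟨
    2 * ∑[ x < m ] ⟦ covered H x ⟧
      ≤⟨ ℕₚ.*-monoʳ-≤ 2 h ⟩
    2 * c ∎
    where
    open ≤-Reasoning
    pt : ∀ d → ⟦ does (d ≤? 2) ⟧ * d ≤ 2 * ⟦ does (0 <? d) ⟧
    pt 0 = z≤n
    pt 1 = s≤s z≤n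
    pt 2 = ≤-refl
    pt (suc (suc (suc d))) = z≤n

  module AffinePlane {p : ℕ} (pr : Prime p) where

    open ModPrime pr

    first second : Fin (p * p) → ℤ
    first  i = + toℕ (proj₁ (remQuot {p} p i))
    second i = + toℕ (proj₂ (remQuot {p} p i))

    coords-ext : ∀ {P Q} → + p ∣ first P ℤ.- first Q → + p ∣ second P ℤ.- second Q → P ≡ Q
    coords-ext {P} {Q} h h′ = begin
      P                                                  ≡⟨ Finₚ.combine-remQuot {p} p P ⟨
      combine (proj₁ (remQuot {p} p P)) (proj₂ (remQuot {p} p P))
        ≡⟨ cong₂ combine (residue-unique (proj₁ (remQuot {p} p P)) (proj₁ (remQuot {p} p Q)) h)
             (residue-unique (proj₂ (remQuot {p} p P)) (proj₂ (remQuot {p} p Q)) h′) ⟩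
      combine (proj₁ (remQuot {p} p Q)) (proj₂ (remQuot {p} p Q))
        ≡⟨ Finₚ.combine-remQuot {p} p Q ⟩
      Q ∎
      where open ≡-Reasoning

    -- The line L is y = first L · x + second L; vertical lines are left out.
    incidence : Fin (p * p) → Fin (p * p) → Bool
    incidence P L = ∣p (second P ℤ.- (first L ℤ.* first P ℤ.+ second L))

    incidence-count : count incidence ≡ p * p * p
    incidence-count = begin
      ∑[ P < p * p ] ∑[ L < p * p ] ⟦ incidence P L ⟧
        ≡⟨ ∑-swap (λ P L → ⟦ incidence P L ⟧) ⟩
      ∑[ L < p * p ] ∑[ P < p * p ] ⟦ incidence P L ⟧
        ≡⟨ sum-cong-≗ (λ L → trans (sum-combine p (λ P → ⟦ incidence P L ⟧)) (trans (sum-cong-≗ (onVertical L)) (sum-const p 1))) ⟩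
      ∑[ L < p * p ] (p * 1)
        ≡⟨ trans (sum-const (p * p) (p * 1)) (cong (p * p *_) (ℕₚ.*-identityʳ p)) ⟩
      p * p * p ∎
      where
      open ≡-Reasoning
      onVertical : ∀ L x → ∑[ y < p ] ⟦ incidence (combine x y) L ⟧ ≡ 1
      onVertical L x = trans (sum-cong-≗ λ y → cong (⟦_⟧ ∘ ∣p) (cong₂ (λ q r → r ℤ.- (first L ℤ.* q ℤ.+ second L))
          (cong (λ z → + toℕ (proj₁ z)) (Finₚ.remQuot-combine x y))
          (trans (cong (λ z → + toℕ (proj₂ z)) (Finₚ.remQuot-combine x y)) (sym (ℤₚ.*-identityʳ (+ toℕ y))))))
        (linear-count ¬p∣1 (first L ℤ.* + toℕ x ℤ.+ second L))

    module _ (H : Fin (p * p) → Fin (p * p) → Bool)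
      (H⊆ : ∀ P L → H P L ≡ true → incidence P L ≡ true) (diam : Bipartite.Diam H 3) where

      I : Fin (p * p) → Fin (p * p) → Set
      I P L = H P L ≡ true

      incident : ∀ {P L} → I P L → + p ∣ second P ℤ.- (first L ℤ.* first P ℤ.+ second L)
      incident {P} {L} i = ∣p-elim (second P ℤ.- (first L ℤ.* first P ℤ.+ second L)) (H⊆ P L i)

      join : ∀ {P Q L M} → I P L → I Q M → ∃ λ N → I P N × I Q N
      join {P} {Q} {L} {M} i j = left-joined H i (diam (inj₁ P) (inj₁ Q) (inj₂ L , i) (inj₂ M , j))

      meet : ∀ {P Q L M} → I P L → I Q M → ∃ λ R → I R L × I R M
      meet {P} {Q} {L} {M} i j = right-joined H i (diam (inj₂ L) (inj₂ M) (inj₁ P , i) (inj₁ Q , j))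

      open ClosedConfiguration pr first second first second I incident coords-ext coords-ext join meet

      -- Covered rows with equal first coordinate coincide, and there are p first coordinates. The
      -- general K serves points through `Pt-unique` and lines through `Ln-unique`.
      fewCovered : ∀ (K : Fin (p * p) → Fin (p * p) → Bool) →
        (∀ {P Q L M} → K P L ≡ true → K Q M ≡ true → + p ∣ first P ℤ.- first Q → P ≡ Q) →
        ∑[ P < p * p ] ⟦ covered K P ⟧ ≤ p
      fewCovered K unique = ≤-trans (≤-reflexive (sum-combine p (λ P → ⟦ covered K P ⟧)))
        (≤-trans (sum≤const 1 λ x → sum-atMostOne (λ y → covered K (combine x y)) λ y y′ c c′ →
            let _ , k  = covered-elim K c
                _ , k′ = covered-elim K c′
            in Finₚ.combine-injectiveʳ x y x y′ (unique k k′ (∣-resp (same x y y′) (∣-self))))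
          (≤-reflexive (ℕₚ.*-identityʳ p)))
        where
        open import Data.Integer.Divisibility.Signed using (∣n⇒∣m*n; ∣-refl)
        ∣-self : + p ∣ + 0 ℤ.* + p
        ∣-self = ∣n⇒∣m*n (+ 0) ∣-refl
        first-combine : ∀ x y → first (combine x y) ≡ + toℕ x
        first-combine x y = cong (λ z → + toℕ (proj₁ z)) (Finₚ.remQuot-combine {p} x y)
        same : ∀ x y y′ → + 0 ℤ.* + p ≡ first (combine x y) ℤ.- first (combine x y′)
        same x y y′ = trans (ℤₚ.*-zeroˡ (+ p)) (sym (trans
          (cong₂ ℤ._-_ (first-combine x y) (first-combine x y′)) (ℤₚ.+-inverseʳ (+ toℕ x))))

      points≤p : ∑[ P < p * p ] ⟦ covered H P ⟧ ≤ p
      points≤p = fewCovered H λ i j → let _ , i′ , j′ = join i j in Pt-unique i′ j′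

      lines≤p : ∑[ L < p * p ] ⟦ covered (transpose H) L ⟧ ≤ p
      lines≤p = fewCovered (transpose H) λ i j → let _ , i′ , j′ = meet i j in Ln-unique i′ j′

      -- All other incidences of H lie in a row or a column with at most two entries, hence number
      -- at most 2p + 2p.
      heavy : Fin (p * p) → Fin (p * p) → Bool
      heavy P L = H P L ∧ (does (3 ≤? rowSum H P) ∧ does (3 ≤? rowSum (transpose H) L))

      heavy-elim : ∀ {P L} → heavy P L ≡ true → I P L × 3 ≤ rowSum H P × 3 ≤ rowSum (transpose H) L
      heavy-elim {P} {L} h =
        let i , h′ = ∧-true {H P L} h
            r , c  = ∧-true {does (3 ≤? rowSum H P)} h′
        in i , from-does (3 ≤? rowSum H P) r , from-does (3 ≤? rowSum (transpose H) L) c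

      heavy-unique : ∀ P L M → heavy P L ≡ true → heavy P M ≡ true → L ≡ M
      heavy-unique P L M h h′ with L Finₚ.≟ M
      ... | yes e = e
      ... | no L≢M =
        let iL , r , cL = heavy-elim h
            iM , _ , cM = heavy-elim h′
            N , iN , N≢L , N≢M   = third (H P) r L M
            Q , iQ , Q≢P , _     = third (transpose H L) cL P P
            Q′ , iQ′ , Q′≢P , Q′≢Q = third (transpose H L) cL P Q
            s , is , s≢P , _     = third (transpose H M) cM P P
        -- The elation acts on M with centre P by way of a third line N through P. The points Q and
        -- Q′ of L are the centres of the two projections, and s on M starts the orbit.
        in ⊥-elim (Elation.impossible iM iN iL (≢-sym N≢M) (≢-sym L≢M) N≢L iQ iQ′ Q≢P Q′≢P (≢-sym Q′≢Q) is s≢P)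

      heavyRow : ∀ P → ∑[ L < p * p ] ⟦ heavy P L ⟧ ≤ ⟦ covered H P ⟧
      heavyRow P with covered H P in e
      ... | true  = sum-atMostOne (heavy P) (heavy-unique P)
      ... | false = ≤-reflexive (sum-zero _ λ L → ⟦⟧≡0 λ h →
          true≢false (trans (sym (covered-intro H (proj₁ (heavy-elim h)))) e))

      plane-bound : count H ≤ 5 * p
      plane-bound = begin
        ∑[ P < p * p ] ∑[ L < p * p ] ⟦ H P L ⟧
          ≤⟨ sum-mono (λ P → sum-mono λ L → pt (H P L) (rowSum H P) (rowSum (transpose H) L)) ⟩
        ∑[ P < p * p ] ∑[ L < p * p ] (lr P L + (lc P L + ⟦ heavy P L ⟧))
          ≡⟨ trans (sum-cong-≗ λ P → trans (∑-distrib (lr P) (λ L → lc P L + ⟦ heavy P L ⟧))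
                (cong (λ k → sum (lr P) + k) (∑-distrib (lc P) (λ L → ⟦ heavy P L ⟧))))
              (trans (∑-distrib (λ P → sum (lr P)) (λ P → sum (lc P) + ∑[ L < p * p ] ⟦ heavy P L ⟧))
                (cong (λ k → ∑[ P < p * p ] sum (lr P) + k) (∑-distrib (λ P → sum (lc P)) (λ P → ∑[ L < p * p ] ⟦ heavy P L ⟧)))) ⟩
        ∑[ P < p * p ] ∑[ L < p * p ] lr P L + (∑[ P < p * p ] ∑[ L < p * p ] lc P L
          + ∑[ P < p * p ] ∑[ L < p * p ] ⟦ heavy P L ⟧)
          ≤⟨ ℕₚ.+-mono-≤ (lightRows H points≤p) (ℕₚ.+-mono-≤
               (≤-trans (≤-reflexive (∑-swap lc)) (lightRows (transpose H) lines≤p))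
               (≤-trans (sum-mono heavyRow) points≤p)) ⟩
        2 * p + (2 * p + p)
          ≡⟨ lem p ⟩
        5 * p ∎
        where
        open ≤-Reasoning
        lr lc : Fin (p * p) → Fin (p * p) → ℕ
        lr P L = ⟦ does (rowSum H P ≤? 2) ⟧ * ⟦ H P L ⟧
        lc P L = ⟦ does (rowSum (transpose H) L ≤? 2) ⟧ * ⟦ H P L ⟧
        lem : ∀ p → 2 * p + (2 * p + p) ≡ 5 * p
        lem = ℕ-Solver.solve-∀
        pt : ∀ h d e → ⟦ h ⟧ ≤ ⟦ does (d ≤? 2) ⟧ * ⟦ h ⟧ + (⟦ does (e ≤? 2) ⟧ * ⟦ h ⟧ + ⟦ h ∧ (does (3 ≤? d) ∧ does (3 ≤? e)) ⟧)
        pt false d e = z≤n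
        pt true 0 e = s≤s z≤n
        pt true 1 e = s≤s z≤n
        pt true 2 e = s≤s z≤n
        pt true (suc (suc (suc d))) 0 = s≤s z≤n
        pt true (suc (suc (suc d))) 1 = s≤s z≤n
        pt true (suc (suc (suc d))) 2 = s≤s z≤n
        pt true (suc (suc (suc d))) (suc (suc (suc e))) = s≤s z≤n

    incidence-small : Small incidence 3 (5 * p)
    incidence-small = plane-bound

-- Pairwise independent arrays and the size of bicliques.

module OrthogonalArrays where

  open FiniteSums
  open Blowups
  open Residues
  open Incidences
  open import Data.Bool.Properties using (not-involutive)
  open import Data.Nat as ℕ using (ℕ; zero; suc; _+_; _*_; _^_; _≤_; _<_; z≤n; s≤s; _≤?_)
  open import Data.Nat.Properties as ℕₚ using (≤-trans; ≤-refl; ≤-reflexive; module ≤-Reasoning)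
  open import Data.Nat.Primality using (Prime; prime⇒nonTrivial; prime⇒nonZero)
  open import Data.Nat.Tactic.RingSolver using (solve-∀)
  open import Data.Integer as ℤ using (ℤ; +_; 1ℤ)
  import Data.Integer.Properties as ℤₚ
  open import Data.Integer.Divisibility.Signed using (_∣_; ∣m∣n⇒∣m-n)
  import Data.Integer.Tactic.RingSolver as ℤ-Solver
  open import Data.Fin as Fin using (Fin; zero; suc; toℕ; combine; remQuot; inject≤)
  import Data.Fin.Properties as Finₚ

  bool-ext : ∀ {a b} → (a ≡ true → b ≡ true) → (b ≡ true → a ≡ true) → a ≡ b
  bool-ext {true}  {b}     f g = sym (f refl)
  bool-ext {false} {true}  f g = g refl
  bool-ext {false} {false} f g = refl

  sum-inject≤ : ∀ {m N} (le : m ≤ N) (f : Fin N → ℕ) → ∑[ x < m ] f (inject≤ x le) ≤ sum f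
  sum-inject≤ {zero}          le       f = ≤-trans (≤-reflexive (sum-zero {zero} (λ x → f (inject≤ x le)) λ ())) z≤n
  sum-inject≤ {suc m} {suc N} (s≤s le) f = begin
    ∑[ x < suc m ] f (inject≤ x (s≤s le))   ≡⟨ sum-suc (λ x → f (inject≤ x (s≤s le))) ⟩
    f zero + ∑[ x < m ] f (suc (inject≤ x le))  ≤⟨ ℕₚ.+-monoʳ-≤ (f zero) (sum-inject≤ le (f ∘ suc)) ⟩
    f zero + sum (f ∘ suc)                ≡⟨ sum-suc f ⟨
    sum f ∎
    where open ≤-Reasoning

  count-not : ∀ {m n} (E : Fin m → Fin n → Bool) → count (λ x y → not (E x y)) + count E ≡ m * n
  count-not {m} {n} E = begin
    count (λ x y → not (E x y)) + count E
      ≡⟨ ∑-distrib (rowSum (λ x y → not (E x y))) (rowSum E) ⟨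
    ∑[ x < m ] (rowSum (λ x y → not (E x y)) x + rowSum E x)
      ≡⟨ sum-cong-≗ (λ x → sym (∑-distrib (λ y → ⟦ not (E x y) ⟧) (λ y → ⟦ E x y ⟧))) ⟩
    ∑[ x < m ] ∑[ y < n ] (⟦ not (E x y) ⟧ + ⟦ E x y ⟧)
      ≡⟨ sum-cong-≗ (λ x → trans (sum-cong-≗ λ y → one (E x y)) (trans (sum-const n 1) (ℕₚ.*-identityʳ n))) ⟩
    ∑[ x < m ] n
      ≡⟨ sum-const m n ⟩
    m * n ∎
    where
    open ≡-Reasoning
    one : ∀ b → ⟦ not b ⟧ + ⟦ b ⟧ ≡ 1
    one true  = refl
    one false = refl

  -- The rows of a pairwise independent 0-1 matrix of density 1/q that vanish on B are few, by the second
  -- moment of the number Z of ones that a row has in B.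
  module SecondMoment {N m q : ℕ} (E : Fin N → Fin m → Bool)
    (single : ∀ v → q * ∑[ u < N ] ⟦ E u v ⟧ ≡ N)
    (pair : ∀ v v′ → ¬ v ≡ v′ → q * q * ∑[ u < N ] (⟦ E u v ⟧ * ⟦ E u v′ ⟧) ≡ N)
    (B : Fin m → Bool) where

    Z : Fin N → ℕ
    Z u = ∑[ v < m ] (⟦ B v ⟧ * ⟦ E u v ⟧)

    vanishing : Fin N → Bool
    vanishing u = does (Z u ℕ.≟ 0)

    A C b : ℕ
    A = ∑[ u < N ] ⟦ vanishing u ⟧
    C = ∑[ u < N ] ⟦ not (vanishing u) ⟧
    b = ∑[ v < m ] ⟦ B v ⟧

    C+A≡N : C + A ≡ N
    C+A≡N = trans (sym (∑-distrib (λ u → ⟦ not (vanishing u) ⟧) (λ u → ⟦ vanishing u ⟧)))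
      (trans (sum-cong-≗ λ u → one (vanishing u)) (trans (sum-const N 1) (ℕₚ.*-identityʳ N)))
      where
      one : ∀ b → ⟦ not b ⟧ + ⟦ b ⟧ ≡ 1
      one true  = refl
      one false = refl

    mean : q * sum Z ≡ N * b
    mean = begin
      q * ∑[ u < N ] ∑[ v < m ] (⟦ B v ⟧ * ⟦ E u v ⟧)
        ≡⟨ cong (q *_) (trans (∑-swap (λ u v → ⟦ B v ⟧ * ⟦ E u v ⟧))
             (sum-cong-≗ λ v → sym (*-distribˡ-sum ⟦ B v ⟧ (λ u → ⟦ E u v ⟧)))) ⟩
      q * ∑[ v < m ] (⟦ B v ⟧ * ∑[ u < N ] ⟦ E u v ⟧)
        ≡⟨ *-distribˡ-sum q (λ v → ⟦ B v ⟧ * ∑[ u < N ] ⟦ E u v ⟧) ⟩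
      ∑[ v < m ] (q * (⟦ B v ⟧ * ∑[ u < N ] ⟦ E u v ⟧))
        ≡⟨ sum-cong-≗ (λ v → trans (lem q ⟦ B v ⟧ _) (cong (_* ⟦ B v ⟧) (single v))) ⟩
      ∑[ v < m ] (N * ⟦ B v ⟧)
        ≡⟨ *-distribˡ-sum N (λ v → ⟦ B v ⟧) ⟨
      N * b ∎
      where
      open ≡-Reasoning
      lem : ∀ q x y → q * (x * y) ≡ q * y * x
      lem = solve-∀

    pair≤ : ∀ v v′ → q * q * ∑[ u < N ] (⟦ E u v ⟧ * ⟦ E u v′ ⟧) ≤ N * q * ⟦ eqᵇ v v′ ⟧ + N
    pair≤ v v′ with v Finₚ.≟ v′
    ... | no v≢v′  = ≤-trans (≤-reflexive (pair v v′ v≢v′)) (ℕₚ.m≤n+m N (N * q * 0))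
    ... | yes refl = ≤-trans (ℕₚ.*-monoʳ-≤ (q * q) (sum-mono λ u → idem (E u v)))
      (≤-trans (≤-reflexive (trans (lem q _) (cong (λ k → k * q * 1) (single v)))) (ℕₚ.m≤m+n (N * q * 1) N))
      where
      idem : ∀ c → ⟦ c ⟧ * ⟦ c ⟧ ≤ ⟦ c ⟧
      idem true  = ≤-refl
      idem false = z≤n
      lem : ∀ q s → q * q * s ≡ q * s * q * 1
      lem = solve-∀

    second : q * q * ∑[ u < N ] (Z u * Z u) ≤ N * b * (q + b)
    second = begin
      q * q * ∑[ u < N ] (Z u * Z u)
        ≡⟨ cong (q * q *_) (trans (sum-cong-≗ λ u → sum-*-sum (λ v → ⟦ B v ⟧ * ⟦ E u v ⟧) (λ v → ⟦ B v ⟧ * ⟦ E u v ⟧))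
             (trans (∑-swap (λ u v → ∑[ v′ < m ] (⟦ B v ⟧ * ⟦ E u v ⟧ * (⟦ B v′ ⟧ * ⟦ E u v′ ⟧))))
               (sum-cong-≗ λ v → ∑-swap (λ u v′ → ⟦ B v ⟧ * ⟦ E u v ⟧ * (⟦ B v′ ⟧ * ⟦ E u v′ ⟧))))) ⟩
      q * q * ∑[ v < m ] ∑[ v′ < m ] ∑[ u < N ] (⟦ B v ⟧ * ⟦ E u v ⟧ * (⟦ B v′ ⟧ * ⟦ E u v′ ⟧))
        ≡⟨ cong (q * q *_) (sum-cong-≗ λ v → sum-cong-≗ λ v′ → trans
             (sum-cong-≗ λ u → lem₁ ⟦ B v ⟧ ⟦ E u v ⟧ ⟦ B v′ ⟧ ⟦ E u v′ ⟧)
             (sym (*-distribˡ-sum (⟦ B v ⟧ * ⟦ B v′ ⟧) (λ u → ⟦ E u v ⟧ * ⟦ E u v′ ⟧)))) ⟩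
      q * q * ∑[ v < m ] ∑[ v′ < m ] (⟦ B v ⟧ * ⟦ B v′ ⟧ * P v v′)
        ≡⟨ trans (*-distribˡ-sum (q * q) (λ v → ∑[ v′ < m ] (⟦ B v ⟧ * ⟦ B v′ ⟧ * P v v′)))
             (sum-cong-≗ λ v → *-distribˡ-sum (q * q) (λ v′ → ⟦ B v ⟧ * ⟦ B v′ ⟧ * P v v′)) ⟩
      ∑[ v < m ] ∑[ v′ < m ] (q * q * (⟦ B v ⟧ * ⟦ B v′ ⟧ * P v v′))
        ≤⟨ sum-mono (λ v → sum-mono λ v′ → pt v v′) ⟩
      ∑[ v < m ] ∑[ v′ < m ] (⟦ B v ⟧ * (N * q) * ⟦ eqᵇ v v′ ⟧ + ⟦ B v ⟧ * N * ⟦ B v′ ⟧)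
        ≡⟨ sum-cong-≗ (λ v → trans (∑-distrib (λ v′ → ⟦ B v ⟧ * (N * q) * ⟦ eqᵇ v v′ ⟧) (λ v′ → ⟦ B v ⟧ * N * ⟦ B v′ ⟧))
             (cong₂ _+_ (trans (sym (*-distribˡ-sum (⟦ B v ⟧ * (N * q)) (λ v′ → ⟦ eqᵇ v v′ ⟧)))
                 (cong (⟦ B v ⟧ * (N * q) *_) (sum-unique v (eqᵇ v) (eqᵇ-refl v) (λ v′ h → sym (eqᵇ⇒≡ h)))))
               (sym (*-distribˡ-sum (⟦ B v ⟧ * N) (λ v′ → ⟦ B v′ ⟧))))) ⟩
      ∑[ v < m ] (⟦ B v ⟧ * (N * q) * 1 + ⟦ B v ⟧ * N * b)
        ≡⟨ sum-cong-≗ (λ v → lem₂ ⟦ B v ⟧ N q b) ⟩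
      ∑[ v < m ] (⟦ B v ⟧ * (N * (q + b)))
        ≡⟨ *-distribʳ-sum (N * (q + b)) (λ v → ⟦ B v ⟧) ⟨
      b * (N * (q + b))
        ≡⟨ lem₃ b N q ⟩
      N * b * (q + b) ∎
      where
      open ≤-Reasoning
      P : Fin m → Fin m → ℕ
      P v v′ = ∑[ u < N ] (⟦ E u v ⟧ * ⟦ E u v′ ⟧)
      lem₁ : ∀ a e a′ e′ → a * e * (a′ * e′) ≡ a * a′ * (e * e′)
      lem₁ = solve-∀
      lem₂ : ∀ a N q b → a * (N * q) * 1 + a * N * b ≡ a * (N * (q + b))
      lem₂ = solve-∀
      lem₃ : ∀ b N q → b * (N * (q + b)) ≡ N * b * (q + b)
      lem₃ = solve-∀
      pt : ∀ v v′ → q * q * (⟦ B v ⟧ * ⟦ B v′ ⟧ * P v v′) ≤ ⟦ B v ⟧ * (N * q) * ⟦ eqᵇ v v′ ⟧ + ⟦ B v ⟧ * N * ⟦ B v′ ⟧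
      pt v v′ with B v | B v′
      ... | false | _ = ≤-reflexive (ℕₚ.*-zeroʳ (q * q))
      ... | true | false = ≤-trans (≤-reflexive (ℕₚ.*-zeroʳ (q * q))) z≤n
      ... | true | true = ≤-trans (≤-reflexive (cong (q * q *_) (ℕₚ.*-identityˡ (P v v′))))
        (≤-trans (pair≤ v v′) (≤-reflexive (lem₄ N q ⟦ eqᵇ v v′ ⟧)))
        where
        lem₄ : ∀ N q e → N * q * e + N ≡ 1 * (N * q) * e + 1 * N * 1
        lem₄ = solve-∀

    Z² : sum Z * sum Z ≤ C * ∑[ u < N ] (Z u * Z u)
    Z² = cauchy-schwarz (not ∘ vanishing) Z λ u → supp u
      where
      supp : ∀ u → not (vanishing u) ≡ false → Z u ≡ 0
      supp u h = from-does (Z u ℕ.≟ 0) (trans (sym (not-involutive (vanishing u))) (cong not h))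

    -- Chebyshev's inequality in Cauchy-Schwarz form. With C = N - A nonvanishing rows, (ΣZ)² ≤
    -- C·ΣZ² becomes Nb ≤ C(q + b), that is Ab ≤ Cq. The cases N = 0 and b = 0 are split off because
    -- Nb is cancelled.
    A*b≤N*q : A * b ≤ N * q
    A*b≤N*q = conclude N b refl refl
      where
      conclude : ∀ N′ b′ → N ≡ N′ → b ≡ b′ → A * b ≤ N * q
      conclude _ zero _ e = ≤-trans (≤-reflexive (trans (cong (A *_) e) (ℕₚ.*-zeroʳ A))) z≤n
      conclude zero (suc _) e _ = ≤-trans (ℕₚ.*-monoˡ-≤ b (≤-trans (ℕₚ.m≤n+m A C) (≤-reflexive (trans C+A≡N e)))) z≤n
      conclude (suc N″) (suc b″) eN eb = ℕₚ.+-cancelʳ-≤ (C * b) _ _ (begin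
        A * b + C * b    ≡⟨ lem₁ A C b ⟩
        (C + A) * b      ≡⟨ cong (_* b) C+A≡N ⟩
        N * b            ≤⟨ ℕₚ.*-cancelˡ-≤ (N * b) {{nz}} squared ⟩
        C * (q + b)      ≡⟨ ℕₚ.*-distribˡ-+ C q b ⟩
        C * q + C * b    ≤⟨ ℕₚ.+-monoˡ-≤ (C * b) (ℕₚ.*-monoˡ-≤ q (≤-trans (ℕₚ.m≤m+n C A) (≤-reflexive C+A≡N))) ⟩
        N * q + C * b    ∎)
        where
        open ≤-Reasoning
        nz : ℕ.NonZero (N * b)
        nz = subst₂ (λ x y → ℕ.NonZero (x * y)) (sym eN) (sym eb) _
        lem₁ : ∀ A C b → A * b + C * b ≡ (C + A) * b
        lem₁ = solve-∀
        lem₂ : ∀ q s → q * s * (q * s) ≡ q * q * (s * s)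
        lem₂ = solve-∀
        lem₃ : ∀ q C t → q * q * (C * t) ≡ C * (q * q * t)
        lem₃ = solve-∀
        lem₄ : ∀ C n k → C * (n * k) ≡ n * (C * k)
        lem₄ = solve-∀
        squared : N * b * (N * b) ≤ N * b * (C * (q + b))
        squared = begin
          N * b * (N * b)                       ≡⟨ cong (λ k → k * k) mean ⟨
          q * sum Z * (q * sum Z)               ≡⟨ lem₂ q (sum Z) ⟩
          q * q * (sum Z * sum Z)               ≤⟨ ℕₚ.*-monoʳ-≤ (q * q) Z² ⟩
          q * q * (C * ∑[ u < N ] (Z u * Z u))  ≡⟨ lem₃ q C _ ⟩
          C * (q * q * ∑[ u < N ] (Z u * Z u))  ≤⟨ ℕₚ.*-monoʳ-≤ C second ⟩
          C * (N * b * (q + b))                 ≡⟨ lem₄ C (N * b) (q + b) ⟩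
          N * b * (C * (q + b))                 ∎

  power-between : ∀ q m → 2 ≤ q → 1 ≤ m → ∃ λ k → m ≤ q ^ k × q ^ k ≤ q * m
  power-between q 1 2≤q _ = 0 , ≤-refl , ≤-trans (ℕₚ.≤-pred (ℕₚ.m≤n⇒m≤1+n 2≤q)) (≤-reflexive (sym (ℕₚ.*-identityʳ q)))
  power-between q (suc (suc m)) 2≤q _ with power-between q (suc m) 2≤q (s≤s z≤n)
  ... | k , lo , hi with suc (suc m) ≤? q ^ k
  ...   | yes lo′ = k , lo′ , ≤-trans hi (ℕₚ.*-monoʳ-≤ q (ℕₚ.n≤1+n (suc m)))
  ...   | no  big = suc k , ≤-trans (grow m) (ℕₚ.*-mono-≤ 2≤q lo) , ℕₚ.*-monoʳ-≤ q (ℕₚ.<⇒≤ (ℕₚ.≰⇒> big))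
    where
    grow : ∀ m → suc (suc m) ≤ 2 * suc m
    grow m = ℕₚ.+-mono-≤ {1} (s≤s z≤n) (≤-reflexive (sym (ℕₚ.+-identityʳ (suc m))))

  module OrthogonalArray {q : ℕ} (pr : Prime q) where

    open ModPrime pr

    private instance
      q≢0 : ℕ.NonZero q
      q≢0 = prime⇒nonZero pr

    -- (a, u) ↦ ⟨a, v⟩ + u, so rows have one more coordinate than columns.
    entry : ∀ k → Fin (q ^ suc k) → Fin (q ^ k) → ℤ
    entry zero    r _ = + toℕ (proj₁ (remQuot {q} 1 r))
    entry (suc k) r w = + toℕ (proj₁ (remQuot {q} (q ^ suc k) r)) ℤ.* + toℕ (proj₁ (remQuot {q} (q ^ k) w))
      ℤ.+ entry k (proj₂ (remQuot {q} (q ^ suc k) r)) (proj₂ (remQuot {q} (q ^ k) w))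

    hit : ∀ k → ℤ → Fin (q ^ suc k) → Fin (q ^ k) → Bool
    hit k s r w = ∣p (entry k r w ℤ.- s)

    module _ (k : ℕ) (w : Fin (q ^ suc k)) where
      hd : ℤ
      hd = + toℕ (proj₁ (remQuot {q} (q ^ k) w))
      tl : Fin (q ^ k)
      tl = proj₂ (remQuot {q} (q ^ k) w)

      -- Fixing the first coordinate a of the row turns its contribution into a shift of the target
      -- value, which is what the inductions on k use.
      hit-combine : ∀ s a u → hit (suc k) s (combine {q} a u) w ≡ hit k (s ℤ.- + toℕ a ℤ.* hd) u tl
      hit-combine s a u = cong ∣p (trans
        (cong (λ z → + toℕ (proj₁ z) ℤ.* hd ℤ.+ entry k (proj₂ z) tl ℤ.- s) (Finₚ.remQuot-combine a u))
        (lem (+ toℕ a) hd (entry k u tl) s))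
        where
        lem : ∀ a b h s → a ℤ.* b ℤ.+ h ℤ.- s ≡ h ℤ.- (s ℤ.- a ℤ.* b)
        lem = ℤ-Solver.solve-∀

    hit-count : ∀ k s w → ∑[ u < q ^ suc k ] ⟦ hit k s u w ⟧ ≡ q ^ k
    hit-count zero s w = trans (sum-combine q (λ r → ⟦ hit 0 s r w ⟧)) (trans
      (sum-cong-≗ λ a → trans (sum-suc (λ j → ⟦ hit 0 s (combine a j) w ⟧)) (trans (cong₂ _+_ (base a) (sum-zero {zero} _ λ ())) (ℕₚ.+-identityʳ _)))
      (linear-count ¬p∣1 s))
      where
      base : ∀ a → ⟦ hit 0 s (combine {q} {1} a zero) w ⟧ ≡ ⟦ ∣p (+ toℕ a ℤ.* 1ℤ ℤ.- s) ⟧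
      base a = cong (λ z → ⟦ ∣p (z ℤ.- s) ⟧) (trans (cong (λ z → + toℕ (proj₁ z)) (Finₚ.remQuot-combine {q} {1} a zero))
        (sym (ℤₚ.*-identityʳ (+ toℕ a))))
    hit-count (suc k) s w = trans (sum-combine q (λ r → ⟦ hit (suc k) s r w ⟧)) (trans
      (sum-cong-≗ λ a → trans (sum-cong-≗ λ u → cong ⟦_⟧ (hit-combine k w s a u)) (hit-count k _ (tl k w)))
      (sum-const q (q ^ k)))

    -- If the tails differ, induction applies for every a. If they agree, the heads differ, and both
    -- values are hit exactly when the first is hit and a solves a linear equation whose coefficient
    -- `d` is nonzero modulo q. The targets s and s′ vary separately because fixing a shifts them by
    -- different amounts.
    pair-count : ∀ k s s′ w w′ → ¬ w ≡ w′ → q * ∑[ u < q ^ suc k ] (⟦ hit k s u w ⟧ * ⟦ hit k s′ u w′ ⟧) ≡ q ^ k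
    pair-count zero s s′ zero zero ne = contradiction refl ne
    pair-count (suc k) s s′ w w′ ne = trans (cong (q *_) expand) (byTail (tl k w Finₚ.≟ tl k w′))
      where
      f : Fin q → Fin (q ^ suc k) → ℕ
      f a u = ⟦ hit k (s ℤ.- + toℕ a ℤ.* hd k w) u (tl k w) ⟧ * ⟦ hit k (s′ ℤ.- + toℕ a ℤ.* hd k w′) u (tl k w′) ⟧
      expand : ∑[ r < q ^ suc (suc k) ] (⟦ hit (suc k) s r w ⟧ * ⟦ hit (suc k) s′ r w′ ⟧) ≡ ∑[ a < q ] ∑[ u < q ^ suc k ] f a u
      expand = trans (sum-combine q (λ r → ⟦ hit (suc k) s r w ⟧ * ⟦ hit (suc k) s′ r w′ ⟧))
        (sum-cong-≗ λ a → sum-cong-≗ λ u → cong₂ _*_ (cong ⟦_⟧ (hit-combine k w s a u)) (cong ⟦_⟧ (hit-combine k w′ s′ a u)))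
      byTail : Dec (tl k w ≡ tl k w′) → q * ∑[ a < q ] ∑[ u < q ^ suc k ] f a u ≡ q * q ^ k
      byTail (no v≢v′) = trans (*-distribˡ-sum q (λ a → sum (f a))) (trans
        (sum-cong-≗ λ a → pair-count k (s ℤ.- + toℕ a ℤ.* hd k w) (s′ ℤ.- + toℕ a ℤ.* hd k w′) (tl k w) (tl k w′) v≢v′)
        (sum-const q (q ^ k)))
      byTail (yes v≡v′) = cong (q *_) (begin
        ∑[ a < q ] ∑[ u < q ^ suc k ] f a u
          ≡⟨ sum-cong-≗ (λ a → sum-cong-≗ λ u → factor a u) ⟩
        ∑[ a < q ] ∑[ u < q ^ suc k ] (⟦ slopeHit a ⟧ * ⟦ hit k (s ℤ.- + toℕ a ℤ.* hd k w) u (tl k w) ⟧)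
          ≡⟨ sum-cong-≗ (λ a → trans (sym (*-distribˡ-sum ⟦ slopeHit a ⟧ (λ u → ⟦ hit k (s ℤ.- + toℕ a ℤ.* hd k w) u (tl k w) ⟧)))
               (cong (⟦ slopeHit a ⟧ *_) (hit-count k (s ℤ.- + toℕ a ℤ.* hd k w) (tl k w)))) ⟩
        ∑[ a < q ] (⟦ slopeHit a ⟧ * q ^ k)
          ≡⟨ *-distribʳ-sum (q ^ k) (λ a → ⟦ slopeHit a ⟧) ⟨
        ∑[ a < q ] ⟦ slopeHit a ⟧ * q ^ k
          ≡⟨ trans (cong (_* q ^ k) (linear-count d≢0 (s ℤ.- s′))) (ℕₚ.*-identityˡ (q ^ k)) ⟩
        q ^ k ∎)
        where
        open ≡-Reasoning
        d : ℤ
        d = hd k w ℤ.- hd k w′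
        slopeHit : Fin q → Bool
        slopeHit a = ∣p (+ toℕ a ℤ.* d ℤ.- (s ℤ.- s′))
        d≢0 : ¬ + q ∣ d
        d≢0 h = ne (trans (sym (Finₚ.combine-remQuot {q} (q ^ k) w)) (trans (cong₂ combine
          (residue-unique (proj₁ (remQuot {q} (q ^ k) w)) (proj₁ (remQuot {q} (q ^ k) w′)) h) v≡v′)
          (Finₚ.combine-remQuot {q} (q ^ k) w′)))
        factor : ∀ a u → f a u ≡ ⟦ slopeHit a ⟧ * ⟦ hit k (s ℤ.- + toℕ a ℤ.* hd k w) u (tl k w) ⟧
        factor a u = trans (sym (⟦∧⟧ (∣p x) (∣p x″))) (trans (cong ⟦_⟧ (trans
            (cong (λ v → ∣p x ∧ hit k (s′ ℤ.- + toℕ a ℤ.* hd k w′) u v) (sym v≡v′))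
            (bool-ext fwd bwd))) (⟦∧⟧ (slopeHit a) (∣p x)))
          where
          e x x′ x″ y : ℤ
          e = entry k u (tl k w)
          x = e ℤ.- (s ℤ.- + toℕ a ℤ.* hd k w)
          x′ = e ℤ.- (s′ ℤ.- + toℕ a ℤ.* hd k w′)
          x″ = entry k u (tl k w′) ℤ.- (s′ ℤ.- + toℕ a ℤ.* hd k w′)
          y = + toℕ a ℤ.* d ℤ.- (s ℤ.- s′)
          lem₁ : ∀ e s s′ a b b′ → (e ℤ.- (s ℤ.- a ℤ.* b)) ℤ.- (e ℤ.- (s′ ℤ.- a ℤ.* b′)) ≡ a ℤ.* (b ℤ.- b′) ℤ.- (s ℤ.- s′)
          lem₁ = ℤ-Solver.solve-∀
          lem₂ : ∀ e s s′ a b b′ → (e ℤ.- (s ℤ.- a ℤ.* b)) ℤ.- (a ℤ.* (b ℤ.- b′) ℤ.- (s ℤ.- s′)) ≡ e ℤ.- (s′ ℤ.- a ℤ.* b′)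
          lem₂ = ℤ-Solver.solve-∀
          fwd : ∣p x ∧ ∣p x′ ≡ true → slopeHit a ∧ ∣p x ≡ true
          fwd h = let h₁ , h₂ = ∧-true {∣p x} h in ∧-intro (∣p-intro y (∣-resp
            (lem₁ e s s′ (+ toℕ a) (hd k w) (hd k w′)) (∣m∣n⇒∣m-n (∣p-elim x h₁) (∣p-elim x′ h₂)))) h₁
          bwd : slopeHit a ∧ ∣p x ≡ true → ∣p x ∧ ∣p x′ ≡ true
          bwd h = let h₁ , h₂ = ∧-true {slopeHit a} h in ∧-intro h₂ (∣p-intro x′ (∣-resp
            (lem₂ e s s′ (+ toℕ a) (hd k w) (hd k w′)) (∣m∣n⇒∣m-n (∣p-elim x h₂) (∣p-elim y h₁))))

    module _ {m k : ℕ} (m≤q^k : m ≤ q ^ k) where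

      m≤q^1+k : m ≤ q ^ suc k
      m≤q^1+k = ≤-trans m≤q^k (ℕₚ.m≤n*m (q ^ k) q)

      zeros : ℤ → Fin m → Fin m → Bool
      zeros s x y = hit k s (inject≤ x m≤q^1+k) (inject≤ y m≤q^k)

      -- A piece of diameter 2 contains every pair of a covered row and a covered column, as a path
      -- between them has odd length. So the covered rows vanish on the covered columns, and the
      -- second moment bound limits the product of their numbers.
      zeros-small : ∀ s → Small (λ x y → not (zeros s x y)) 2 (q ^ suc k * q)
      zeros-small s H H⊆ diam = begin
        count H
          ≤⟨ sum-mono (λ x → sum-mono λ y → rectangle x y) ⟩
        ∑[ x < m ] ∑[ y < m ] (⟦ covered H x ⟧ * ⟦ B y ⟧)
          ≡⟨ sum-*-sum (λ x → ⟦ covered H x ⟧) (λ y → ⟦ B y ⟧) ⟨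
        ∑[ x < m ] ⟦ covered H x ⟧ * b
          ≤⟨ ℕₚ.*-monoˡ-≤ b (≤-trans (sum-mono λ x → ⟦⟧-mono (vanishes x)) (sum-inject≤ m≤q^1+k (λ u → ⟦ vanishing u ⟧))) ⟩
        A * b
          ≤⟨ A*b≤N*q ⟩
        q ^ suc k * q ∎
        where
        open ≤-Reasoning
        open Bipartite H
        B : Fin m → Bool
        B = covered (transpose H)
        E : Fin (q ^ suc k) → Fin m → Bool
        E u y = hit k s u (inject≤ y m≤q^k)
        open SecondMoment {q = q} E (λ y → cong (q *_) (hit-count k s (inject≤ y m≤q^k)))
          (λ y y′ ne → trans (ℕₚ.*-assoc q q _) (cong (q *_) (pair-count k s s (inject≤ y m≤q^k) (inject≤ y′ m≤q^k)
            (λ e → ne (Finₚ.inject≤-injective m≤q^k m≤q^k y y′ e))))) B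
        rectangle : ∀ x y → ⟦ H x y ⟧ ≤ ⟦ covered H x ⟧ * ⟦ B y ⟧
        rectangle x y = ≤-trans (⟦⟧-mono λ h → ∧-intro (covered-intro H h) (covered-intro (transpose H) h))
          (≤-reflexive (⟦∧⟧ (covered H x) (B y)))
        complete : ∀ {x y} → Path 2 (inj₁ x) (inj₂ y) → H x y ≡ true
        complete (step {w = inj₂ _} e here) = e
        complete (step {w = inj₂ _} e (step {w = inj₁ _} e′ ()))
        vanishes : ∀ x → covered H x ≡ true → vanishing (inject≤ x m≤q^1+k) ≡ true
        vanishes x c = does-true (Z (inject≤ x m≤q^1+k) ℕ.≟ 0) (sum-zero _ λ y →
            trans (sym (⟦∧⟧ (B y) (zeros s x y))) (⟦⟧≡0 (none y)))
          where
          none : ∀ y → ¬ B y ∧ zeros s x y ≡ true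
          none y h =
            let by , z = ∧-true {B y} h
                _ , i = covered-elim H c
                _ , j = covered-elim (transpose H) by
                Hxy = complete (diam (inj₁ x) (inj₂ y) (inj₂ _ , i) (inj₁ _ , j))
            in true≢false (trans (sym (H⊆ x y Hxy)) (cong not z))

      -- The level sets partition the m × m corner, so one of them has at most the average size
      -- m²/q. Averaging stands in for an exact count, which truncation to the corner may destroy.
      sparse : ∃ λ (s : Fin q) → q * count (zeros (+ toℕ s)) ≤ m * m
      sparse =
        let s , lt = sum-<⇒∃< (λ s → q * count (zeros (+ toℕ s))) (λ _ → suc (m * m)) total
        in s , ℕₚ.≤-pred lt
        where
        open ≤-Reasoning
        one : ∀ z → ∑[ s < q ] ⟦ ∣p (z ℤ.- + toℕ s) ⟧ ≡ 1
        one z = trans (sum-cong-≗ λ s → cong ⟦_⟧ (bool-ext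
            (λ h → ∣p-intro (+ toℕ s ℤ.* 1ℤ ℤ.- z) (∣-resp (cong (ℤ._- z) (sym (ℤₚ.*-identityʳ (+ toℕ s))))
              (∣-diff-comm z (+ toℕ s) (∣p-elim (z ℤ.- + toℕ s) h))))
            (λ h → ∣p-intro (z ℤ.- + toℕ s) (∣-diff-comm (+ toℕ s) z (∣-resp (cong (ℤ._- z) (ℤₚ.*-identityʳ (+ toℕ s)))
              (∣p-elim (+ toℕ s ℤ.* 1ℤ ℤ.- z) h))))))
          (linear-count ¬p∣1 z)
        total : ∑[ s < q ] (q * count (zeros (+ toℕ s))) < ∑[ s < q ] suc (m * m)
        total = begin-strict
          ∑[ s < q ] (q * count (zeros (+ toℕ s)))
            ≡⟨ *-distribˡ-sum q (λ s → count (zeros (+ toℕ s))) ⟨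
          q * ∑[ s < q ] ∑[ x < m ] ∑[ y < m ] ⟦ zeros (+ toℕ s) x y ⟧
            ≡⟨ cong (q *_) (trans (∑-swap (λ s x → ∑[ y < m ] ⟦ zeros (+ toℕ s) x y ⟧))
                 (sum-cong-≗ λ x → trans (∑-swap (λ s y → ⟦ zeros (+ toℕ s) x y ⟧))
                   (trans (sum-cong-≗ λ y → one (entry k (inject≤ x m≤q^1+k) (inject≤ y m≤q^k)))
                     (trans (sum-const m 1) (ℕₚ.*-identityʳ m))))) ⟩
          q * ∑[ x < m ] m
            ≡⟨ cong (q *_) (sum-const m m) ⟩
          q * (m * m)
            <⟨ ℕₚ.*-monoʳ-< q (ℕₚ.n<1+n (m * m)) ⟩
          q * suc (m * m)
            ≡⟨ sum-const q (suc (m * m)) ⟨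
          ∑[ s < q ] suc (m * m) ∎

    -- Origin of q³: the array has q·q^k rows, rounding m up to a power of q costs at most another
    -- q, and the second moment bound contributes the third.
    bicliqueFree : ∀ m → 1 ≤ m → Σ (Fin m → Fin m → Bool) λ R →
      q * (m * m) ≤ q * count R + m * m × Small R 2 (q * q * q * m)
    bicliqueFree m 1≤m =
      let k , lo , hi = power-between q m (ℕ.nonTrivial⇒n>1 q {{prime⇒nonTrivial pr}}) 1≤m
          s , sp      = sparse {m} {k} lo
      in (λ x y → not (zeros {m} {k} lo (+ toℕ s) x y)) , dense {k} lo s sp , small {k} lo hi s
      where
      open ≤-Reasoning
      dense : ∀ {k} (lo : m ≤ q ^ k) (s : Fin q) → q * count (zeros {m} {k} lo (+ toℕ s)) ≤ m * m →
        q * (m * m) ≤ q * count (λ x y → not (zeros {m} {k} lo (+ toℕ s) x y)) + m * m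
      dense {k} lo s sp = begin
        q * (m * m)        ≡⟨ cong (q *_) (count-not (zeros {m} {k} lo (+ toℕ s))) ⟨
        q * (cR + cZ)      ≡⟨ ℕₚ.*-distribˡ-+ q cR cZ ⟩
        q * cR + q * cZ    ≤⟨ ℕₚ.+-monoʳ-≤ (q * cR) sp ⟩
        q * cR + m * m     ∎
        where
        cR = count (λ x y → not (zeros {m} {k} lo (+ toℕ s) x y))
        cZ = count (zeros {m} {k} lo (+ toℕ s))
      small : ∀ {k} (lo : m ≤ q ^ k) → q ^ k ≤ q * m → (s : Fin q) →
        Small (λ x y → not (zeros {m} {k} lo (+ toℕ s) x y)) 2 (q * q * q * m)
      small {k} lo hi s H H⊆ diam = ≤-trans (zeros-small {m} {k} lo (+ toℕ s) H H⊆ diam) (begin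
        q * q ^ k * q      ≤⟨ ℕₚ.*-monoˡ-≤ q (ℕₚ.*-monoʳ-≤ q hi) ⟩
        q * (q * m) * q    ≡⟨ lem q m ⟩
        q * q * q * m      ∎)
        where
        lem : ∀ q m → q * (q * m) * q ≡ q * q * q * m
        lem = solve-∀

-- Primes up to a constant factor, by a Chebyshev-type estimate.

module PrimesInRange where

  open import Data.Nat
  open import Data.Nat.Properties
  open import Data.Nat.Divisibility
  open import Data.Nat.Primality
  open import Data.Nat.Primality.Factorisation using (factorise; module PrimeFactorisation)
  open import Data.Nat.ListAction using (product)
  open import Data.Nat.Tactic.RingSolver using (solve-∀)
  open import Data.List using ([]; _∷_)
  open import Data.List.Relation.Unary.All using (All; []; _∷_)
  open import Data.Fin using (Fin; toℕ; fromℕ<)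
  import Data.Fin.Properties as Finₚ

  binom : ℕ → ℕ → ℕ
  binom n       zero    = 1
  binom zero    (suc k) = 0
  binom (suc n) (suc k) = binom n k + binom n (suc k)

  binom≤2^ : ∀ n k → binom n k ≤ 2 ^ n
  binom≤2^ n       zero    = m^n>0 2 n
  binom≤2^ zero    (suc k) = z≤n
  binom≤2^ (suc n) (suc k) = +-mono-≤ (binom≤2^ n k) (≤-trans (binom≤2^ n (suc k)) (≤-reflexive (sym (+-identityʳ _))))

  absorption : ∀ n k → suc k * binom (suc n) (suc k) ≡ suc n * binom n k
  absorption zero    zero    = refl
  absorption zero    (suc k) = *-zeroʳ (suc (suc k))
  absorption (suc n) zero    = trans (*-identityˡ _) (cong (1 +_) (trans (sym (*-identityˡ (binom (suc n) 1))) (absorption n zero)))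
  absorption (suc n) (suc k) = begin
    suc (suc k) * (binom (suc n) (suc k) + binom (suc n) (suc (suc k)))
      ≡⟨ *-distribˡ-+ (suc (suc k)) (binom (suc n) (suc k)) _ ⟩
    suc (suc k) * binom (suc n) (suc k) + suc (suc k) * binom (suc n) (suc (suc k))
      ≡⟨ cong₂ (λ x y → binom (suc n) (suc k) + x + y) (absorption n k) (absorption n (suc k)) ⟩
    binom (suc n) (suc k) + suc n * binom n k + suc n * binom n (suc k)
      ≡⟨ lem n (binom n k) (binom n (suc k)) ⟩
    suc (suc n) * (binom n k + binom n (suc k)) ∎
    where
    open ≡-Reasoning
    lem : ∀ n a b → (a + b) + suc n * a + suc n * b ≡ suc (suc n) * (a + b)
    lem = solve-∀

  binom-! : ∀ r k → binom (r + k) k * (k ! * r !) ≡ (r + k) !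
  binom-! r zero    = trans (+-identityʳ (r ! + 0)) (trans (+-identityʳ (r !)) (cong _! (sym (+-identityʳ r))))
  binom-! r (suc k) rewrite +-suc r k = begin
    binom (suc (r + k)) (suc k) * (suc k * k ! * r !)
      ≡⟨ lem₁ (binom (suc (r + k)) (suc k)) (suc k) (k !) (r !) ⟩
    (suc k * binom (suc (r + k)) (suc k)) * (k ! * r !)
      ≡⟨ cong (_* (k ! * r !)) (absorption (r + k) k) ⟩
    suc (r + k) * binom (r + k) k * (k ! * r !)
      ≡⟨ *-assoc (suc (r + k)) (binom (r + k) k) _ ⟩
    suc (r + k) * (binom (r + k) k * (k ! * r !))
      ≡⟨ cong (suc (r + k) *_) (binom-! r k) ⟩
    suc (r + k) * (r + k) ! ∎
    where
    open ≡-Reasoning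
    lem₁ : ∀ b s x y → b * (s * x * y) ≡ (s * b) * (x * y)
    lem₁ = solve-∀

  binom-lower : ∀ n r → suc r * binom (suc (n + r)) n ≡ suc (n + r) * binom (n + r) n
  binom-lower n r = +-cancelˡ-≡ (n * D n) _ _ (begin
    n * D n + suc r * D n
      ≡⟨ lem₁ n r (D n) ⟩
    suc (n + r) * D n
      ≡⟨ go n ⟩
    n * D n + suc (n + r) * binom (n + r) n ∎)
    where
    open ≡-Reasoning
    D : ℕ → ℕ
    D j = binom (suc (n + r)) j
    lem₁ : ∀ n r d → n * d + suc r * d ≡ suc (n + r) * d
    lem₁ = solve-∀
    go : ∀ j → suc (n + r) * D j ≡ j * D j + suc (n + r) * binom (n + r) j
    go zero    = refl
    go (suc j) = trans (*-distribˡ-+ (suc (n + r)) (binom (n + r) j) _)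
      (cong (_+ suc (n + r) * binom (n + r) (suc j)) (sym (absorption (n + r) j)))

  binom-positive : ∀ n r → 1 ≤ binom (n + r) n
  binom-positive zero    r = ≤-refl
  binom-positive (suc n) r = ≤-trans (binom-positive n r) (m≤m+n _ _)

  -- The equation says 1/c = 1/b − 1/a, the recurrence of the Leibniz harmonic triangle.
  leibniz-∣ : ∀ {a b c M} → .{{NonZero b}} → .{{NonZero a}} → c * a ≡ c * b + a * b → a ∣ M → b ∣ M → c ∣ M
  leibniz-∣ {a} {b} {c} {M} eq (divides s Msa) (divides t Mtb) with a ≤? b
  ... | yes a≤b = contradiction (≤-trans (≤-reflexive (sym eq)) (*-monoʳ-≤ c a≤b))
                    (<⇒≱ (m<m+n (c * b) (>-nonZero⁻¹ (a * b) {{m*n≢0 a b}})))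
  ... | no  a≰b with d , refl ← m≤n⇒∃[o]m+o≡n (<⇒≤ (≰⇒> a≰b)) = divides (t ∸ s) (*-cancelˡ-≡ M ((t ∸ s) * c) d {{d≢0}} (begin
      d * M
        ≡⟨ m+n∸m≡n (b * M) (d * M) ⟨
      b * M + d * M ∸ b * M
        ≡⟨ cong (λ z → z ∸ b * M) (sym (*-distribʳ-+ M b d)) ⟩
      (b + d) * M ∸ b * M
        ≡⟨ cong₂ _∸_ (cong ((b + d) *_) Mtb) (cong (b *_) Msa) ⟩
      (b + d) * (t * b) ∸ b * (s * (b + d))
        ≡⟨ cong₂ _∸_ (lem₁ (b + d) t b) (lem₂ b s (b + d)) ⟩
      t * ((b + d) * b) ∸ s * ((b + d) * b)
        ≡⟨ *-distribʳ-∸ ((b + d) * b) t s ⟨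
      (t ∸ s) * ((b + d) * b)
        ≡⟨ cong ((t ∸ s) *_) (+-cancelˡ-≡ (c * b) _ _ (trans (sym eq) (*-distribˡ-+ c b d))) ⟩
      (t ∸ s) * (c * d)
        ≡⟨ lem₃ (t ∸ s) c d ⟩
      d * ((t ∸ s) * c) ∎))
    where
    open ≡-Reasoning
    d≢0 : NonZero d
    d≢0 = ≢-nonZero λ { refl → a≰b (≤-reflexive (+-identityʳ b)) }
    lem₁ : ∀ a t b → a * (t * b) ≡ t * (a * b)
    lem₁ = solve-∀
    lem₂ : ∀ b s a → b * (s * a) ≡ s * (a * b)
    lem₂ = solve-∀
    lem₃ : ∀ u c d → u * (c * d) ≡ d * (u * c)
    lem₃ = solve-∀

  -- The numbers (m+1)·binom n (m+1) are the denominators of the Leibniz harmonic triangle. Its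
  -- first column has denominators 1, 2, 3, ..., and each later one arises by `leibniz-∣` from two
  -- in the preceding column.
  binom-∣-commonMultiple : ∀ N M → (∀ j → 1 ≤ j → j ≤ N → j ∣ M) →
    ∀ m r → suc m + r ≤ N → suc m * binom (suc m + r) (suc m) ∣ M
  binom-∣-commonMultiple N M common zero r le = ∣-trans (∣-reflexive (trans (absorption r 0) (*-identityʳ (suc r)))) (common (suc r) (s≤s z≤n) le)
  binom-∣-commonMultiple N M common (suc m) r le = leibniz-∣
      {a = suc m * D} {b = suc m * B} {c = suc (suc m) * binom (suc (suc m) + r) (suc (suc m))}
      {{m*n≢0 (suc m) B {{_}} {{>-nonZero (binom-positive (suc m) r)}}}}
      {{m*n≢0 (suc m) D {{_}} {{>-nonZero D>0}}}}
      (trans (cong (_* (suc m * D)) (absorption (suc m + r) (suc m))) (trans (lem₁ (suc m) r B D rel) (cong (λ z → z * (suc m * B) + suc m * D * (suc m * B)) (sym (absorption (suc m + r) (suc m))))))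
      (subst (λ k → suc m * binom k (suc m) ∣ M) (+-suc (suc m) r) (binom-∣-commonMultiple N M common m (suc r) (≤-trans (≤-reflexive (+-suc (suc m) r)) le)))
      (binom-∣-commonMultiple N M common m r (≤-trans (n≤1+n _) le))
    where
    B D : ℕ
    B = binom (suc m + r) (suc m)
    D = binom (suc (suc m + r)) (suc m)
    rel : suc r * D ≡ suc (suc m + r) * B
    rel = binom-lower (suc m) r
    D>0 : 1 ≤ D
    D>0 = subst (λ k → 1 ≤ binom k (suc m)) (+-suc (suc m) r) (binom-positive (suc m) (suc r))
    lem₁ : ∀ n r B D → suc r * D ≡ suc (n + r) * B → (suc (n + r) * B) * (n * D) ≡ (suc (n + r) * B) * (n * B) + (n * D) * (n * B)
    lem₁ n r B D e = trans (lem₂ n r B D) (trans (cong (λ z → n * B * z + n * D * (n * B)) e) (lem₃ n r B D))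
      where
      lem₂ : ∀ n r B D → (suc (n + r) * B) * (n * D) ≡ n * B * (suc r * D) + n * D * (n * B)
      lem₂ = solve-∀
      lem₃ : ∀ n r B D → n * B * (suc (n + r) * B) + n * D * (n * B) ≡ (suc (n + r) * B) * (n * B) + (n * D) * (n * B)
      lem₃ = solve-∀

  2^≤central : ∀ n → 2 ^ n ≤ binom (n + n) n
  2^≤central zero    = ≤-refl
  2^≤central (suc n) rewrite +-suc n n = ≤-trans (+-monoʳ-≤ (2 ^ n) (≤-reflexive (+-identityʳ (2 ^ n))))
    (+-mono-≤ (≤-trans (2^≤central n) (mono n)) (≤-trans (2^≤central n) (m≤m+n _ _)))
    where
    mono : ∀ n → binom (n + n) n ≤ binom (suc (n + n)) n
    mono zero    = ≤-refl
    mono (suc n) = m≤n+m (binom (suc n + suc n) (suc n)) (binom (suc n + suc n) n)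

  -- Nair's argument: the central binomial coefficient of 2N is at least 2^N, and N times it divides
  -- every common multiple of 1, ..., 2N.
  2^≤commonMultiple : ∀ N M → .{{NonZero M}} → 1 ≤ N → (∀ j → 1 ≤ j → j ≤ N + N → j ∣ M) → 2 ^ N ≤ M
  2^≤commonMultiple (suc N) M _ common = ≤-trans (≤-trans (2^≤central (suc N)) (m≤n*m _ (suc N)))
    (∣⇒≤ (binom-∣-commonMultiple (suc N + suc N) M common N (suc N) ≤-refl))

  prod : (ℕ → ℕ) → ℕ → ℕ → ℕ
  prod f a zero    = 1
  prod f a (suc k) = f (a + suc k) * prod f a k

  prod-split : ∀ f n k → prod f 0 (n + k) ≡ prod f n k * prod f 0 n
  prod-split f n zero    = trans (cong (prod f 0) (+-identityʳ n)) (sym (+-identityʳ _))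
  prod-split f n (suc k) rewrite +-suc n k =
    trans (cong (f (suc (n + k)) *_) (prod-split f n k)) (sym (*-assoc (f (suc (n + k))) _ _))

  ∣-prod : ∀ f a k i → 1 ≤ i → i ≤ k → f (a + i) ∣ prod f a k
  ∣-prod f a zero    (suc i) _ ()
  ∣-prod f a (suc k) i 1≤i i≤ with m≤n⇒m<n∨m≡n i≤
  ... | inj₁ i<   = ∣n⇒∣m*n (f (a + suc k)) (∣-prod f a k i 1≤i (≤-pred i<))
  ... | inj₂ refl = m∣m*n (prod f a k)

  prod-≤ : ∀ f a k c → (∀ i → f i ≤ c) → prod f a k ≤ c ^ k
  prod-≤ f a zero    c h = ≤-refl
  prod-≤ f a (suc k) c h = *-mono-≤ (h (a + suc k)) (prod-≤ f a k c h)

  prod-positive : ∀ f a k → (∀ i → 1 ≤ f i) → 1 ≤ prod f a k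
  prod-positive f a zero    h = ≤-refl
  prod-positive f a (suc k) h = *-mono-≤ (h (a + suc k)) (prod-positive f a k h)

  primeOr1′ : ∀ i → Dec (Prime i) → ℕ
  primeOr1′ i (yes _) = i
  primeOr1′ i (no _)  = 1

  primeOr1 : ℕ → ℕ
  primeOr1 i = primeOr1′ i (prime? i)

  primeOr1-≡ : ∀ {p} → Prime p → primeOr1 p ≡ p
  primeOr1-≡ {p} pr = go (prime? p)
    where
    go : ∀ d → primeOr1′ p d ≡ p
    go (yes _)  = refl
    go (no ¬pr) = contradiction pr ¬pr

  prime>1 : ∀ {p} → Prime p → 2 ≤ p
  prime>1 {p} pr = nonTrivial⇒n>1 p {{prime⇒nonTrivial pr}}

  primeOr1-positive : ∀ i → 1 ≤ primeOr1 i
  primeOr1-positive i = go (prime? i)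
    where
    go : ∀ d → 1 ≤ primeOr1′ i d
    go (yes pr) = ≤-trans (s≤s z≤n) (prime>1 pr)
    go (no _)   = ≤-refl

  prime∤primeOr1 : ∀ {p i} → Prime p → i < p → ¬ p ∣ primeOr1 i
  prime∤primeOr1 {p} {i} pr i<p = go (prime? i)
    where
    go : ∀ d → ¬ p ∣ primeOr1′ i d
    go (yes qr) h = >⇒∤ {{prime⇒nonZero qr}} i<p h
    go (no _)   h = contradiction (∣1⇒≡1 h) (λ { refl → contradiction (prime>1 pr) λ { (s≤s ()) } })

  prime∤prod : ∀ {p} → Prime p → ∀ a k → a + k < p → ¬ p ∣ prod primeOr1 a k
  prime∤prod pr a zero    lt h = contradiction (∣1⇒≡1 h) (λ { refl → contradiction (prime>1 pr) λ { (s≤s ()) } })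
  prime∤prod pr a (suc k) lt h = [ prime∤primeOr1 pr lt , prime∤prod pr a k (<-trans (+-monoʳ-< a (n<1+n k)) lt) ]′
    (euclidsLemma (primeOr1 (a + suc k)) (prod primeOr1 a k) pr h)

  prime∤! : ∀ {p} → Prime p → ∀ n → n < p → ¬ p ∣ n !
  prime∤! pr zero    lt h = contradiction (∣1⇒≡1 h) (λ { refl → contradiction (prime>1 pr) λ { (s≤s ()) } })
  prime∤! pr (suc n) lt h = [ >⇒∤ lt , prime∤! pr n (<-trans (n<1+n n) lt) ]′ (euclidsLemma (suc n) (n !) pr h)

  n∣n! : ∀ n → 1 ≤ n → n ∣ n !
  n∣n! (suc n) _ = m∣m*n (n !)

  prime∣central : ∀ {p} n → Prime p → n < p → p ≤ n + n → p ∣ binom (n + n) n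
  prime∣central {p} n pr n<p p≤2n =
    [ (λ h → h) , (λ h → ⊥-elim ([ prime∤! pr n n<p , prime∤! pr n n<p ]′ (euclidsLemma (n !) (n !) pr h))) ]′
    (euclidsLemma (binom (n + n) n) (n ! * n !) pr (subst (p ∣_) (sym (binom-! n n))
      (∣-trans (n∣n! p (≤-trans (s≤s z≤n) (prime>1 pr))) (m≤n⇒m!∣n! p≤2n))))

  -- Induction on k works because a new prime exceeds all earlier factors, so it must divide the
  -- quotient of X by their product.
  prod-primes-∣ : ∀ n X → (∀ {p} → Prime p → n < p → p ≤ n + n → p ∣ X) → ∀ k → k ≤ n → prod primeOr1 n k ∣ X
  prod-primes-∣ n X h zero    _ = 1∣ X
  prod-primes-∣ n X h (suc k) k<n = go (prime? (n + suc k)) (prod-primes-∣ n X h k (<⇒≤ k<n))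
    where
    go : ∀ d → prod primeOr1 n k ∣ X → primeOr1′ (n + suc k) d * prod primeOr1 n k ∣ X
    go (no _)   ih = subst (_∣ X) (sym (*-identityˡ _)) ih
    go (yes pr) (divides Y refl) =
      [ (λ p∣Y → *-pres-∣ p∣Y ∣-refl)
      , (λ h′ → contradiction h′ (prime∤prod pr n k (+-monoʳ-< n (n<1+n k)))) ]′
      (euclidsLemma Y (prod primeOr1 n k) pr (h pr (m<m+n n (s≤s z≤n)) (+-monoʳ-≤ n k<n)))

  -- Erdős's doubling argument: the primes in (n, 2n] divide a central binomial coefficient, which
  -- is at most 4^n. Passing from each power of two to the next, these exponents add up
  -- geometrically.
  primorial≤ : ∀ i → prod primeOr1 0 (2 ^ i) ≤ 2 ^ (2 ^ suc i)
  primorial≤ zero    = s≤s z≤n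
  primorial≤ (suc i) = begin
    prod primeOr1 0 (2 ^ suc i)
      ≡⟨ cong (λ k → prod primeOr1 0 (n + k)) (+-identityʳ n) ⟩
    prod primeOr1 0 (n + n)
      ≡⟨ prod-split primeOr1 n n ⟩
    prod primeOr1 n n * prod primeOr1 0 n
      ≤⟨ *-mono-≤ (≤-trans (∣⇒≤ {{>-nonZero (binom-positive n n)}}
           (prod-primes-∣ n (binom (n + n) n) (prime∣central n) n ≤-refl)) (binom≤2^ (n + n) n)) (primorial≤ i) ⟩
    2 ^ (n + n) * 2 ^ (2 ^ suc i)
      ≡⟨ cong (λ k → 2 ^ (n + k) * 2 ^ (2 ^ suc i)) (+-identityʳ n) ⟨
    2 ^ (2 ^ suc i) * 2 ^ (2 ^ suc i)
      ≡⟨ ^-distribˡ-+-* 2 (2 ^ suc i) (2 ^ suc i) ⟨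
    2 ^ (2 ^ suc i + 2 ^ suc i)
      ≡⟨ cong (λ k → 2 ^ (2 ^ suc i + k)) (+-identityʳ (2 ^ suc i)) ⟨
    2 ^ (2 ^ suc (suc i)) ∎
    where
    open ≤-Reasoning
    n = 2 ^ i

  prime-power-cancel : ∀ {r p} → Prime r → Prime p → ¬ r ≡ p → ∀ e Q → r ^ e ∣ p * Q → r ^ e ∣ Q
  prime-power-cancel pr pp ne zero    Q h = 1∣ Q
  prime-power-cancel {r} {p} pr pp ne (suc e) Q h =
    [ (λ r∣p → [ (λ { refl → contradiction (prime>1 pr) λ { (s≤s ()) } }) , (λ e → contradiction e ne) ]′ (prime⇒irreducible pp r∣p))
    , (λ { (divides Q′ refl) → subst (r ^ suc e ∣_) (*-comm r Q′) (*-monoʳ-∣ r (prime-power-cancel pr pp ne e Q′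
        (*-cancelˡ-∣ r {{prime⇒nonZero pr}} (subst (r ^ suc e ∣_) (lem p Q′ r) h)))) }) ]′
    (euclidsLemma p Q pr (∣-trans (m∣m*n (r ^ e)) h))
    where
    lem : ∀ p q r → p * (q * r) ≡ r * (p * q)
    lem = solve-∀

  -- Divisibility is tested on prime powers. Splitting a prime off the list lowers its own exponent
  -- by one on both sides, and the other prime powers are unaffected.
  prime-powers-∣ : ∀ as → All Prime as → ∀ Q → (∀ r e → Prime r → r ^ e ∣ product as → r ^ e ∣ Q) → product as ∣ Q
  prime-powers-∣ []       []         Q h = 1∣ Q
  prime-powers-∣ (p ∷ as) (pp ∷ aps) Q h = go (h p 1 pp (subst (_∣ p * product as) (sym (*-identityʳ p)) (m∣m*n (product as))))
    where
    go : p ^ 1 ∣ Q → p * product as ∣ Q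
    go (divides Q′ eq) = subst (p * product as ∣_) (sym Q≡) (*-monoʳ-∣ p (prime-powers-∣ as aps Q′ rest))
      where
      Q≡ : Q ≡ p * Q′
      Q≡ = trans eq (trans (cong (Q′ *_) (*-identityʳ p)) (*-comm Q′ p))
      rest : ∀ r e → Prime r → r ^ e ∣ product as → r ^ e ∣ Q′
      rest r e pr d with r ≟ p
      ... | yes refl = *-cancelˡ-∣ p {{prime⇒nonZero pp}} (subst (p ^ suc e ∣_) Q≡ (h p (suc e) pp (*-monoʳ-∣ p d)))
      ... | no  ne   = prime-power-cancel pr pp ne e Q′ (subst (r ^ e ∣_) Q≡ (h r e pr (∣n⇒∣m*n p d)))

  log-floor : ∀ q x → 2 ≤ q → 1 ≤ x → ∃ λ k → q ^ k ≤ x × x < q ^ suc k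
  log-floor q 1 2≤q _ = 0 , ≤-refl , ≤-trans 2≤q (≤-reflexive (sym (*-identityʳ q)))
  log-floor q (suc (suc x)) 2≤q _ with log-floor q (suc x) 2≤q (s≤s z≤n)
  ... | k , lo , hi with suc (suc x) <? q ^ suc k
  ...   | yes hi′ = k , ≤-trans lo (n≤1+n _) , hi′
  ...   | no  big = suc k , ≮⇒≥ big , ≤-trans (s≤s hi) (≤-trans (s≤s (m≤m+n (q ^ suc k) 0))
          (≤-trans (+-monoˡ-≤ (q ^ suc k + 0) (m^n>0 q {{>-nonZero (≤-trans (s≤s z≤n) 2≤q)}} (suc k))) (*-monoˡ-≤ (q ^ suc k) 2≤q)))

  module NoPrimes (T s : ℕ) (1≤T : 1 ≤ T) (s²≡T : s * s ≡ T) where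

    powerOr1′ : ∀ i → Dec (Prime i) → ℕ
    powerOr1′ i (yes pr) = i ^ proj₁ (log-floor i T (prime>1 pr) 1≤T)
    powerOr1′ i (no _)   = 1

    powerOr1 : ℕ → ℕ
    powerOr1 i = powerOr1′ i (prime? i)

    powerOr1≤T : ∀ i → powerOr1 i ≤ T
    powerOr1≤T i = go (prime? i)
      where
      go : ∀ d → powerOr1′ i d ≤ T
      go (yes pr) = proj₁ (proj₂ (log-floor i T (prime>1 pr) 1≤T))
      go (no _)   = 1≤T

    powerOr1-positive : ∀ i → 1 ≤ powerOr1 i
    powerOr1-positive i = go (prime? i)
      where
      go : ∀ d → 1 ≤ powerOr1′ i d
      go (yes pr) = m^n>0 i {{prime⇒nonZero pr}} (proj₁ (log-floor i T (prime>1 pr) 1≤T))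
      go (no _)   = ≤-refl

    power∣powerOr1 : ∀ {p} e → Prime p → p ^ e ≤ T → p ^ e ∣ powerOr1 p
    power∣powerOr1 {p} e pr le = go (prime? p)
      where
      go : ∀ d → p ^ e ∣ powerOr1′ p d
      go (no ¬pr) = contradiction pr ¬pr
      go (yes pr′) =
        let E , _ , T< = log-floor p T (prime>1 pr′) 1≤T
        in pow∣ E (≮⇒≥ λ E<e → <⇒≱ T< (≤-trans (^-monoʳ-≤ p {{prime⇒nonZero pr}} E<e) le))
        where
        pow∣ : ∀ E → e ≤ E → p ^ e ∣ p ^ E
        pow∣ E e≤E with d , refl ← m≤n⇒∃[o]m+o≡n e≤E = subst (p ^ e ∣_) (sym (^-distribˡ-+-* p e d)) (m∣m*n (p ^ d))

    module _ (y : ℕ) (none : ∀ p → Prime p → y < p → p ≤ T → ⊥) where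

      -- Without primes in (y, T] this is a common multiple of 1, …, T.
      M : ℕ
      M = prod powerOr1 0 s * prod primeOr1 0 y

      M≢0 : NonZero M
      M≢0 = >-nonZero (*-mono-≤ (prod-positive powerOr1 0 s powerOr1-positive) (prod-positive primeOr1 0 y primeOr1-positive))

      power∣M : ∀ p e → Prime p → p ^ e ≤ T → p ^ e ∣ M
      power∣M p zero    pr le = 1∣ M
      power∣M p (suc e) pr le with p ≤? s
      ... | yes p≤s = ∣m⇒∣m*n (prod primeOr1 0 y) (∣-trans (power∣powerOr1 (suc e) pr le)
          (∣-prod powerOr1 0 s p (≤-trans (s≤s z≤n) (prime>1 pr)) p≤s))
      -- Since p > s and s² = T, the exponent can only be one; and p ≤ y because there are no primes
      -- in (y, T].
      ... | no p≰s = ∣n⇒∣m*n (prod powerOr1 0 s) (single e le)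
        where
        single : ∀ e → p ^ suc e ≤ T → p ^ suc e ∣ prod primeOr1 0 y
        single zero le′ = subst (_∣ prod primeOr1 0 y) (trans (primeOr1-≡ pr) (sym (*-identityʳ p)))
          (∣-prod primeOr1 0 y p (≤-trans (s≤s z≤n) (prime>1 pr))
            (≮⇒≥ λ y<p → none p pr y<p (≤-trans (≤-reflexive (sym (*-identityʳ p))) le′)))
        single (suc e) le′ = contradiction (≤-trans p²≤ le′) (<⇒≱ (≤-trans (≤-reflexive (cong suc (sym s²≡T))) (*-mono-< (≰⇒> p≰s) (≰⇒> p≰s))))
          where
          p²≤ : p * p ≤ p ^ suc (suc e)
          p²≤ = *-monoʳ-≤ p (m≤m*n p (p ^ e) {{m^n≢0 p e {{prime⇒nonZero pr}}}})

      common : ∀ j → 1 ≤ j → j ≤ T → j ∣ M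
      common j@(suc _) _ j≤T = subst (_∣ M) (sym isFactorisation) (prime-powers-∣ factors factorsPrime M λ r e pr d →
          power∣M r e pr (≤-trans (∣⇒≤ (subst (r ^ e ∣_) (sym isFactorisation) d)) j≤T))
        where open PrimeFactorisation (factorise j)

      M≤ : M ≤ T ^ s * prod primeOr1 0 y
      M≤ = *-monoˡ-≤ (prod primeOr1 0 y) (prod-≤ powerOr1 0 s T powerOr1≤T)

  -- With k = 4 + i this is 4(k+2) < 2^(k+1). It fails at k = 3, which is why the range of k starts
  -- at 4.
  linear<2^ : ∀ i → 4 * (suc (4 + suc i)) < 2 ^ (4 + suc i)
  linear<2^ zero    = from-yes′
    where
    from-yes′ : 24 < 32
    from-yes′ = m≤m+n 25 7
  linear<2^ (suc i) = ≤-trans (s≤s (≤-trans (≤-reflexive (lem i)) (+-monoʳ-≤ (4 * (suc (4 + suc i))) (m≤m+n 4 (16 + 4 * suc i)))))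
    (≤-trans (≤-reflexive (lem₂ (4 * (suc (4 + suc i))) i)) (+-mono-≤ (linear<2^ i) (≤-trans (<⇒≤ (linear<2^ i)) (≤-reflexive (sym (+-identityʳ _))))))
    where
    lem : ∀ i → 4 * suc (4 + suc (suc i)) ≡ 4 * (suc (4 + suc i)) + 4
    lem = solve-∀
    lem₂ : ∀ x i → suc (x + (4 + (16 + 4 * suc i))) ≡ suc x + 4 * suc (4 + suc i)
    lem₂ = solve-∀

  -- Put T = 4^(k+2) and y = T/8. Without primes in (y, T] the bounds on `M` would give 2^(T/2) ≤
  -- T^s · 4^y with s = √T. Here 4^y accounts for half of the exponent T/2, and T^s for less than
  -- the other half.
  prime-in-range : ∀ i → let k = 4 + i in
    ∃ λ p → Prime p × 2 ^ suc (k + k) < p × p ≤ 2 ^ (suc (suc k) + suc (suc k))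
  prime-in-range i = go (Finₚ.any? λ (j : Fin (suc T)) → (y <? toℕ j) ×-dec prime? (toℕ j))
    where
    k = 4 + i
    y = 2 ^ suc (k + k)
    T = 2 ^ (suc (suc k) + suc (suc k))
    s = 2 ^ suc (suc k)
    N = 2 ^ (suc k + suc (suc k))
    1≤T : 1 ≤ T
    1≤T = m^n>0 2 (suc (suc k) + suc (suc k))
    s²≡T : s * s ≡ T
    s²≡T = sym (^-distribˡ-+-* 2 (suc (suc k)) (suc (suc k)))
    N+N≡T : N + N ≡ T
    N+N≡T = cong (N +_) (sym (+-identityʳ N))
    e a b : ℕ
    e = suc (suc k)
    a = (e + e) * s
    b = 2 ^ suc (suc (k + k))
    a<b : a < b
    a<b = begin-strict
      (e + e) * s          ≡⟨ lem₁ e (2 ^ suc k) ⟩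
      4 * e * 2 ^ suc k    <⟨ *-monoˡ-< (2 ^ suc k) {{m^n≢0 2 (suc k)}} (subst (λ j → 4 * suc j < 2 ^ j) (+-suc 4 i) (linear<2^ i)) ⟩
      2 ^ suc k * 2 ^ suc k  ≡⟨ ^-distribˡ-+-* 2 (suc k) (suc k) ⟨
      2 ^ (suc k + suc k)  ≡⟨ cong (λ z → 2 ^ suc z) (+-suc k k) ⟩
      b ∎
      where
      open ≤-Reasoning
      lem₁ : ∀ e t → (e + e) * (2 * t) ≡ 4 * e * t
      lem₁ = solve-∀
    2b≡N : b + b ≡ N
    2b≡N = trans (cong (b +_) (sym (+-identityʳ b))) (cong (λ z → 2 ^ suc z) (trans (cong suc (sym (+-suc k k))) (sym (+-suc k (suc k)))))
    go : Dec (∃ λ (j : Fin (suc T)) → y < toℕ j × Prime (toℕ j)) → ∃ λ p → Prime p × y < p × p ≤ T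
    go (yes (j , y<j , pr)) = toℕ j , pr , y<j , ≤-pred (Finₚ.toℕ<n j)
    go (no ¬any) = contradiction bound (<⇒≱ (^-monoʳ-< 2 (s≤s (s≤s z≤n)) (subst (a + b <_) 2b≡N (+-monoˡ-< b a<b))))
      where
      none : ∀ p → Prime p → y < p → p ≤ T → ⊥
      none p pr y<p p≤T = ¬any (fromℕ< (s≤s p≤T) , subst (y <_) (sym (Finₚ.toℕ-fromℕ< (s≤s p≤T))) y<p ,
        subst Prime (sym (Finₚ.toℕ-fromℕ< (s≤s p≤T))) pr)
      open NoPrimes T s 1≤T s²≡T
      open ≤-Reasoning
      bound : 2 ^ N ≤ 2 ^ (a + b)
      bound = begin
        2 ^ N
          ≤⟨ 2^≤commonMultiple N (M y none) {{M≢0 y none}} (m^n>0 2 (suc k + suc (suc k)))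
               (λ j 1≤j j≤ → common y none j 1≤j (≤-trans j≤ (≤-reflexive N+N≡T))) ⟩
        M y none
          ≤⟨ M≤ y none ⟩
        T ^ s * prod primeOr1 0 y
          ≤⟨ *-monoʳ-≤ (T ^ s) (primorial≤ (suc (k + k))) ⟩
        T ^ s * 2 ^ b
          ≡⟨ cong (_* 2 ^ b) (^-*-assoc 2 (e + e) s) ⟩
        2 ^ a * 2 ^ b
          ≡⟨ ^-distribˡ-+-* 2 a b ⟨
        2 ^ (a + b) ∎

  prime-below : ∀ x → 4096 ≤ x → ∃ λ p → Prime p × p ≤ x × x ≤ 32 * p
  prime-below x 4096≤x = go (log-floor 4 x (s≤s (s≤s z≤n)) (≤-trans (s≤s z≤n) 4096≤x))
    where
    go : (∃ λ k → 4 ^ k ≤ x × x < 4 ^ suc k) → ∃ λ p → Prime p × p ≤ x × x ≤ 32 * p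
    -- As 4096 = 4^6, the largest power of 4 up to x has exponent at least 6. It serves as T, and x
    -- < 4T = 32y while the prime exceeds y.
    go (k , lo , hi) with i , refl ← m≤n⇒∃[o]m+o≡n {6} {k} (≮⇒≥ λ k<6 → <⇒≱ hi (≤-trans (^-monoʳ-≤ 4 k<6) 4096≤x)) =
      let p , pr , lo′ , hi′ = prime-in-range i
      in p , pr , ≤-trans hi′ (≤-trans (≤-reflexive (sq (6 + i))) lo) , ≤-trans (<⇒≤ hi) (≤-trans (≤-reflexive (x32 i)) (*-monoʳ-≤ 32 (<⇒≤ lo′)))
      where
      sq : ∀ e → 2 ^ (e + e) ≡ 4 ^ e
      sq e = trans (cong (λ z → 2 ^ (e + z)) (sym (+-identityʳ e))) (sym (^-*-assoc 2 2 e))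
      x32 : ∀ i → 4 ^ suc (6 + i) ≡ 32 * 2 ^ suc (4 + i + (4 + i))
      x32 i = trans (sym (sq (7 + i))) (trans (cong (2 ^_) (lem i)) (^-distribˡ-+-* 2 5 (suc (4 + i + (4 + i)))))
        where
        lem : ∀ i → 7 + i + (7 + i) ≡ 5 + suc (4 + i + (4 + i))
        lem = solve-∀

-- Rational inequalities as cross-multiplied inequalities in ℕ.

module Fractions where

  open import Data.Nat as ℕ using (ℕ; zero; suc; z≤n; s≤s)
  import Data.Nat.Properties as ℕₚ
  open import Data.Integer as ℤ using (ℤ; +_; -[1+_])
  import Data.Integer.Properties as ℤₚ
  open import Data.Rational
  open import Data.Rational.Properties
  import Data.Rational.Unnormalised as ℚᵘ
  import Data.Rational.Unnormalised.Properties as ℚᵘₚ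
  open import Data.Rational.Solver using (module +-*-Solver)

  toℚᵘ-ℕ : ∀ n → toℚᵘ (ℕtoℚ n) ℚᵘ.≃ ℚᵘ.mkℚᵘ (+ n) 0
  toℚᵘ-ℕ n = toℚᵘ-fromℚᵘ (ℚᵘ.mkℚᵘ (+ n) 0)

  ℕtoℚ-* : ∀ m n → ℕtoℚ (m ℕ.* n) ≡ ℕtoℚ m * ℕtoℚ n
  ℕtoℚ-* m n = toℚᵘ-injective (begin
    toℚᵘ (ℕtoℚ (m ℕ.* n))                     ≈⟨ toℚᵘ-ℕ (m ℕ.* n) ⟩
    ℚᵘ.mkℚᵘ (+ (m ℕ.* n)) 0                   ≈⟨ ℚᵘ.*≡* (cong (ℤ._* + 1) (ℤₚ.pos-* m n)) ⟩
    ℚᵘ.mkℚᵘ (+ m) 0 ℚᵘ.* ℚᵘ.mkℚᵘ (+ n) 0      ≈⟨ ℚᵘₚ.*-cong (toℚᵘ-ℕ m) (toℚᵘ-ℕ n) ⟨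
    toℚᵘ (ℕtoℚ m) ℚᵘ.* toℚᵘ (ℕtoℚ n)          ≈⟨ toℚᵘ-homo-* (ℕtoℚ m) (ℕtoℚ n) ⟨
    toℚᵘ (ℕtoℚ m * ℕtoℚ n)                    ∎)
    where open ℚᵘₚ.≃-Reasoning

  ℕtoℚ-+ : ∀ m n → ℕtoℚ (m ℕ.+ n) ≡ ℕtoℚ m + ℕtoℚ n
  ℕtoℚ-+ m n = toℚᵘ-injective (begin
    toℚᵘ (ℕtoℚ (m ℕ.+ n))                     ≈⟨ toℚᵘ-ℕ (m ℕ.+ n) ⟩
    ℚᵘ.mkℚᵘ (+ (m ℕ.+ n)) 0                   ≈⟨ ℚᵘ.*≡* (cong (ℤ._* + 1) (cong₂ ℤ._+_ (sym (ℤₚ.*-identityʳ (+ m))) (sym (ℤₚ.*-identityʳ (+ n))))) ⟩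
    ℚᵘ.mkℚᵘ (+ m) 0 ℚᵘ.+ ℚᵘ.mkℚᵘ (+ n) 0      ≈⟨ ℚᵘₚ.+-cong (toℚᵘ-ℕ m) (toℚᵘ-ℕ n) ⟨
    toℚᵘ (ℕtoℚ m) ℚᵘ.+ toℚᵘ (ℕtoℚ n)          ≈⟨ toℚᵘ-homo-+ (ℕtoℚ m) (ℕtoℚ n) ⟨
    toℚᵘ (ℕtoℚ m + ℕtoℚ n)                    ∎)
    where open ℚᵘₚ.≃-Reasoning

  ℕtoℚ-mono : ∀ {m n} → m ℕ.≤ n → ℕtoℚ m ≤ ℕtoℚ n
  ℕtoℚ-mono {m} {n} h = toℚᵘ-cancel-≤ (ℚᵘₚ.≤-respˡ-≃ (ℚᵘₚ.≃-sym (toℚᵘ-ℕ m)) (ℚᵘₚ.≤-respʳ-≃ (ℚᵘₚ.≃-sym (toℚᵘ-ℕ n))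
    (ℚᵘ.*≤* (ℤₚ.*-monoʳ-≤-nonNeg (+ 1) (ℤ.+≤+ h)))))

  ℕtoℚ-cancel : ∀ {m n} → ℕtoℚ m ≤ ℕtoℚ n → m ℕ.≤ n
  ℕtoℚ-cancel {m} {n} h with ℚᵘₚ.≤-respˡ-≃ (toℚᵘ-ℕ m) (ℚᵘₚ.≤-respʳ-≃ (toℚᵘ-ℕ n) (toℚᵘ-mono-≤ h))
  ... | ℚᵘ.*≤* le = ℤₚ.drop‿+≤+ (subst₂ ℤ._≤_ (ℤₚ.*-identityʳ (+ m)) (ℤₚ.*-identityʳ (+ n)) le)

  ℕtoℚ-nonNeg : ∀ n → NonNegative (ℕtoℚ n)
  ℕtoℚ-nonNeg n = nonNegative (ℕtoℚ-mono {0} {n} z≤n)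

  ℕtoℚ-pos : ∀ {n} → 1 ℕ.≤ n → Positive (ℕtoℚ n)
  ℕtoℚ-pos {n} h = positive (<-≤-trans (*<* (ℤ.+<+ (s≤s z≤n))) (ℕtoℚ-mono {1} {n} h))

  -- The fraction need not be in lowest terms, so products and sums can be formed without reduction.
  record Frac (ε : ℚ) (a b : ℕ) : Set where
    constructor frac
    field
      1≤b : 1 ℕ.≤ b
      scaled : ε * ℕtoℚ b ≡ ℕtoℚ a

  open Frac public

  Frac-ℕ : ∀ n → Frac (ℕtoℚ n) n 1
  Frac-ℕ n = frac ℕₚ.≤-refl (*-identityʳ (ℕtoℚ n))

  Frac-* : ∀ {ε δ a b c d} → Frac ε a b → Frac δ c d → Frac (ε * δ) (a ℕ.* c) (b ℕ.* d)
  Frac-* {ε} {δ} {a} {b} {c} {d} (frac p e) (frac q f) = frac (ℕₚ.*-mono-≤ p q) (begin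
    ε * δ * ℕtoℚ (b ℕ.* d)          ≡⟨ cong (ε * δ *_) (ℕtoℚ-* b d) ⟩
    ε * δ * (ℕtoℚ b * ℕtoℚ d)       ≡⟨ solve 4 (λ x y z w → x :* y :* (z :* w) := x :* z :* (y :* w)) refl ε δ (ℕtoℚ b) (ℕtoℚ d) ⟩
    ε * ℕtoℚ b * (δ * ℕtoℚ d)       ≡⟨ cong₂ _*_ e f ⟩
    ℕtoℚ a * ℕtoℚ c                 ≡⟨ ℕtoℚ-* a c ⟨
    ℕtoℚ (a ℕ.* c)                  ∎)
    where
    open ≡-Reasoning
    open +-*-Solver

  Frac-+ : ∀ {ε δ a b c d} → Frac ε a b → Frac δ c d → Frac (ε + δ) (a ℕ.* d ℕ.+ c ℕ.* b) (b ℕ.* d)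
  Frac-+ {ε} {δ} {a} {b} {c} {d} (frac p e) (frac q f) = frac (ℕₚ.*-mono-≤ p q) (begin
    (ε + δ) * ℕtoℚ (b ℕ.* d)        ≡⟨ cong ((ε + δ) *_) (ℕtoℚ-* b d) ⟩
    (ε + δ) * (ℕtoℚ b * ℕtoℚ d)
      ≡⟨ solve 4 (λ x y z w → (x :+ y) :* (z :* w) := x :* z :* w :+ y :* w :* z) refl ε δ (ℕtoℚ b) (ℕtoℚ d) ⟩
    ε * ℕtoℚ b * ℕtoℚ d + δ * ℕtoℚ d * ℕtoℚ b
      ≡⟨ cong₂ (λ x y → x * ℕtoℚ d + y * ℕtoℚ b) e f ⟩
    ℕtoℚ a * ℕtoℚ d + ℕtoℚ c * ℕtoℚ b
      ≡⟨ cong₂ _+_ (ℕtoℚ-* a d) (ℕtoℚ-* c b) ⟨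
    ℕtoℚ (a ℕ.* d) + ℕtoℚ (c ℕ.* b)
      ≡⟨ ℕtoℚ-+ (a ℕ.* d) (c ℕ.* b) ⟨
    ℕtoℚ (a ℕ.* d ℕ.+ c ℕ.* b)      ∎)
    where
    open ≡-Reasoning
    open +-*-Solver

  module _ {ε δ a b c d} (F : Frac ε a b) (G : Frac δ c d) where

    private
      left : ε * ℕtoℚ (b ℕ.* d) ≡ ℕtoℚ (a ℕ.* d)
      left = trans (cong (ε *_) (ℕtoℚ-* b d)) (trans (sym (*-assoc ε (ℕtoℚ b) (ℕtoℚ d)))
        (trans (cong (_* ℕtoℚ d) (scaled F)) (sym (ℕtoℚ-* a d))))
      right : δ * ℕtoℚ (b ℕ.* d) ≡ ℕtoℚ (c ℕ.* b)
      right = trans (cong (λ k → δ * ℕtoℚ k) (ℕₚ.*-comm b d)) (trans (cong (δ *_) (ℕtoℚ-* d b))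
        (trans (sym (*-assoc δ (ℕtoℚ d) (ℕtoℚ b))) (trans (cong (_* ℕtoℚ b) (scaled G)) (sym (ℕtoℚ-* c b)))))

    Frac-≤⇒ : ε ≤ δ → a ℕ.* d ℕ.≤ c ℕ.* b
    Frac-≤⇒ h = ℕtoℚ-cancel (subst₂ _≤_ left right (*-monoʳ-≤-nonNeg (ℕtoℚ (b ℕ.* d)) {{ℕtoℚ-nonNeg (b ℕ.* d)}} h))

    Frac-≤⇐ : a ℕ.* d ℕ.≤ c ℕ.* b → ε ≤ δ
    Frac-≤⇐ h = *-cancelʳ-≤-pos (ℕtoℚ (b ℕ.* d)) {{ℕtoℚ-pos (ℕₚ.*-mono-≤ (1≤b F) (1≤b G))}}
      (subst₂ _≤_ (sym left) (sym right) (ℕtoℚ-mono {a ℕ.* d} {c ℕ.* b} h))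

  toFrac : ∀ ε → 0ℚ ≤ ε → ∃ λ a → ∃ λ b → Frac ε a b
  toFrac ε@(mkℚ (+ a) b-1 _) _ = a , suc b-1 , frac (s≤s z≤n) (toℚᵘ-injective (begin
    toℚᵘ (ε * ℕtoℚ (suc b-1))                  ≈⟨ toℚᵘ-homo-* ε (ℕtoℚ (suc b-1)) ⟩
    toℚᵘ ε ℚᵘ.* toℚᵘ (ℕtoℚ (suc b-1))          ≈⟨ ℚᵘₚ.*-congˡ {toℚᵘ ε} (toℚᵘ-ℕ (suc b-1)) ⟩
    toℚᵘ ε ℚᵘ.* ℚᵘ.mkℚᵘ (+ suc b-1) 0          ≈⟨ ℚᵘ.*≡* (trans (ℤₚ.*-identityʳ _) (cong (λ k → + a ℤ.* + k) (sym (ℕₚ.*-identityʳ (suc b-1))))) ⟩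
    ℚᵘ.mkℚᵘ (+ a) 0                            ≈⟨ toℚᵘ-ℕ a ⟨
    toℚᵘ (ℕtoℚ a)                              ∎))
    where open ℚᵘₚ.≃-Reasoning
  toFrac (mkℚ (-[1+ _ ]) _ _) (*≤* ())

  Frac-/ : ∀ a b → .{{_ : ℕ.NonZero b}} → Frac (+ a / b) a b
  Frac-/ a (suc b-1) = frac (s≤s z≤n) (toℚᵘ-injective (begin
    toℚᵘ ((+ a / suc b-1) * ℕtoℚ (suc b-1))    ≈⟨ toℚᵘ-homo-* (+ a / suc b-1) (ℕtoℚ (suc b-1)) ⟩
    toℚᵘ (+ a / suc b-1) ℚᵘ.* toℚᵘ (ℕtoℚ (suc b-1))
      ≈⟨ ℚᵘₚ.*-cong (toℚᵘ-fromℚᵘ (ℚᵘ.mkℚᵘ (+ a) b-1)) (toℚᵘ-ℕ (suc b-1)) ⟩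
    ℚᵘ.mkℚᵘ (+ a) b-1 ℚᵘ.* ℚᵘ.mkℚᵘ (+ suc b-1) 0
      ≈⟨ ℚᵘ.*≡* (trans (ℤₚ.*-identityʳ _) (cong (λ k → + a ℤ.* + k) (sym (ℕₚ.*-identityʳ (suc b-1))))) ⟩
    ℚᵘ.mkℚᵘ (+ a) 0                            ≈⟨ toℚᵘ-ℕ a ⟨
    toℚᵘ (ℕtoℚ a)                              ∎))
    where open ℚᵘₚ.≃-Reasoning

  Frac-positive⇒ : ∀ {ε a b} → Frac ε a b → 0ℚ < ε → 1 ℕ.≤ a
  Frac-positive⇒ {ε} {zero} {b} F h = ⊥-elim (<-irrefl refl (<-≤-trans h (Frac-≤⇐ F (Frac-ℕ 0) z≤n)))
  Frac-positive⇒ {a = suc a} F h = s≤s z≤n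

  1/-positive : ∀ b → .{{_ : ℕ.NonZero b}} → 0ℚ < + 1 / b
  1/-positive b = ≰⇒> λ h → ℕₚ.<⇒≱ (s≤s z≤n) (Frac-≤⇒ (Frac-/ 1 b) (Frac-ℕ 0) h)

-- Quantitative bounds for diameters 2, 3 and 4.

module Estimates where

  open FiniteSums using (eqᵇ)
  open Pieces
  open Blowups
  open Incidences
  open OrthogonalArrays
  open PrimesInRange
  open Fractions
  open import Data.Nat as ℕ using (ℕ; zero; suc; z≤n; s≤s) renaming (_≤_ to _≤ℕ_)
  import Data.Nat.Properties as ℕₚ
  import Data.Nat.DivMod as ℕᵈ
  open import Data.Nat.Primality using (Prime)
  open import Data.Nat.Tactic.RingSolver using (solve-∀)
  open import Data.Fin using (Fin)
  open import Data.Integer using (+_)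
  open import Data.Rational using (0ℚ; 1ℚ; _/_; _+_; _*_; _≤_; _<_)
  import Data.Rational.Properties as ℚₚ

  n<[1+n/d]*d : ∀ n d → .{{_ : ℕ.NonZero d}} → n ℕ.< suc (n ℕᵈ./ d) ℕ.* d
  n<[1+n/d]*d n d = ℕₚ.≤-<-trans (ℕₚ.≤-reflexive (ℕᵈ.m≡m%n+[m/n]*n n d)) (ℕₚ.+-monoˡ-< (n ℕᵈ./ d ℕ.* d) (ℕᵈ.m%n<n n d))

  square-cancel-≤ : ∀ {m n} → m ℕ.* m ≤ℕ n ℕ.* n → m ≤ℕ n
  square-cancel-≤ h = ℕₚ.≮⇒≥ λ n<m → ℕₚ.<⇒≱ (ℕₚ.*-mono-< n<m n<m) h

  module _ {ε a b} (F : Frac ε a b) (s n : ℕ) where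

    private
      lem₁ : ∀ s b → s ℕ.* (b ℕ.* (1 ℕ.* 1)) ≡ s ℕ.* b
      lem₁ = solve-∀
      rhs : Frac (ε * (ℕtoℚ n * ℕtoℚ n)) (a ℕ.* (n ℕ.* n)) (b ℕ.* (1 ℕ.* 1))
      rhs = Frac-* F (Frac-* (Frac-ℕ n) (Frac-ℕ n))

    size-bound⇐ : s ℕ.* b ≤ℕ a ℕ.* (n ℕ.* n) → ℕtoℚ s ≤ ε * (ℕtoℚ n * ℕtoℚ n)
    size-bound⇐ h = Frac-≤⇐ (Frac-ℕ s) rhs
      (ℕₚ.≤-trans (ℕₚ.≤-reflexive (lem₁ s b)) (ℕₚ.≤-trans h (ℕₚ.≤-reflexive (sym (ℕₚ.*-identityʳ _)))))

    size-bound⇒ : ℕtoℚ s ≤ ε * (ℕtoℚ n * ℕtoℚ n) → s ℕ.* b ≤ℕ a ℕ.* (n ℕ.* n)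
    size-bound⇒ h = ℕₚ.≤-trans (ℕₚ.≤-reflexive (sym (lem₁ s b)))
      (ℕₚ.≤-trans (Frac-≤⇒ (Frac-ℕ s) rhs h) (ℕₚ.≤-reflexive (ℕₚ.*-identityʳ _)))

  1≤product⇒1≤ : ∀ m {n b} → 1 ≤ℕ b → b ≤ℕ m ℕ.* n → 1 ≤ℕ n
  1≤product⇒1≤ m {zero}  1≤b h = ℕₚ.≤-trans 1≤b (ℕₚ.≤-trans h (ℕₚ.≤-reflexive (ℕₚ.*-zeroʳ m)))
  1≤product⇒1≤ m {suc n} 1≤b h = s≤s z≤n

  diam4-upper : ∀ {n ε a b} → Frac ε a b → 1 ≤ℕ a → ∃ λ ℓ → Partitionable n ε 4 ℓ × ℕtoℚ ℓ * ε ≤ 1ℚ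
  diam4-upper {n} {ε} {a} {b} F 1≤a = K , part , Frac-≤⇐ (Frac-* (Frac-ℕ K) F) (Frac-ℕ 1)
      (ℕₚ.≤-trans (ℕₚ.≤-reflexive (ℕₚ.*-identityʳ (K ℕ.* a))) (ℕₚ.≤-trans (ℕᵈ.m/n*n≤m b a) (ℕₚ.≤-reflexive (lem₁ b))))
    where
    instance
      a≢0 : ℕ.NonZero a
      a≢0 = ℕ.>-nonZero 1≤a
    -- The integer part of 1/ε: Kε ≤ 1 bounds the number of classes, and (K+1)ε ≥ 1 turns the
    -- peeling bound n²/(K+1) into εn².
    K : ℕ
    K = b ℕᵈ./ a
    lem₁ : ∀ b → b ≡ 1 ℕ.* (1 ℕ.* b)
    lem₁ = solve-∀
    lem₂ : ∀ s k a → s ℕ.* (k ℕ.* a) ≡ a ℕ.* (k ℕ.* s)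
    lem₂ = solve-∀
    part : Partitionable n ε 4 K
    part G =
      let p , diam , size = diam4-partition G K
      in p , size-bound⇐ F (sizeE₀ p) n (begin
           sizeE₀ p ℕ.* b                  ≤⟨ ℕₚ.*-monoʳ-≤ (sizeE₀ p) (ℕₚ.<⇒≤ (n<[1+n/d]*d b a)) ⟩
           sizeE₀ p ℕ.* (suc K ℕ.* a)      ≡⟨ lem₂ (sizeE₀ p) (suc K) a ⟩
           a ℕ.* (suc K ℕ.* sizeE₀ p)      ≤⟨ ℕₚ.*-monoʳ-≤ a size ⟩
           a ℕ.* (n ℕ.* n)                 ∎) , diam
      where open ℕₚ.≤-Reasoning

  diam3-upper : ∀ {n ε a b} → Frac ε a b → 1 ≤ℕ a → ∃ λ ℓ → Partitionable n ε 3 ℓ × ℕtoℚ ℓ * (ε * ε) ≤ 1ℚ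
  diam3-upper {n} {ε} {a} {b} F 1≤a = K , part , Frac-≤⇐ (Frac-* (Frac-ℕ K) (Frac-* F F)) (Frac-ℕ 1)
      (ℕₚ.≤-trans (ℕₚ.≤-reflexive (ℕₚ.*-identityʳ _)) (ℕₚ.≤-trans (ℕᵈ.m/n*n≤m (b ℕ.* b) (a ℕ.* a)) (ℕₚ.≤-reflexive (lem₁ (b ℕ.* b)))))
    where
    instance
      a²≢0 : ℕ.NonZero (a ℕ.* a)
      a²≢0 = ℕ.>-nonZero (ℕₚ.*-mono-≤ 1≤a 1≤a)
    K : ℕ
    K = (b ℕ.* b) ℕᵈ./ (a ℕ.* a)
    lem₁ : ∀ b → b ≡ 1 ℕ.* (1 ℕ.* b)
    lem₁ = solve-∀
    lem₂ : ∀ s b → s ℕ.* b ℕ.* (s ℕ.* b) ≡ s ℕ.* s ℕ.* (b ℕ.* b)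
    lem₂ = solve-∀
    lem₃ : ∀ s k a → s ℕ.* (k ℕ.* a) ≡ a ℕ.* (k ℕ.* s)
    lem₃ = solve-∀
    part : Partitionable n ε 3 K
    part G =
      let p , diam , size = diam3-partition G K
          s = sizeE₀ p
      in p , size-bound⇐ F s n (square-cancel-≤ (begin
           s ℕ.* b ℕ.* (s ℕ.* b)                          ≡⟨ lem₂ s b ⟩
           s ℕ.* s ℕ.* (b ℕ.* b)                          ≤⟨ ℕₚ.*-monoʳ-≤ (s ℕ.* s) (ℕₚ.<⇒≤ (n<[1+n/d]*d (b ℕ.* b) (a ℕ.* a))) ⟩
           s ℕ.* s ℕ.* (suc K ℕ.* (a ℕ.* a))              ≡⟨ lem₃ (s ℕ.* s) (suc K) (a ℕ.* a) ⟩
           a ℕ.* a ℕ.* (suc K ℕ.* (s ℕ.* s))              ≤⟨ ℕₚ.*-monoʳ-≤ (a ℕ.* a) size ⟩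
           a ℕ.* a ℕ.* (n ℕ.* n ℕ.* (n ℕ.* n))            ≡⟨ lem₂ a (n ℕ.* n) ⟨
           a ℕ.* (n ℕ.* n) ℕ.* (a ℕ.* (n ℕ.* n))          ∎)) , diam
      where open ℕₚ.≤-Reasoning

  diam2-upper : ∀ n {ε} → 0ℚ ≤ ε → P≤ n ε 2 (1ℚ * ℕtoℚ n)
  diam2-upper n {ε} 0≤ε = n , part , ℚₚ.≤-reflexive (sym (ℚₚ.*-identityˡ (ℕtoℚ n)))
    where
    part : Partitionable n ε 2 n
    part G =
      let p , diam , size = starPartition G
          a , b , F = toFrac ε 0≤ε
      in p , size-bound⇐ F (sizeE₀ p) n (ℕₚ.≤-trans (ℕₚ.≤-reflexive (cong (ℕ._* b) size)) z≤n) , diam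

  -- Blocks of size t = n/(2a₀), rounded down, satisfy n ≤ 4a₀t, so εn² ≤ 16εa₀²t². The density
  -- hypothesis makes this at most half of the t²·`count R` edges; the other half must be covered by
  -- classes of at most t²h edges each.
  blowup-lower : ∀ {a₀ d h n ε a b ℓ} (R : Fin a₀ → Fin a₀ → Bool) → Small R d h → 1 ≤ℕ a₀ → a₀ ℕ.+ a₀ ≤ℕ n →
    Frac ε a b → 32 ℕ.* a ℕ.* (a₀ ℕ.* a₀) ≤ℕ b ℕ.* count R → Partitionable n ε d ℓ → count R ≤ℕ 2 ℕ.* (ℓ ℕ.* h)
  blowup-lower {a₀} {d} {h} {n} {ε} {a} {b} {ℓ} R small 1≤a₀ 2a₀≤n F dense part =
    ℕₚ.*-cancelˡ-≤ T {{ℕ.>-nonZero (ℕₚ.*-mono-≤ 1≤t 1≤t)}} (ℕₚ.+-cancelˡ-≤ (e ℕ.* T) _ _ (begin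
      e ℕ.* T ℕ.+ T ℕ.* e              ≡⟨ lem₁ e T ⟩
      2 ℕ.* (T ℕ.* e)                  ≤⟨ ℕₚ.*-monoʳ-≤ 2 (proj₂ G p (λ j → diam j)) ⟩
      2 ℕ.* (s ℕ.+ ℓ ℕ.* (T ℕ.* h))    ≡⟨ lem₂ s ℓ T h ⟩
      2 ℕ.* s ℕ.+ T ℕ.* (2 ℕ.* (ℓ ℕ.* h)) ≤⟨ ℕₚ.+-monoˡ-≤ _ 2s≤ ⟩
      e ℕ.* T ℕ.+ T ℕ.* (2 ℕ.* (ℓ ℕ.* h)) ∎))
    where
    open ℕₚ.≤-Reasoning
    instance
      2a₀≢0 : ℕ.NonZero (a₀ ℕ.+ a₀)
      2a₀≢0 = ℕ.>-nonZero (ℕₚ.≤-trans 1≤a₀ (ℕₚ.m≤m+n a₀ a₀))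
    t T e : ℕ
    t = n ℕᵈ./ (a₀ ℕ.+ a₀)
    T = t ℕ.* t
    e = count R
    1≤t : 1 ≤ℕ t
    1≤t = ℕᵈ.m≥n⇒m/n>0 2a₀≤n
    lem₁ : ∀ e T → e ℕ.* T ℕ.+ T ℕ.* e ≡ 2 ℕ.* (T ℕ.* e)
    lem₁ = solve-∀
    lem₂ : ∀ s ℓ T h → 2 ℕ.* (s ℕ.+ ℓ ℕ.* (T ℕ.* h)) ≡ 2 ℕ.* s ℕ.+ T ℕ.* (2 ℕ.* (ℓ ℕ.* h))
    lem₂ = solve-∀
    lem₃ : ∀ t a → a ℕ.* t ℕ.+ a ℕ.* t ≡ t ℕ.* (a ℕ.+ a)
    lem₃ = solve-∀
    lem₄ : ∀ t a → t ℕ.* (a ℕ.+ a) ℕ.+ t ℕ.* (a ℕ.+ a) ≡ 4 ℕ.* a ℕ.* t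
    lem₄ = solve-∀
    lem₅ : ∀ a x t → 2 ℕ.* (a ℕ.* (4 ℕ.* x ℕ.* t ℕ.* (4 ℕ.* x ℕ.* t))) ≡ 32 ℕ.* a ℕ.* (x ℕ.* x) ℕ.* (t ℕ.* t)
    lem₅ = solve-∀
    lem₆ : ∀ b s → b ℕ.* (2 ℕ.* s) ≡ 2 ℕ.* (s ℕ.* b)
    lem₆ = solve-∀
    G = lowerBoundGraph n t R small (ℕₚ.≤-trans (ℕₚ.≤-reflexive (lem₃ t a₀)) (ℕᵈ.m/n*n≤m n (a₀ ℕ.+ a₀)))
    p = proj₁ (part (proj₁ G))
    s = sizeE₀ p
    diam = proj₂ (proj₂ (part (proj₁ G)))
    n≤ : n ≤ℕ 4 ℕ.* a₀ ℕ.* t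
    n≤ = begin
      n                                               ≤⟨ ℕₚ.<⇒≤ (n<[1+n/d]*d n (a₀ ℕ.+ a₀)) ⟩
      (a₀ ℕ.+ a₀) ℕ.+ t ℕ.* (a₀ ℕ.+ a₀)               ≤⟨ ℕₚ.+-monoˡ-≤ _ (ℕₚ.m≤n*m (a₀ ℕ.+ a₀) t {{ℕ.>-nonZero 1≤t}}) ⟩
      t ℕ.* (a₀ ℕ.+ a₀) ℕ.+ t ℕ.* (a₀ ℕ.+ a₀)         ≡⟨ lem₄ t a₀ ⟩
      4 ℕ.* a₀ ℕ.* t                                  ∎
    2s≤ : 2 ℕ.* s ≤ℕ e ℕ.* T
    2s≤ = ℕₚ.*-cancelˡ-≤ b {{ℕ.>-nonZero (1≤b F)}} (begin
      b ℕ.* (2 ℕ.* s)                                 ≡⟨ lem₆ b s ⟩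
      2 ℕ.* (s ℕ.* b)                                 ≤⟨ ℕₚ.*-monoʳ-≤ 2 (size-bound⇒ F s n (proj₁ (proj₂ (part (proj₁ G))))) ⟩
      2 ℕ.* (a ℕ.* (n ℕ.* n))                         ≤⟨ ℕₚ.*-monoʳ-≤ 2 (ℕₚ.*-monoʳ-≤ a (ℕₚ.*-mono-≤ n≤ n≤)) ⟩
      2 ℕ.* (a ℕ.* (4 ℕ.* a₀ ℕ.* t ℕ.* (4 ℕ.* a₀ ℕ.* t)))  ≡⟨ lem₅ a a₀ t ⟩
      32 ℕ.* a ℕ.* (a₀ ℕ.* a₀) ℕ.* T                  ≤⟨ ℕₚ.*-monoˡ-≤ T dense ⟩
      b ℕ.* e ℕ.* T                                   ≡⟨ ℕₚ.*-assoc b e T ⟩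
      b ℕ.* (e ℕ.* T)                                 ∎)

  diam4-lower : ∀ {n ε a b ℓ} → Frac ε a b → 1 ≤ℕ a → b ≤ℕ n ℕ.* a → 32 ℕ.* a ≤ℕ b → Partitionable n ε 4 ℓ →
    b ≤ℕ 128 ℕ.* (ℓ ℕ.* a)
  diam4-lower {n} {ε} {a} {b} {ℓ} F 1≤a b≤na 32a≤b part = begin
      b                                   ≤⟨ ℕₚ.<⇒≤ (n<[1+n/d]*d b c) ⟩
      c ℕ.+ k ℕ.* c                       ≤⟨ ℕₚ.+-monoˡ-≤ (k ℕ.* c) (ℕₚ.m≤n*m c k {{ℕ.>-nonZero 1≤k}}) ⟩
      k ℕ.* c ℕ.+ k ℕ.* c                 ≤⟨ ℕₚ.+-mono-≤ (ℕₚ.*-monoˡ-≤ c k≤2ℓ) (ℕₚ.*-monoˡ-≤ c k≤2ℓ) ⟩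
      2 ℕ.* (ℓ ℕ.* 1) ℕ.* c ℕ.+ 2 ℕ.* (ℓ ℕ.* 1) ℕ.* c ≡⟨ lem₁ ℓ a ⟩
      128 ℕ.* (ℓ ℕ.* a)                   ∎
    where
    open ℕₚ.≤-Reasoning
    c : ℕ
    c = 32 ℕ.* a
    instance
      c≢0 : ℕ.NonZero c
      c≢0 = ℕ.>-nonZero (ℕₚ.*-mono-≤ {1} {32} (s≤s z≤n) 1≤a)
    -- About 1/(32ε) matching edges, the most that the density hypothesis of `blowup-lower` allows.
    -- They fit into n vertices because nε ≥ 1.
    k : ℕ
    k = b ℕᵈ./ c
    1≤k : 1 ≤ℕ k
    1≤k = ℕᵈ.m≥n⇒m/n>0 32a≤b
    kc≤b : k ℕ.* c ≤ℕ b
    kc≤b = ℕᵈ.m/n*n≤m b c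
    lem₁ : ∀ ℓ a → 2 ℕ.* (ℓ ℕ.* 1) ℕ.* (32 ℕ.* a) ℕ.+ 2 ℕ.* (ℓ ℕ.* 1) ℕ.* (32 ℕ.* a) ≡ 128 ℕ.* (ℓ ℕ.* a)
    lem₁ = solve-∀
    lem₂ : ∀ k a → k ℕ.* (32 ℕ.* a) ≡ (k ℕ.+ k) ℕ.* a ℕ.+ 30 ℕ.* k ℕ.* a
    lem₂ = solve-∀
    lem₃ : ∀ a k → 32 ℕ.* a ℕ.* (k ℕ.* k) ≡ k ℕ.* (32 ℕ.* a) ℕ.* k
    lem₃ = solve-∀
    2k≤n : k ℕ.+ k ≤ℕ n
    2k≤n = ℕₚ.*-cancelʳ-≤ (k ℕ.+ k) n a {{ℕ.>-nonZero 1≤a}} (begin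
      (k ℕ.+ k) ℕ.* a                          ≤⟨ ℕₚ.m≤m+n _ (30 ℕ.* k ℕ.* a) ⟩
      (k ℕ.+ k) ℕ.* a ℕ.+ 30 ℕ.* k ℕ.* a       ≡⟨ lem₂ k a ⟨
      k ℕ.* c                                  ≤⟨ ℕₚ.≤-trans kc≤b b≤na ⟩
      n ℕ.* a                                  ∎)
    k≤2ℓ : k ≤ℕ 2 ℕ.* (ℓ ℕ.* 1)
    k≤2ℓ = subst (_≤ℕ 2 ℕ.* (ℓ ℕ.* 1)) (matching-count k) (blowup-lower _ (matching-small 4) 1≤k 2k≤n F
      (begin
        32 ℕ.* a ℕ.* (k ℕ.* k)          ≡⟨ lem₃ a k ⟩
        k ℕ.* c ℕ.* k                   ≤⟨ ℕₚ.*-monoˡ-≤ k kc≤b ⟩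
        b ℕ.* k                         ≡⟨ cong (b ℕ.*_) (matching-count k) ⟨
        b ℕ.* count eqᵇ ∎) part)


  diam3-lower : ∀ {n ε a b ℓ} → Frac ε a b → 1 ≤ℕ a → b ℕ.* b ≤ℕ n ℕ.* (a ℕ.* a) → 4096 ℕ.* (32 ℕ.* a) ≤ℕ b →
    Partitionable n ε 3 ℓ → b ℕ.* b ≤ℕ 2048 ℕ.* 2048 ℕ.* 10 ℕ.* (ℓ ℕ.* (a ℕ.* a))
  diam3-lower {n} {ε} {a} {b} {ℓ} F 1≤a b²≤ big part = bound (prime-below x 4096≤x)
    where
    open ℕₚ.≤-Reasoning
    c : ℕ
    c = 32 ℕ.* a
    instance
      c≢0 : ℕ.NonZero c
      c≢0 = ℕ.>-nonZero (ℕₚ.*-mono-≤ {1} {32} (s≤s z≤n) 1≤a)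
    x : ℕ
    x = b ℕᵈ./ c
    -- The smallness of ε puts x, which is 1/(32ε) rounded down, into the range of `prime-below`.
    4096≤x : 4096 ≤ℕ x
    4096≤x = ℕₚ.≮⇒≥ λ x<4096 → ℕₚ.<⇒≱ (ℕₚ.<-≤-trans (n<[1+n/d]*d b c) (ℕₚ.*-monoˡ-≤ c x<4096)) big
    bound : (∃ λ p → Prime p × p ≤ℕ x × x ≤ℕ 32 ℕ.* p) → b ℕ.* b ≤ℕ 2048 ℕ.* 2048 ℕ.* 10 ℕ.* (ℓ ℕ.* (a ℕ.* a))
    bound (p , pr , p≤x , x≤32p) = begin
      b ℕ.* b
        ≤⟨ ℕₚ.*-mono-≤ b≤ b≤ ⟩
      2048 ℕ.* (a ℕ.* p) ℕ.* (2048 ℕ.* (a ℕ.* p))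
        ≡⟨ lem₁ 2048 a p ⟩
      2048 ℕ.* 2048 ℕ.* (p ℕ.* p ℕ.* (a ℕ.* a))
        ≤⟨ ℕₚ.*-monoʳ-≤ (2048 ℕ.* 2048) (ℕₚ.*-monoˡ-≤ (a ℕ.* a) p²≤10ℓ) ⟩
      2048 ℕ.* 2048 ℕ.* (10 ℕ.* ℓ ℕ.* (a ℕ.* a))
        ≡⟨ lem₂ (2048 ℕ.* 2048) 10 ℓ (a ℕ.* a) ⟩
      2048 ℕ.* 2048 ℕ.* 10 ℕ.* (ℓ ℕ.* (a ℕ.* a)) ∎
      where
      lem₁ : ∀ k a p → k ℕ.* (a ℕ.* p) ℕ.* (k ℕ.* (a ℕ.* p)) ≡ k ℕ.* k ℕ.* (p ℕ.* p ℕ.* (a ℕ.* a))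
      lem₁ = solve-∀
      lem₂ : ∀ k m ℓ a → k ℕ.* (m ℕ.* ℓ ℕ.* a) ≡ k ℕ.* m ℕ.* (ℓ ℕ.* a)
      lem₂ = solve-∀
      lem₃ : ∀ p a → 32 ℕ.* p ℕ.* (32 ℕ.* a) ℕ.+ 32 ℕ.* p ℕ.* (32 ℕ.* a) ≡ 2048 ℕ.* (a ℕ.* p)
      lem₃ = solve-∀
      lem₄ : ∀ p a → p ℕ.* (32 ℕ.* a) ℕ.* (p ℕ.* (32 ℕ.* a)) ≡ (p ℕ.* p ℕ.+ p ℕ.* p) ℕ.* (a ℕ.* a) ℕ.+ 1022 ℕ.* (p ℕ.* p ℕ.* (a ℕ.* a))
      lem₄ = solve-∀
      lem₅ : ∀ p a → 32 ℕ.* a ℕ.* (p ℕ.* p ℕ.* (p ℕ.* p)) ≡ p ℕ.* (32 ℕ.* a) ℕ.* (p ℕ.* p ℕ.* p)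
      lem₅ = solve-∀
      lem₆ : ∀ p ℓ → 2 ℕ.* (ℓ ℕ.* (5 ℕ.* p)) ≡ 10 ℕ.* ℓ ℕ.* p
      lem₆ = solve-∀
      1≤x : 1 ≤ℕ x
      1≤x = ℕₚ.≤-trans (s≤s z≤n) 4096≤x
      1≤p : 1 ≤ℕ p
      1≤p = ℕₚ.≤-trans (s≤s z≤n) (prime>1 pr)
      pc≤b : p ℕ.* c ≤ℕ b
      pc≤b = ℕₚ.≤-trans (ℕₚ.*-monoˡ-≤ c p≤x) (ℕᵈ.m/n*n≤m b c)
      b≤ : b ≤ℕ 2048 ℕ.* (a ℕ.* p)
      b≤ = begin
        b                       ≤⟨ ℕₚ.<⇒≤ (n<[1+n/d]*d b c) ⟩
        c ℕ.+ x ℕ.* c           ≤⟨ ℕₚ.+-monoˡ-≤ (x ℕ.* c) (ℕₚ.m≤n*m c x {{ℕ.>-nonZero 1≤x}}) ⟩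
        x ℕ.* c ℕ.+ x ℕ.* c     ≤⟨ ℕₚ.+-mono-≤ (ℕₚ.*-monoˡ-≤ c x≤32p) (ℕₚ.*-monoˡ-≤ c x≤32p) ⟩
        32 ℕ.* p ℕ.* c ℕ.+ 32 ℕ.* p ℕ.* c ≡⟨ lem₃ p a ⟩
        2048 ℕ.* (a ℕ.* p)      ∎
      2p²≤n : p ℕ.* p ℕ.+ p ℕ.* p ≤ℕ n
      2p²≤n = ℕₚ.*-cancelʳ-≤ (p ℕ.* p ℕ.+ p ℕ.* p) n (a ℕ.* a) {{ℕ.>-nonZero (ℕₚ.*-mono-≤ 1≤a 1≤a)}} (begin
        (p ℕ.* p ℕ.+ p ℕ.* p) ℕ.* (a ℕ.* a)   ≤⟨ ℕₚ.m≤m+n _ (1022 ℕ.* (p ℕ.* p ℕ.* (a ℕ.* a))) ⟩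
        (p ℕ.* p ℕ.+ p ℕ.* p) ℕ.* (a ℕ.* a) ℕ.+ 1022 ℕ.* (p ℕ.* p ℕ.* (a ℕ.* a)) ≡⟨ lem₄ p a ⟨
        p ℕ.* c ℕ.* (p ℕ.* c)                 ≤⟨ ℕₚ.*-mono-≤ pc≤b pc≤b ⟩
        b ℕ.* b                               ≤⟨ b²≤ ⟩
        n ℕ.* (a ℕ.* a)                       ∎)
      open AffinePlane pr using (incidence; incidence-count; incidence-small)
      -- Half of the p³ incidences against pieces of at most 5p: ℓ ≥ p³/(2·5p).
      p²≤10ℓ : p ℕ.* p ≤ℕ 10 ℕ.* ℓ
      p²≤10ℓ = ℕₚ.*-cancelʳ-≤ (p ℕ.* p) (10 ℕ.* ℓ) p {{ℕ.>-nonZero 1≤p}} (begin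
        p ℕ.* p ℕ.* p           ≡⟨ incidence-count ⟨
        count incidence
          ≤⟨ blowup-lower incidence incidence-small (ℕₚ.*-mono-≤ 1≤p 1≤p) 2p²≤n F (begin
               32 ℕ.* a ℕ.* (p ℕ.* p ℕ.* (p ℕ.* p))  ≡⟨ lem₅ p a ⟩
               p ℕ.* c ℕ.* (p ℕ.* p ℕ.* p)           ≤⟨ ℕₚ.*-monoˡ-≤ (p ℕ.* p ℕ.* p) pc≤b ⟩
               b ℕ.* (p ℕ.* p ℕ.* p)                 ≡⟨ cong (b ℕ.*_) incidence-count ⟨
               b ℕ.* count incidence                 ∎) part ⟩
        2 ℕ.* (ℓ ℕ.* (5 ℕ.* p)) ≡⟨ lem₆ p ℓ ⟩
        10 ℕ.* ℓ ℕ.* p          ∎)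

  -- E₀ has at most (1/4 - η)n² edges with η = g/f, while R has at least (1 - 1/q)m² with m about
  -- n/2. As f ≤ q gives 1/q ≤ η, an amount of order ηn² remains, to be covered by bicliques of at
  -- most q³m edges.
  diam2-lower : ∀ {q n ε a b g f ℓ} → Prime q → Frac ε a b → 1 ≤ℕ g → f ≤ℕ q → 2 ℕ.* f ℕ.+ 2 ≤ℕ n →
    (a ℕ.* f ℕ.+ g ℕ.* b) ℕ.* 4 ≤ℕ b ℕ.* f → Partitionable n ε 2 ℓ → n ≤ℕ 12 ℕ.* f ℕ.* (q ℕ.* q ℕ.* q) ℕ.* ℓ
  diam2-lower {q} {n} {ε} {a} {b} {g} {f} {ℓ} pr F 1≤g f≤q 2f+2≤n εη part = n≤
    where
    open ℕₚ.≤-Reasoning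
    m r : ℕ
    m = n ℕᵈ./ 2
    r = n ℕᵈ.% 2
    n≡ : n ≡ r ℕ.+ m ℕ.* 2
    n≡ = ℕᵈ.m≡m%n+[m/n]*n n 2
    r≤1 : r ≤ℕ 1
    r≤1 = ℕₚ.≤-pred (ℕᵈ.m%n<n n 2)
    n≤2m+1 : n ≤ℕ 1 ℕ.+ m ℕ.* 2
    n≤2m+1 = ℕₚ.≤-trans (ℕₚ.≤-reflexive n≡) (ℕₚ.+-monoˡ-≤ (m ℕ.* 2) r≤1)
    f+1≤m : suc f ≤ℕ m
    f+1≤m = ℕₚ.≮⇒≥ λ m<f+1 → ℕₚ.<⇒≱ (ℕₚ.≤-<-trans n≤2m+1
      (ℕₚ.≤-<-trans (ℕₚ.+-monoʳ-≤ 1 (ℕₚ.*-monoˡ-≤ 2 (ℕₚ.≤-pred m<f+1)))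
        (ℕₚ.≤-reflexive (lem f)))) 2f+2≤n
      where
      lem : ∀ f → suc (1 ℕ.+ f ℕ.* 2) ≡ 2 ℕ.* f ℕ.+ 2
      lem = solve-∀
    1≤m : 1 ≤ℕ m
    1≤m = ℕₚ.≤-trans (s≤s z≤n) f+1≤m
    open OrthogonalArray pr using (bicliqueFree)
    bf = bicliqueFree m 1≤m
    R = proj₁ bf
    e h : ℕ
    e = count R
    h = q ℕ.* q ℕ.* q ℕ.* m
    fits : m ℕ.* 1 ℕ.+ m ℕ.* 1 ≤ℕ n
    fits = ℕₚ.≤-trans (ℕₚ.≤-reflexive (lem m)) (ℕᵈ.m/n*n≤m n 2)
      where
      lem : ∀ m → m ℕ.* 1 ℕ.+ m ℕ.* 1 ≡ m ℕ.* 2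
      lem = solve-∀
    -- The blow-up factor is 1, since R itself grows with n; the construction only adds an isolated
    -- vertex when n is odd.
    G = lowerBoundGraph n 1 R (proj₂ (proj₂ bf)) fits
    p = proj₁ (part (proj₁ G))
    s = sizeE₀ p
    size : s ℕ.* b ≤ℕ a ℕ.* (n ℕ.* n)
    size = size-bound⇒ F s n (proj₁ (proj₂ (part (proj₁ G))))
    e≤ : e ≤ℕ s ℕ.+ ℓ ℕ.* h
    e≤ = begin
      e                          ≡⟨ ℕₚ.*-identityˡ e ⟨
      1 ℕ.* e                    ≤⟨ proj₂ G p (proj₂ (proj₂ (part (proj₁ G)))) ⟩
      s ℕ.+ ℓ ℕ.* (1 ℕ.* h)      ≡⟨ cong (λ z → s ℕ.+ ℓ ℕ.* z) (ℕₚ.*-identityˡ h) ⟩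
      s ℕ.+ ℓ ℕ.* h              ∎
    N² : ℕ
    N² = n ℕ.* n
    step₁ : 4 ℕ.* f ℕ.* e ℕ.+ 4 ℕ.* g ℕ.* N² ≤ℕ f ℕ.* N² ℕ.+ 4 ℕ.* f ℕ.* (ℓ ℕ.* h)
    step₁ = ℕₚ.*-cancelˡ-≤ b {{ℕ.>-nonZero (1≤b F)}} (begin
      b ℕ.* (4 ℕ.* f ℕ.* e ℕ.+ 4 ℕ.* g ℕ.* N²)
        ≤⟨ ℕₚ.*-monoʳ-≤ b (ℕₚ.+-monoˡ-≤ (4 ℕ.* g ℕ.* N²) (ℕₚ.*-monoʳ-≤ (4 ℕ.* f) e≤)) ⟩
      b ℕ.* (4 ℕ.* f ℕ.* (s ℕ.+ ℓ ℕ.* h) ℕ.+ 4 ℕ.* g ℕ.* N²)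
        ≡⟨ lem₁ b f s (ℓ ℕ.* h) g N² ⟩
      4 ℕ.* f ℕ.* (s ℕ.* b) ℕ.+ (4 ℕ.* g ℕ.* b ℕ.* N² ℕ.+ b ℕ.* (4 ℕ.* f ℕ.* (ℓ ℕ.* h)))
        ≤⟨ ℕₚ.+-monoˡ-≤ _ (ℕₚ.*-monoʳ-≤ (4 ℕ.* f) size) ⟩
      4 ℕ.* f ℕ.* (a ℕ.* N²) ℕ.+ (4 ℕ.* g ℕ.* b ℕ.* N² ℕ.+ b ℕ.* (4 ℕ.* f ℕ.* (ℓ ℕ.* h)))
        ≡⟨ lem₂ f a N² g b (b ℕ.* (4 ℕ.* f ℕ.* (ℓ ℕ.* h))) ⟩
      (a ℕ.* f ℕ.+ g ℕ.* b) ℕ.* 4 ℕ.* N² ℕ.+ b ℕ.* (4 ℕ.* f ℕ.* (ℓ ℕ.* h))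
        ≤⟨ ℕₚ.+-monoˡ-≤ _ (ℕₚ.*-monoˡ-≤ N² εη) ⟩
      b ℕ.* f ℕ.* N² ℕ.+ b ℕ.* (4 ℕ.* f ℕ.* (ℓ ℕ.* h))
        ≡⟨ lem₃ b f N² (4 ℕ.* f ℕ.* (ℓ ℕ.* h)) ⟩
      b ℕ.* (f ℕ.* N² ℕ.+ 4 ℕ.* f ℕ.* (ℓ ℕ.* h)) ∎)
      where
      lem₁ : ∀ b f s y g N → b ℕ.* (4 ℕ.* f ℕ.* (s ℕ.+ y) ℕ.+ 4 ℕ.* g ℕ.* N) ≡ 4 ℕ.* f ℕ.* (s ℕ.* b) ℕ.+ (4 ℕ.* g ℕ.* b ℕ.* N ℕ.+ b ℕ.* (4 ℕ.* f ℕ.* y))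
      lem₁ = solve-∀
      lem₂ : ∀ f a N g b y → 4 ℕ.* f ℕ.* (a ℕ.* N) ℕ.+ (4 ℕ.* g ℕ.* b ℕ.* N ℕ.+ y) ≡ (a ℕ.* f ℕ.+ g ℕ.* b) ℕ.* 4 ℕ.* N ℕ.+ y
      lem₂ = solve-∀
      lem₃ : ∀ b f N y → b ℕ.* f ℕ.* N ℕ.+ b ℕ.* y ≡ b ℕ.* (f ℕ.* N ℕ.+ y)
      lem₃ = solve-∀
    X Y M² : ℕ
    M² = m ℕ.* m
    X = g ℕ.* q ℕ.* M²
    Y = 4 ℕ.* f ℕ.* q ℕ.* (ℓ ℕ.* h)
    f≤gq : f ≤ℕ g ℕ.* q
    f≤gq = ℕₚ.≤-trans f≤q (ℕₚ.m≤n*m q g {{ℕ.>-nonZero 1≤g}})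
    fm≤M² : ∀ {k} → k ≤ℕ m → q ℕ.* (f ℕ.* k) ≤ℕ X
    fm≤M² {k} k≤m = begin
      q ℕ.* (f ℕ.* k)   ≤⟨ ℕₚ.*-monoʳ-≤ q (ℕₚ.*-mono-≤ (ℕₚ.≤-trans (ℕₚ.n≤1+n f) f+1≤m) k≤m) ⟩
      q ℕ.* M²          ≤⟨ ℕₚ.*-monoˡ-≤ M² (ℕₚ.m≤n*m q g {{ℕ.>-nonZero 1≤g}}) ⟩
      X                 ∎
    -- Everything is scaled by 4fq. Of the 16X supplied by ηn², the missing density 1/q costs 4X and
    -- the rounding n ≤ 2m + 1 costs 5X, its lower order terms being absorbed by m > f.
    step₂ : 16 ℕ.* X ≤ℕ 9 ℕ.* X ℕ.+ Y
    step₂ = ℕₚ.+-cancelˡ-≤ (4 ℕ.* f ℕ.* (q ℕ.* M²)) _ _ (begin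
      4 ℕ.* f ℕ.* (q ℕ.* M²) ℕ.+ 16 ℕ.* X
        ≡⟨ lem₁ f q m g ⟩
      4 ℕ.* f ℕ.* (q ℕ.* M²) ℕ.+ 4 ℕ.* g ℕ.* q ℕ.* (m ℕ.* 2 ℕ.* (m ℕ.* 2))
        ≤⟨ ℕₚ.+-mono-≤ (ℕₚ.*-monoʳ-≤ (4 ℕ.* f) (proj₁ (proj₂ bf))) (ℕₚ.*-monoʳ-≤ (4 ℕ.* g ℕ.* q) (ℕₚ.*-mono-≤ 2m≤n 2m≤n)) ⟩
      4 ℕ.* f ℕ.* (q ℕ.* e ℕ.+ M²) ℕ.+ 4 ℕ.* g ℕ.* q ℕ.* N²
        ≡⟨ lem₂ f q e M² g N² ⟩
      q ℕ.* (4 ℕ.* f ℕ.* e ℕ.+ 4 ℕ.* g ℕ.* N²) ℕ.+ 4 ℕ.* (f ℕ.* M²)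
        ≤⟨ ℕₚ.+-monoˡ-≤ (4 ℕ.* (f ℕ.* M²)) (ℕₚ.*-monoʳ-≤ q step₁) ⟩
      q ℕ.* (f ℕ.* N² ℕ.+ 4 ℕ.* f ℕ.* (ℓ ℕ.* h)) ℕ.+ 4 ℕ.* (f ℕ.* M²)
        ≤⟨ ℕₚ.+-mono-≤ (ℕₚ.*-monoʳ-≤ q (ℕₚ.+-monoˡ-≤ (4 ℕ.* f ℕ.* (ℓ ℕ.* h)) (ℕₚ.*-monoʳ-≤ f (ℕₚ.*-mono-≤ n≤2m+1 n≤2m+1))))
             (ℕₚ.*-monoʳ-≤ 4 (ℕₚ.*-monoˡ-≤ M² f≤gq)) ⟩
      q ℕ.* (f ℕ.* ((1 ℕ.+ m ℕ.* 2) ℕ.* (1 ℕ.+ m ℕ.* 2)) ℕ.+ 4 ℕ.* f ℕ.* (ℓ ℕ.* h)) ℕ.+ 4 ℕ.* X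
        ≡⟨ lem₃ q f m (ℓ ℕ.* h) X ⟩
      4 ℕ.* f ℕ.* (q ℕ.* M²) ℕ.+ (4 ℕ.* X ℕ.+ (4 ℕ.* (q ℕ.* (f ℕ.* m)) ℕ.+ q ℕ.* (f ℕ.* 1)) ℕ.+ Y)
        ≤⟨ ℕₚ.+-monoʳ-≤ (4 ℕ.* f ℕ.* (q ℕ.* M²)) (ℕₚ.+-monoˡ-≤ Y (ℕₚ.+-monoʳ-≤ (4 ℕ.* X)
             (ℕₚ.+-mono-≤ (ℕₚ.*-monoʳ-≤ 4 (fm≤M² ℕₚ.≤-refl)) (fm≤M² 1≤m)))) ⟩
      4 ℕ.* f ℕ.* (q ℕ.* M²) ℕ.+ (4 ℕ.* X ℕ.+ (4 ℕ.* X ℕ.+ X) ℕ.+ Y)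
        ≡⟨ cong (λ z → 4 ℕ.* f ℕ.* (q ℕ.* M²) ℕ.+ (z ℕ.+ Y)) (lem₄ X) ⟩
      4 ℕ.* f ℕ.* (q ℕ.* M²) ℕ.+ (9 ℕ.* X ℕ.+ Y) ∎)
      where
      2m≤n : m ℕ.* 2 ≤ℕ n
      2m≤n = ℕᵈ.m/n*n≤m n 2
      lem₁ : ∀ f q m g → 4 ℕ.* f ℕ.* (q ℕ.* (m ℕ.* m)) ℕ.+ 16 ℕ.* (g ℕ.* q ℕ.* (m ℕ.* m)) ≡ 4 ℕ.* f ℕ.* (q ℕ.* (m ℕ.* m)) ℕ.+ 4 ℕ.* g ℕ.* q ℕ.* (m ℕ.* 2 ℕ.* (m ℕ.* 2))
      lem₁ = solve-∀
      lem₂ : ∀ f q e M g N → 4 ℕ.* f ℕ.* (q ℕ.* e ℕ.+ M) ℕ.+ 4 ℕ.* g ℕ.* q ℕ.* N ≡ q ℕ.* (4 ℕ.* f ℕ.* e ℕ.+ 4 ℕ.* g ℕ.* N) ℕ.+ 4 ℕ.* (f ℕ.* M)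
      lem₂ = solve-∀
      lem₃ : ∀ q f m y X → q ℕ.* (f ℕ.* ((1 ℕ.+ m ℕ.* 2) ℕ.* (1 ℕ.+ m ℕ.* 2)) ℕ.+ 4 ℕ.* f ℕ.* y) ℕ.+ 4 ℕ.* X
        ≡ 4 ℕ.* f ℕ.* (q ℕ.* (m ℕ.* m)) ℕ.+ (4 ℕ.* X ℕ.+ (4 ℕ.* (q ℕ.* (f ℕ.* m)) ℕ.+ q ℕ.* (f ℕ.* 1)) ℕ.+ 4 ℕ.* f ℕ.* q ℕ.* y)
      lem₃ = solve-∀
      lem₄ : ∀ X → 4 ℕ.* X ℕ.+ (4 ℕ.* X ℕ.+ X) ≡ 9 ℕ.* X
      lem₄ = solve-∀
    1≤q : 1 ≤ℕ q
    1≤q = ℕₚ.≤-trans (s≤s z≤n) (prime>1 pr)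
    m≤ : m ≤ℕ 4 ℕ.* f ℕ.* (q ℕ.* q ℕ.* q) ℕ.* ℓ
    m≤ = ℕₚ.*-cancelˡ-≤ (q ℕ.* m) {{ℕ.>-nonZero (ℕₚ.*-mono-≤ 1≤q 1≤m)}} (begin
      q ℕ.* m ℕ.* m         ≡⟨ ℕₚ.*-assoc q m m ⟩
      q ℕ.* M²              ≤⟨ ℕₚ.*-monoˡ-≤ M² (ℕₚ.m≤n*m q g {{ℕ.>-nonZero 1≤g}}) ⟩
      X                     ≤⟨ ℕₚ.m≤n*m X 7 ⟩
      7 ℕ.* X               ≤⟨ ℕₚ.+-cancelˡ-≤ (9 ℕ.* X) _ _ (ℕₚ.≤-trans (ℕₚ.≤-reflexive (lem₁ X)) step₂) ⟩
      Y                     ≡⟨ lem₂ f q ℓ m ⟩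
      q ℕ.* m ℕ.* (4 ℕ.* f ℕ.* (q ℕ.* q ℕ.* q) ℕ.* ℓ) ∎)
      where
      lem₁ : ∀ X → 9 ℕ.* X ℕ.+ 7 ℕ.* X ≡ 16 ℕ.* X
      lem₁ = solve-∀
      lem₂ : ∀ f q ℓ m → 4 ℕ.* f ℕ.* q ℕ.* (ℓ ℕ.* (q ℕ.* q ℕ.* q ℕ.* m)) ≡ q ℕ.* m ℕ.* (4 ℕ.* f ℕ.* (q ℕ.* q ℕ.* q) ℕ.* ℓ)
      lem₂ = solve-∀
    n≤ : n ≤ℕ 12 ℕ.* f ℕ.* (q ℕ.* q ℕ.* q) ℕ.* ℓ
    n≤ = begin
      n                     ≤⟨ n≤2m+1 ⟩
      1 ℕ.+ m ℕ.* 2         ≤⟨ ℕₚ.+-monoˡ-≤ (m ℕ.* 2) 1≤m ⟩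
      m ℕ.+ m ℕ.* 2         ≡⟨ lem₁ m ⟩
      3 ℕ.* m               ≤⟨ ℕₚ.*-monoʳ-≤ 3 m≤ ⟩
      3 ℕ.* (4 ℕ.* f ℕ.* (q ℕ.* q ℕ.* q) ℕ.* ℓ) ≡⟨ lem₂ f (q ℕ.* q ℕ.* q) ℓ ⟩
      12 ℕ.* f ℕ.* (q ℕ.* q ℕ.* q) ℕ.* ℓ ∎
      where
      lem₁ : ∀ m → m ℕ.+ m ℕ.* 2 ≡ 3 ℕ.* m
      lem₁ = solve-∀
      lem₂ : ∀ f Q ℓ → 3 ℕ.* (4 ℕ.* f ℕ.* Q ℕ.* ℓ) ≡ 12 ℕ.* f ℕ.* Q ℕ.* ℓ
      lem₂ = solve-∀

-- Choice of the constants.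

module Assembly where

  open PrimesInRange
  open Fractions
  open Estimates
  open import Data.Nat as ℕ using (ℕ; z≤n; s≤s) renaming (_≤_ to _≤ℕ_)
  import Data.Nat.Properties as ℕₚ
  open import Data.Nat.Primality using (Prime)
  open import Data.Nat.Tactic.RingSolver using (solve-∀)
  open import Data.Integer using (+_)
  open import Data.Rational using (ℚ; 0ℚ; 1ℚ; _/_; _+_; _*_; _-_; -_; _≤_; _<_)
  import Data.Rational.Properties as ℚₚ

  0<1ℚ : 0ℚ < 1ℚ
  0<1ℚ = 1/-positive 1

  ≤-minus⇒+-≤ : ∀ {x y z} → x ≤ y - z → x + z ≤ y
  ≤-minus⇒+-≤ {x} {y} {z} h = begin
    x + z            ≤⟨ ℚₚ.+-monoˡ-≤ z h ⟩
    y - z + z        ≡⟨ ℚₚ.+-assoc y (- z) z ⟩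
    y + (- z + z)    ≡⟨ cong (λ w → y + w) (ℚₚ.+-inverseˡ z) ⟩
    y + 0ℚ           ≡⟨ ℚₚ.+-identityʳ y ⟩
    y                ∎
    where open ℚₚ.≤-Reasoning

  diam2-Θ : Σ ℚ λ C → (0ℚ < C) × ((η : ℚ) → 0ℚ < η →
      Σ ℚ λ c → (0ℚ < c) × Σ ℕ λ N → (n : ℕ) → N ≤ℕ n →
      (ε : ℚ) → 0ℚ ≤ ε → ε ≤ (+ 1 / 4) - η →
      P≥ n ε 2 (c * ℕtoℚ n) × P≤ n ε 2 (C * ℕtoℚ n))
  diam2-Θ = 1ℚ , 0<1ℚ , λ η 0<η →
    let g , f , H = toFrac η (ℚₚ.<⇒≤ 0<η)
        -- At x = 4096 + 32f the bound x ≤ 32q makes q at least f, the denominator of η.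
        q , pr , _ , x≤32q = prime-below (4096 ℕ.+ 32 ℕ.* f) (ℕₚ.m≤m+n 4096 (32 ℕ.* f))
    in constants η 0<η g f H q pr (ℕₚ.*-cancelˡ-≤ 32 (ℕₚ.≤-trans (ℕₚ.m≤n+m (32 ℕ.* f) 4096) x≤32q))
    where
    constants : ∀ η → 0ℚ < η → ∀ g f → Frac η g f → ∀ q → Prime q → f ≤ℕ q →
      Σ ℚ λ c → (0ℚ < c) × Σ ℕ λ N → (n : ℕ) → N ≤ℕ n →
      (ε : ℚ) → 0ℚ ≤ ε → ε ≤ (+ 1 / 4) - η →
      P≥ n ε 2 (c * ℕtoℚ n) × P≤ n ε 2 (1ℚ * ℕtoℚ n)
    constants η 0<η g f H q pr f≤q = + 1 / D , 1/-positive D , 2 ℕ.* f ℕ.+ 2 , λ n N≤n ε 0≤ε ε≤ →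
        (λ ℓ part → let a , b , F = toFrac ε 0≤ε in lower n ℓ (diam2-lower pr F (Frac-positive⇒ H 0<η) f≤q N≤n
          (ℕₚ.≤-trans (Frac-≤⇒ (Frac-+ F H) (Frac-/ 1 4) (≤-minus⇒+-≤ ε≤)) (ℕₚ.≤-reflexive (ℕₚ.*-identityˡ _))) part))
      , diam2-upper n 0≤ε
      where
      1≤q : 1 ≤ℕ q
      1≤q = ℕₚ.≤-trans (s≤s z≤n) (prime>1 pr)
      D : ℕ
      D = 12 ℕ.* f ℕ.* (q ℕ.* q ℕ.* q)
      instance
        D≢0 : ℕ.NonZero D
        D≢0 = ℕ.>-nonZero (ℕₚ.*-mono-≤ (ℕₚ.*-mono-≤ {1} {12} (s≤s z≤n) (1≤b H)) (ℕₚ.*-mono-≤ (ℕₚ.*-mono-≤ 1≤q 1≤q) 1≤q))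
      lower : ∀ n ℓ → n ≤ℕ D ℕ.* ℓ → (+ 1 / D) * ℕtoℚ n ≤ ℕtoℚ ℓ
      lower n ℓ h = Frac-≤⇐ (Frac-* (Frac-/ 1 D) (Frac-ℕ n)) (Frac-ℕ ℓ)
        (ℕₚ.≤-trans (ℕₚ.≤-reflexive (lem₁ n)) (ℕₚ.≤-trans h (ℕₚ.≤-reflexive (lem₂ D ℓ))))
        where
        lem₁ : ∀ n → 1 ℕ.* n ℕ.* 1 ≡ n
        lem₁ = solve-∀
        lem₂ : ∀ D ℓ → D ℕ.* ℓ ≡ ℓ ℕ.* (D ℕ.* 1)
        lem₂ = solve-∀

  1/M≤ : ∀ M .{{_ : ℕ.NonZero M}} ℓ {δ a b} → Frac δ a b → b ≤ℕ M ℕ.* (ℓ ℕ.* a) → + 1 / M ≤ ℕtoℚ ℓ * δ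
  1/M≤ M ℓ {a = a} {b} F h = Frac-≤⇐ (Frac-/ 1 M) (Frac-* (Frac-ℕ ℓ) F)
      (ℕₚ.≤-trans (ℕₚ.≤-reflexive (lem₁ b)) (ℕₚ.≤-trans h (ℕₚ.≤-reflexive (ℕₚ.*-comm M (ℓ ℕ.* a)))))
    where
    lem₁ : ∀ b → 1 ℕ.* (1 ℕ.* b) ≡ b
    lem₁ = solve-∀

  ≤1/K : ∀ K .{{_ : ℕ.NonZero K}} {ε a b} → Frac ε a b → ε ≤ + 1 / K → K ℕ.* a ≤ℕ b
  ≤1/K K {a = a} {b} F h = ℕₚ.≤-trans (ℕₚ.≤-reflexive (ℕₚ.*-comm K a))
    (ℕₚ.≤-trans (Frac-≤⇒ F (Frac-/ 1 K) h) (ℕₚ.≤-reflexive (ℕₚ.*-identityˡ b)))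

  1≤n*⇒ : ∀ n {δ a b} → Frac δ a b → 1ℚ ≤ ℕtoℚ n * δ → b ≤ℕ n ℕ.* a
  1≤n*⇒ n {b = b} F h = ℕₚ.≤-trans (ℕₚ.≤-reflexive (lem₁ b))
      (ℕₚ.≤-trans (Frac-≤⇒ (Frac-ℕ 1) (Frac-* (Frac-ℕ n) F) h) (ℕₚ.≤-reflexive (ℕₚ.*-identityʳ _)))
    where
    lem₁ : ∀ b → b ≡ 1 ℕ.* (1 ℕ.* b)
    lem₁ = solve-∀

  diam3-Θ : Σ ℚ λ ε₀ → (0ℚ < ε₀) × Σ ℚ λ c → (0ℚ < c) × Σ ℚ λ C → (0ℚ < C) ×
      ((n : ℕ) (ε : ℚ) → 0ℚ ≤ ε → 1ℚ ≤ ℕtoℚ n * (ε * ε) → ε ≤ ε₀ →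
      ((ℓ : ℕ) → Partitionable n ε 3 ℓ → c ≤ ℕtoℚ ℓ * (ε * ε))
      × (∃ λ ℓ → Partitionable n ε 3 ℓ × (ℕtoℚ ℓ * (ε * ε) ≤ C)))
  diam3-Θ = constants (4096 ℕ.* 32) (2048 ℕ.* 2048 ℕ.* 10) refl refl
    where
    -- K keeps 1/(32ε) at 4096 or more, and M combines b ≤ 2048ap with p² ≤ 10ℓ. Both stay
    -- variables, so that fractions with these denominators are handled without evaluating large
    -- numerals.
    constants : ∀ K M → .{{_ : ℕ.NonZero K}} → .{{_ : ℕ.NonZero M}} → K ≡ 4096 ℕ.* 32 → M ≡ 2048 ℕ.* 2048 ℕ.* 10 →
      Σ ℚ λ ε₀ → (0ℚ < ε₀) × Σ ℚ λ c → (0ℚ < c) × Σ ℚ λ C → (0ℚ < C) ×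
      ((n : ℕ) (ε : ℚ) → 0ℚ ≤ ε → 1ℚ ≤ ℕtoℚ n * (ε * ε) → ε ≤ ε₀ →
      ((ℓ : ℕ) → Partitionable n ε 3 ℓ → c ≤ ℕtoℚ ℓ * (ε * ε))
      × (∃ λ ℓ → Partitionable n ε 3 ℓ × (ℕtoℚ ℓ * (ε * ε) ≤ C)))
    constants K M K≡ M≡ = + 1 / K , 1/-positive K , + 1 / M , 1/-positive M , 1ℚ , 0<1ℚ , λ n ε 0≤ε 1≤nε² ε≤ →
      let a , b , F = toFrac ε 0≤ε
          F² = Frac-* F F
          b²≤na² = 1≤n*⇒ n F² 1≤nε²
          1≤a = 1≤product⇒1≤ a (1≤product⇒1≤ n (1≤b F²) b²≤na²) ℕₚ.≤-refl
          Ka≤b = ≤1/K K F ε≤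
      in (λ ℓ part → 1/M≤ M ℓ F² (subst (λ z → b ℕ.* b ≤ℕ z ℕ.* (ℓ ℕ.* (a ℕ.* a))) (sym M≡)
           (diam3-lower F 1≤a b²≤na²
             (ℕₚ.≤-trans (ℕₚ.≤-reflexive (trans (sym (ℕₚ.*-assoc 4096 32 a)) (cong (ℕ._* a) (sym K≡)))) Ka≤b) part)))
       , diam3-upper F 1≤a

  diam4-Θ : Σ ℚ λ ε₀ → (0ℚ < ε₀) × Σ ℚ λ c → (0ℚ < c) × Σ ℚ λ C → (0ℚ < C) ×
      ((n : ℕ) (ε : ℚ) → 0ℚ ≤ ε → 1ℚ ≤ ℕtoℚ n * ε → ε ≤ ε₀ →
      ((ℓ : ℕ) → Partitionable n ε 4 ℓ → c ≤ ℕtoℚ ℓ * ε)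
      × (∃ λ ℓ → Partitionable n ε 4 ℓ × (ℕtoℚ ℓ * ε ≤ C)))
  diam4-Θ = + 1 / 32 , 1/-positive 32 , + 1 / 128 , 1/-positive 128 , 1ℚ , 0<1ℚ , λ n ε 0≤ε 1≤nε ε≤ →
      let a , b , F = toFrac ε 0≤ε
          b≤na = 1≤n*⇒ n F 1≤nε
          1≤a = 1≤product⇒1≤ n (1≤b F) b≤na
      in (λ ℓ part → 1/M≤ 128 ℓ F (diam4-lower F 1≤a b≤na (≤1/K 32 F ε≤) part)) , diam4-upper F 1≤a

open import Data.Nat using (ℕ) renaming (_≤_ to _≤ℕ_)
open import Data.Integer using (+_)
open import Data.Rational using (ℚ; 0ℚ; 1ℚ; _/_; _*_; _-_; _≤_; _<_)
open Assembly using (diam2-Θ; diam3-Θ; diam4-Θ)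

theorem1p2 : (Σ ℚ λ C → (0ℚ < C) × ((η : ℚ) → 0ℚ < η →
    Σ ℚ λ c → (0ℚ < c) × Σ ℕ λ N → (n : ℕ) → N ≤ℕ n →
    (ε : ℚ) → 0ℚ ≤ ε → ε ≤ (+ 1 / 4) - η →
    P≥ n ε 2 (c * ℕtoℚ n) × P≤ n ε 2 (C * ℕtoℚ n)))
    × (Σ ℚ λ ε₀ → (0ℚ < ε₀) × Σ ℚ λ c → (0ℚ < c) × Σ ℚ λ C → (0ℚ < C) ×
    ((n : ℕ) (ε : ℚ) → 0ℚ ≤ ε → 1ℚ ≤ ℕtoℚ n * (ε * ε) → ε ≤ ε₀ →
    ((ℓ : ℕ) → Partitionable n ε 3 ℓ → c ≤ ℕtoℚ ℓ * (ε * ε))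
    × (∃ λ ℓ → Partitionable n ε 3 ℓ × (ℕtoℚ ℓ * (ε * ε) ≤ C))))
    × (Σ ℚ λ ε₀ → (0ℚ < ε₀) × Σ ℚ λ c → (0ℚ < c) × Σ ℚ λ C → (0ℚ < C) ×
    ((n : ℕ) (ε : ℚ) → 0ℚ ≤ ε → 1ℚ ≤ ℕtoℚ n * ε → ε ≤ ε₀ →
    ((ℓ : ℕ) → Partitionable n ε 4 ℓ → c ≤ ℕtoℚ ℓ * ε)
    × (∃ λ ℓ → Partitionable n ε 4 ℓ × (ℕtoℚ ℓ * ε ≤ C))))
theorem1p2 = diam2-Θ , diam3-Θ , diam4-Θ
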